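{- Let $p$ be a prime, let $\mathbb{Z}/p\mathbb{Z}$ be equipped with a metric group structure, and let $E\colon\mathbb{Z}/p\mathbb{Z}\to\mathbb{C}$ be a finite quantum dilogarithm. Then $E(u)\in\overline{\mathbb{Q}}$ for all $u\in\mathbb{Z}/p\mathbb{Z}$.
   Context: A metric group is a finite abelian group $G$ together with a function $\langle\cdot\rangle\colon G\to\mathbb{C}^\times$ such that $\langle x\rangle=\langle -x\rangle$ for all $x$ and $\langle x;y\rangle:=\dfrac{\langle x+y\rangle}{\langle x\rangle\langle y\rangle}$ is a non-degenerate bicharacter on $G$. Let $N=|G|$. A finite quantum dilogarithm for a metric group $G$ is a function $E\colon G\to\mathbb{C}$ such that for some non-zero constant $C\in\mathbb{C}^\times$ and all $x,y\in G$, $$\langle x;y\rangle E(x)E(y)=C+\frac1{\sqrt N}\sum_{z\in G}E(y-z)E(z)\langle z\rangle E(x-z),$$ and which, when $|G|\le4$, is in addition required to satisfy $E(0)^2=\sqrt{N}\,E(0)+1$. -}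

module Defs where

open import Algebra.Bundles.Raw using (RawRing)
open import Algebra.Structures using (IsAbelianGroup)
import Algebra.Definitions.RawSemiring as RawSemiringDefinitions
open import Data.Bool.Base using (if_then_else_)
open import Data.Fin.Base as Fin using (Fin; toℕ)
import Data.Fin.Properties as Fin
open import Data.Integer.Base as ℤ using (+_; -[1+_])
import Data.Integer.Properties as ℤ
open import Data.Nat.Base as ℕ using (ℕ; zero; suc)
open import Data.Nat.DivMod using (_%_; _mod_; m%n<n; m<n⇒m%n≡m; n%n≡0; %-distribˡ-+)
import Data.Nat.Properties as ℕ
open import Data.Product.Base using (Σ; ∃-syntax; _×_; _,_; proj₁; proj₂)
open import Data.Rational.Base as ℚ using (ℚ; 0ℚ; 1ℚ; ½; ∣_∣; 1/_; toℚᵘ; Positive; NonNegative)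
import Data.Rational.Properties as ℚ
open import Data.Rational.Solver using (module +-*-Solver)
open import Data.Rational.Unnormalised.Base as ℚᵘ using (mkℚᵘ)
import Data.Rational.Unnormalised.Properties as ℚᵘ
open import Data.Sum.Base using (inj₁; inj₂)
open import Function.Base using (_∘_)
open import Function.Bundles using (_↔_; Inverse)
open import Function.Construct.Identity using (↔-id)
open import Level using (0ℓ)
open import Relation.Binary.PropositionalEquality
open import Relation.Nullary.Decidable.Core using (Dec; does; yes; no)

private
  open +-*-Solver using (solve; _:+_; _:*_; _:-_; :-_; _:=_; con)

  ∣p∣≤q : ∀ p q → p ℚ.≤ q → ℚ.- p ℚ.≤ q → ∣ p ∣ ℚ.≤ q
  ∣p∣≤q p q p≤q -p≤q with ℚ.∣p∣≡p∨∣p∣≡-p p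
  ... | inj₁ eq = subst (ℚ._≤ q) (sym eq) p≤q
  ... | inj₂ eq = subst (ℚ._≤ q) (sym eq) -p≤q

  p≤p+q : ∀ p q → 0ℚ ℚ.≤ q → p ℚ.≤ p ℚ.+ q
  p≤p+q p q 0≤q = subst (ℚ._≤ p ℚ.+ q) (ℚ.+-identityʳ p) (ℚ.+-monoʳ-≤ p 0≤q)

  half-+ : ∀ ε → ε ℚ.* ½ ℚ.+ ε ℚ.* ½ ≡ ε
  half-+ = solve 1 (λ ε → ε :* con ½ :+ ε :* con ½ := ε) refl

  half-pos : ∀ {ε} → 0ℚ ℚ.< ε → 0ℚ ℚ.< ε ℚ.* ½
  half-pos {ε} 0<ε = subst (ℚ._< ε ℚ.* ½) (ℚ.*-zeroˡ ½) (ℚ.*-monoˡ-<-pos ½ 0<ε)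

  *-pos : ∀ {p q} → 0ℚ ℚ.< p → 0ℚ ℚ.< q → 0ℚ ℚ.< p ℚ.* q
  *-pos {p} {q} 0<p 0<q =
    subst (ℚ._< p ℚ.* q) (ℚ.*-zeroˡ q) (ℚ.*-monoˡ-<-pos q {{ℚ.positive 0<q}} 0<p)

  *-nonNeg : ∀ {p q} → 0ℚ ℚ.≤ p → 0ℚ ℚ.≤ q → 0ℚ ℚ.≤ p ℚ.* q
  *-nonNeg {p} {q} 0≤p 0≤q =
    subst (ℚ._≤ p ℚ.* q) (ℚ.*-zeroˡ q) (ℚ.*-monoʳ-≤-nonNeg q {{ℚ.nonNegative 0≤q}} 0≤p)

  ratio : ∀ {ε B} → 0ℚ ℚ.< ε → 0ℚ ℚ.< B → ∃[ δ ] 0ℚ ℚ.< δ × B ℚ.* δ ≡ ε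
  ratio {ε} {B} 0<ε 0<B = ε ℚ.* B⁻¹ , *-pos 0<ε (ℚ.positive⁻¹ B⁻¹ {{ℚ.1/pos⇒pos B}}) , eq
    where
    instance
      B-pos = ℚ.positive 0<B
      B-nonZero = ℚ.pos⇒nonZero B
    B⁻¹ = 1/ B
    eq : B ℚ.* (ε ℚ.* B⁻¹) ≡ ε
    eq = begin
      B ℚ.* (ε ℚ.* B⁻¹) ≡⟨ solve 3 (λ a b c → a :* (b :* c) := b :* (a :* c)) refl B ε B⁻¹ ⟩
      ε ℚ.* (B ℚ.* B⁻¹) ≡⟨ cong (ε ℚ.*_) (ℚ.*-inverseʳ B) ⟩
      ε ℚ.* 1ℚ          ≡⟨ ℚ.*-identityʳ ε ⟩
      ε                 ∎
      where open ≡-Reasoning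

  1+ι : ℕ → ℚ
  1+ι zero    = 1ℚ
  1+ι (suc n) = 1ℚ ℚ.+ 1+ι n

  1≤1+ι : ∀ n → 1ℚ ℚ.≤ 1+ι n
  1≤1+ι zero    = ℚ.≤-refl
  1≤1+ι (suc n) = p≤p+q 1ℚ (1+ι n) (ℚ.≤-trans (ℚ.nonNegative⁻¹ 1ℚ) (1≤1+ι n))

  toℚᵘ-1+ι : ∀ n → toℚᵘ (1+ι n) ℚᵘ.≃ mkℚᵘ (+ suc n) 0
  toℚᵘ-1+ι zero    = ℚᵘ.≃-refl
  toℚᵘ-1+ι (suc n) = ℚᵘ.≃-trans (ℚ.toℚᵘ-homo-+ 1ℚ (1+ι n))
    (ℚᵘ.≃-trans (ℚᵘ.+-congʳ ℚᵘ.1ℚᵘ (toℚᵘ-1+ι n)) (ℚᵘ.*≡* (cong (λ m → + m ℤ.* + 1)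
      (cong (ℕ.suc ∘ ℕ.suc) (ℕ.*-identityʳ n)))))

  archimedean : ∀ p → ∃[ n ] p ℚ.< 1+ι n
  archimedean p@(ℚ.mkℚ (+ n) d _) = n , ℚ.toℚᵘ-cancel-<
    (ℚᵘ.<-respʳ-≃ (ℚᵘ.≃-sym (toℚᵘ-1+ι n)) (ℚᵘ.*<* (subst₂ ℤ._<_
      (ℤ.pos-* n 1) (ℤ.pos-* (suc n) (suc d))
      (ℤ.+<+ (subst (ℕ._< suc n ℕ.* suc d) (sym (ℕ.*-identityʳ n))
        (ℕ.≤-trans (ℕ.n<1+n n) (ℕ.m≤m*n (suc n) (suc d))))))))
  archimedean p@(ℚ.mkℚ -[1+ n ] d _) = zero , ℚ.<-trans (ℚ.negative⁻¹ p) (ℚ.positive⁻¹ 1ℚ)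

  ½^_ : ℕ → ℚ
  ½^ zero  = 1ℚ
  ½^ suc k = ½^ k ℚ.* ½

  ½^-pos : ∀ k → 0ℚ ℚ.< ½^ k
  ½^-pos zero    = ℚ.positive⁻¹ 1ℚ
  ½^-pos (suc k) = half-pos (½^-pos k)

  1+ι*½^≤1 : ∀ k → 1+ι k ℚ.* ½^ k ℚ.≤ 1ℚ
  1+ι*½^≤1 zero    = ℚ.≤-refl
  1+ι*½^≤1 (suc k) = begin
    (1ℚ ℚ.+ a) ℚ.* (u ℚ.* ½)  ≤⟨ ℚ.*-monoʳ-≤-nonNeg (u ℚ.* ½)
                                   {{ℚ.nonNegative (ℚ.<⇒≤ (½^-pos (suc k)))}}
                                   (ℚ.+-monoˡ-≤ a (1≤1+ι k)) ⟩
    (a ℚ.+ a) ℚ.* (u ℚ.* ½)   ≡⟨ solve 2 (λ a u → (a :+ a) :* (u :* con ½) := a :* u) refl a u ⟩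
    a ℚ.* u                   ≤⟨ 1+ι*½^≤1 k ⟩
    1ℚ                        ∎
    where
    open ℚ.≤-Reasoning
    a = 1+ι k
    u = ½^ k

  small : ∀ {B ε} → 0ℚ ℚ.< B → 0ℚ ℚ.< ε → ∃[ k ] B ℚ.* ½^ k ℚ.< ε
  small {B} {ε} 0<B 0<ε = k , (begin-strict
    B ℚ.* u               ≡⟨ cong (ℚ._* u) εc≡B ⟨
    ε ℚ.* c ℚ.* u         ≡⟨ ℚ.*-assoc ε c u ⟩
    ε ℚ.* (c ℚ.* u)       <⟨ ℚ.*-monoʳ-<-pos ε {{ℚ.positive 0<ε}}
                               (ℚ.*-monoˡ-<-pos u {{ℚ.positive (½^-pos k)}} c<k) ⟩
    ε ℚ.* (1+ι k ℚ.* u)   ≤⟨ ℚ.*-monoˡ-≤-nonNeg ε {{ℚ.nonNegative (ℚ.<⇒≤ 0<ε)}} (1+ι*½^≤1 k) ⟩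
    ε ℚ.* 1ℚ              ≡⟨ ℚ.*-identityʳ ε ⟩
    ε                     ∎)
    where
    open ℚ.≤-Reasoning
    scaled = ratio 0<B 0<ε
    c = proj₁ scaled
    εc≡B = proj₂ (proj₂ scaled)
    k = proj₁ (archimedean c)
    c<k = proj₂ (archimedean c)
    u = ½^ k

record ℝ : Set where
  constructor mkℝ
  field
    seq    : ℕ → ℚ
    cauchy : ∀ {ε} → 0ℚ ℚ.< ε → ∃[ n₀ ] ∀ m n → n₀ ℕ.≤ m → n₀ ℕ.≤ n →
             ∣ seq m ℚ.- seq n ∣ ℚ.< ε

open ℝ public

infix 4 _≈ℝ_

record _≈ℝ_ (x y : ℝ) : Set where
  constructor mk≈ℝ
  field
    converge : ∀ {ε} → 0ℚ ℚ.< ε → ∃[ n₀ ] ∀ n → n₀ ℕ.≤ n →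
               ∣ seq x n ℚ.- seq y n ∣ ℚ.< ε

open _≈ℝ_ public

fromℚ : ℚ → ℝ
fromℚ q .seq _          = q
fromℚ q .cauchy {ε} 0<ε = 0 , λ _ _ _ _ → subst (λ p → ∣ p ∣ ℚ.< ε) (sym (ℚ.+-inverseʳ q)) 0<ε

infixl 6 _+ℝ_
infixl 7 _*ℝ_
infix  8 -ℝ_

_+ℝ_ : ℝ → ℝ → ℝ
(x +ℝ y) .seq n = seq x n ℚ.+ seq y n
(x +ℝ y) .cauchy {ε} 0<ε = a ℕ.⊔ b , close
  where
  open ℚ.≤-Reasoning
  a = proj₁ (cauchy x (half-pos 0<ε))
  b = proj₁ (cauchy y (half-pos 0<ε))
  x-close = proj₂ (cauchy x (half-pos 0<ε))
  y-close = proj₂ (cauchy y (half-pos 0<ε))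
  close : ∀ m n → a ℕ.⊔ b ℕ.≤ m → a ℕ.⊔ b ℕ.≤ n →
          ∣ (seq x m ℚ.+ seq y m) ℚ.- (seq x n ℚ.+ seq y n) ∣ ℚ.< ε
  close m n le₁ le₂ = begin-strict
    ∣ (x₁ ℚ.+ y₁) ℚ.- (x₂ ℚ.+ y₂) ∣
      ≡⟨ cong ∣_∣ (solve 4 (λ a b c d → (a :+ b) :- (c :+ d) := (a :- c) :+ (b :- d))
           refl x₁ y₁ x₂ y₂) ⟩
    ∣ (x₁ ℚ.- x₂) ℚ.+ (y₁ ℚ.- y₂) ∣
      ≤⟨ ℚ.∣p+q∣≤∣p∣+∣q∣ (x₁ ℚ.- x₂) (y₁ ℚ.- y₂) ⟩
    ∣ x₁ ℚ.- x₂ ∣ ℚ.+ ∣ y₁ ℚ.- y₂ ∣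
      <⟨ ℚ.+-mono-< (x-close m n (ℕ.m⊔n≤o⇒m≤o a b le₁) (ℕ.m⊔n≤o⇒m≤o a b le₂))
                    (y-close m n (ℕ.m⊔n≤o⇒n≤o a b le₁) (ℕ.m⊔n≤o⇒n≤o a b le₂)) ⟩
    ε ℚ.* ½ ℚ.+ ε ℚ.* ½
      ≡⟨ half-+ ε ⟩
    ε ∎
    where
    x₁ = seq x m
    x₂ = seq x n
    y₁ = seq y m
    y₂ = seq y n

-ℝ_ : ℝ → ℝ
(-ℝ x) .seq n = ℚ.- seq x n
(-ℝ x) .cauchy {ε} 0<ε = a , close
  where
  a = proj₁ (cauchy x 0<ε)
  x-close = proj₂ (cauchy x 0<ε)
  close : ∀ m n → a ℕ.≤ m → a ℕ.≤ n → ∣ ℚ.- seq x m ℚ.- (ℚ.- seq x n) ∣ ℚ.< ε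
  close m n le₁ le₂ = subst (ℚ._< ε)
    (trans (sym (ℚ.∣-p∣≡∣p∣ _))
      (cong ∣_∣ (solve 2 (λ a b → :- (a :- b) := :- a :- (:- b)) refl (seq x m) (seq x n))))
    (x-close m n le₁ le₂)

private
  bound : ∀ x → ∃[ n₀ ] ∃[ B ] 0ℚ ℚ.< B × (∀ n → n₀ ℕ.≤ n → ∣ seq x n ∣ ℚ.≤ B)
  bound x = a , ∣ l ∣ ℚ.+ 1ℚ , 0<B , le
    where
    a = proj₁ (cauchy x (ℚ.positive⁻¹ 1ℚ))
    x-close = proj₂ (cauchy x (ℚ.positive⁻¹ 1ℚ))
    l = seq x a
    0<B : 0ℚ ℚ.< ∣ l ∣ ℚ.+ 1ℚ
    0<B = ℚ.+-mono-≤-< (ℚ.0≤∣p∣ l) (ℚ.positive⁻¹ 1ℚ)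
    le : ∀ n → a ℕ.≤ n → ∣ seq x n ∣ ℚ.≤ ∣ l ∣ ℚ.+ 1ℚ
    le n a≤n = begin
      ∣ seq x n ∣                      ≡⟨ cong ∣_∣ (solve 2 (λ a b → a := b :+ (a :- b)) refl (seq x n) l) ⟩
      ∣ l ℚ.+ (seq x n ℚ.- l) ∣        ≤⟨ ℚ.∣p+q∣≤∣p∣+∣q∣ l (seq x n ℚ.- l) ⟩
      ∣ l ∣ ℚ.+ ∣ seq x n ℚ.- l ∣      ≤⟨ ℚ.+-monoʳ-≤ ∣ l ∣ (ℚ.<⇒≤ (x-close n a a≤n ℕ.≤-refl)) ⟩
      ∣ l ∣ ℚ.+ 1ℚ                     ∎
      where open ℚ.≤-Reasoning

  ∣p*q∣<B*δ : ∀ {B δ} p q → 0ℚ ℚ.< B → ∣ p ∣ ℚ.≤ B → ∣ q ∣ ℚ.< δ → ∣ p ℚ.* q ∣ ℚ.< B ℚ.* δ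
  ∣p*q∣<B*δ {B} {δ} p q 0<B p≤B q<δ = begin-strict
    ∣ p ℚ.* q ∣      ≡⟨ ℚ.∣p*q∣≡∣p∣*∣q∣ p q ⟩
    ∣ p ∣ ℚ.* ∣ q ∣  ≤⟨ ℚ.*-monoʳ-≤-nonNeg ∣ q ∣ {{ℚ.∣-∣-nonNeg q}} p≤B ⟩
    B ℚ.* ∣ q ∣      <⟨ ℚ.*-monoʳ-<-pos B {{ℚ.positive 0<B}} q<δ ⟩
    B ℚ.* δ          ∎
    where open ℚ.≤-Reasoning

  *ℝ-close : ∀ {x y : ℕ → ℚ} {A B δ ε} → 0ℚ ℚ.< A → 0ℚ ℚ.< B → (A ℚ.+ B) ℚ.* δ ≡ ε →
             ∀ a b c d →
             (∀ n → a ℕ.≤ n → ∣ x n ∣ ℚ.≤ A) →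
             (∀ n → b ℕ.≤ n → ∣ y n ∣ ℚ.≤ B) →
             (∀ m n → c ℕ.≤ m → c ℕ.≤ n → ∣ x m ℚ.- x n ∣ ℚ.< δ) →
             (∀ m n → d ℕ.≤ m → d ℕ.≤ n → ∣ y m ℚ.- y n ∣ ℚ.< δ) →
             let N = (a ℕ.⊔ b) ℕ.⊔ (c ℕ.⊔ d) in
             ∀ m n → N ℕ.≤ m → N ℕ.≤ n → ∣ x m ℚ.* y m ℚ.- x n ℚ.* y n ∣ ℚ.< ε
  *ℝ-close {x} {y} {A} {B} {δ} {ε} 0<A 0<B [A+B]δ≡ε a b c d x≤A y≤B x-close y-close = close
    where
    open ℚ.≤-Reasoning
    N = (a ℕ.⊔ b) ℕ.⊔ (c ℕ.⊔ d)
    a≤ : ∀ {n} → N ℕ.≤ n → a ℕ.≤ n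
    a≤ le = ℕ.m⊔n≤o⇒m≤o a b (ℕ.m⊔n≤o⇒m≤o _ (c ℕ.⊔ d) le)
    b≤ : ∀ {n} → N ℕ.≤ n → b ℕ.≤ n
    b≤ le = ℕ.m⊔n≤o⇒n≤o a b (ℕ.m⊔n≤o⇒m≤o _ (c ℕ.⊔ d) le)
    c≤ : ∀ {n} → N ℕ.≤ n → c ℕ.≤ n
    c≤ le = ℕ.m⊔n≤o⇒m≤o c d (ℕ.m⊔n≤o⇒n≤o (a ℕ.⊔ b) _ le)
    d≤ : ∀ {n} → N ℕ.≤ n → d ℕ.≤ n
    d≤ le = ℕ.m⊔n≤o⇒n≤o c d (ℕ.m⊔n≤o⇒n≤o (a ℕ.⊔ b) _ le)
    close : ∀ m n → N ℕ.≤ m → N ℕ.≤ n → ∣ x m ℚ.* y m ℚ.- x n ℚ.* y n ∣ ℚ.< ε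
    close m n le₁ le₂ = begin-strict
      ∣ x₁ ℚ.* y₁ ℚ.- x₂ ℚ.* y₂ ∣
        ≡⟨ cong ∣_∣ (solve 4 (λ a b c d → a :* b :- c :* d := a :* (b :- d) :+ d :* (a :- c))
             refl x₁ y₁ x₂ y₂) ⟩
      ∣ x₁ ℚ.* (y₁ ℚ.- y₂) ℚ.+ y₂ ℚ.* (x₁ ℚ.- x₂) ∣
        ≤⟨ ℚ.∣p+q∣≤∣p∣+∣q∣ (x₁ ℚ.* (y₁ ℚ.- y₂)) (y₂ ℚ.* (x₁ ℚ.- x₂)) ⟩
      ∣ x₁ ℚ.* (y₁ ℚ.- y₂) ∣ ℚ.+ ∣ y₂ ℚ.* (x₁ ℚ.- x₂) ∣
        <⟨ ℚ.+-mono-<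
             (∣p*q∣<B*δ x₁ (y₁ ℚ.- y₂) 0<A (x≤A m (a≤ le₁)) (y-close m n (d≤ le₁) (d≤ le₂)))
             (∣p*q∣<B*δ y₂ (x₁ ℚ.- x₂) 0<B (y≤B n (b≤ le₂)) (x-close m n (c≤ le₁) (c≤ le₂))) ⟩
      A ℚ.* δ ℚ.+ B ℚ.* δ
        ≡⟨ ℚ.*-distribʳ-+ δ A B ⟨
      (A ℚ.+ B) ℚ.* δ
        ≡⟨ [A+B]δ≡ε ⟩
      ε ∎
      where
      x₁ = x m
      x₂ = x n
      y₁ = y m
      y₂ = y n

_*ℝ_ : ℝ → ℝ → ℝ
(x *ℝ y) .seq n = seq x n ℚ.* seq y n
(x *ℝ y) .cauchy {ε} 0<ε =
  let a , A , 0<A , x≤A  = bound x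
      b , B , 0<B , y≤B  = bound y
      δ , 0<δ , [A+B]δ≡ε = ratio 0<ε (ℚ.+-mono-< 0<A 0<B)
      c , x-close        = cauchy x 0<δ
      d , y-close        = cauchy y 0<δ
  in (a ℕ.⊔ b) ℕ.⊔ (c ℕ.⊔ d) ,
     *ℝ-close 0<A 0<B [A+B]δ≡ε a b c d x≤A y≤B x-close y-close

-- Bisection: root q k ≤ √q ≤ root q k + gap q k, the gap halving at each step.

gap : ℚ → ℕ → ℚ
gap q k = (q ℚ.+ 1ℚ) ℚ.* ½^ k

root : ℚ → ℕ → ℚ
root q zero    = 0ℚ
root q (suc k) =
  let r = root q k ℚ.+ gap q (suc k) in
  if does (r ℚ.* r ℚ.≤? q) then r else root q k

private
  root-elim : ∀ {ℓ} (P : ℚ → Set ℓ) q k →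
    let r = root q k ℚ.+ gap q (suc k) in
    (r ℚ.* r ℚ.≤ q → P r) → (q ℚ.≤ r ℚ.* r → P (root q k)) → P (root q (suc k))
  root-elim P q k = elim (r ℚ.* r ℚ.≤? q)
    where
    r = root q k ℚ.+ gap q (suc k)
    elim : (d : Dec (r ℚ.* r ℚ.≤ q)) → (r ℚ.* r ℚ.≤ q → P r) →
           (q ℚ.≤ r ℚ.* r → P (root q k)) → P (if does d then r else root q k)
    elim (yes le) f g = f le
    elim (no ≰q)  f g = g (ℚ.<⇒≤ (ℚ.≰⇒> ≰q))

module _ (q : ℚ) .{{_ : NonNegative q}} where

  private
    0≤q : 0ℚ ℚ.≤ q
    0≤q = ℚ.nonNegative⁻¹ q

    0<q+1 : 0ℚ ℚ.< q ℚ.+ 1ℚ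
    0<q+1 = ℚ.+-mono-≤-< 0≤q (ℚ.positive⁻¹ 1ℚ)

    0≤gap : ∀ k → 0ℚ ℚ.≤ gap q k
    0≤gap k = ℚ.<⇒≤ (*-pos 0<q+1 (½^-pos k))

    upper : ℕ → ℚ
    upper k = root q k ℚ.+ gap q k

    upper-half : ∀ k → (root q k ℚ.+ gap q (suc k)) ℚ.+ gap q (suc k) ≡ upper k
    upper-half k = solve 3 (λ r a u → (r :+ a :* (u :* con ½)) :+ a :* (u :* con ½) := r :+ a :* u)
      refl (root q k) (q ℚ.+ 1ℚ) (½^ k)

    root-step : ∀ k → root q k ℚ.≤ root q (suc k)
    root-step k = root-elim (root q k ℚ.≤_) q k
      (λ _ → p≤p+q (root q k) (gap q (suc k)) (0≤gap (suc k)))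
      (λ _ → ℚ.≤-refl)

    upper-step : ∀ k → upper (suc k) ℚ.≤ upper k
    upper-step k = root-elim (λ r → r ℚ.+ gap q (suc k) ℚ.≤ upper k) q k
      (λ _ → ℚ.≤-reflexive (upper-half k))
      (λ _ → ℚ.≤-trans
        (p≤p+q (root q k ℚ.+ gap q (suc k)) (gap q (suc k)) (0≤gap (suc k)))
        (ℚ.≤-reflexive (upper-half k)))

    root-mono : ∀ j k → root q k ℚ.≤ root q (j ℕ.+ k)
    root-mono zero    k = ℚ.≤-refl
    root-mono (suc j) k = ℚ.≤-trans (root-mono j k) (root-step (j ℕ.+ k))

    upper-anti : ∀ j k → upper (j ℕ.+ k) ℚ.≤ upper k
    upper-anti zero    k = ℚ.≤-refl
    upper-anti (suc j) k = ℚ.≤-trans (upper-step (j ℕ.+ k)) (upper-anti j k)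

    lower : ∀ {k m} → k ℕ.≤ m → root q k ℚ.≤ root q m
    lower {k} {m} k≤m = subst (λ i → root q k ℚ.≤ root q i) (ℕ.m∸n+n≡m k≤m) (root-mono (m ℕ.∸ k) k)

    below : ∀ {k m} → k ℕ.≤ m → root q m ℚ.≤ upper k
    below {k} {m} k≤m = ℚ.≤-trans (p≤p+q (root q m) (gap q m) (0≤gap m))
      (subst (λ i → upper i ℚ.≤ upper k) (ℕ.m∸n+n≡m k≤m) (upper-anti (m ℕ.∸ k) k))

    diff : ∀ {l h a b} → a ℚ.≤ l ℚ.+ h → l ℚ.≤ b → a ℚ.- b ℚ.≤ h
    diff {l} {h} {a} {b} a≤ l≤ = ℚ.≤-trans (ℚ.+-mono-≤ a≤ (ℚ.neg-antimono-≤ l≤))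
      (ℚ.≤-reflexive (solve 2 (λ l h → (l :+ h) :- l := h) refl l h))

    root-close : ∀ {k} m n → k ℕ.≤ m → k ℕ.≤ n → ∣ root q m ℚ.- root q n ∣ ℚ.≤ gap q k
    root-close {k} m n k≤m k≤n = ∣p∣≤q _ _
      (diff (below k≤m) (lower k≤n))
      (subst (ℚ._≤ gap q k)
        (solve 2 (λ a b → b :- a := :- (a :- b)) refl (root q m) (root q n))
        (diff (below k≤n) (lower k≤m)))

    root²≤q : ∀ k → root q k ℚ.* root q k ℚ.≤ q
    root²≤q zero = 0≤q
    root²≤q (suc k) = root-elim (λ r → r ℚ.* r ℚ.≤ q) q k (λ le → le) (λ _ → root²≤q k)

    q≤upper² : ∀ k → q ℚ.≤ upper k ℚ.* upper k
    q≤upper² zero = subst (q ℚ.≤_)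
      (solve 1 (λ q → q :+ (q :+ (q :* q :+ con 1ℚ)) :=
        (con 0ℚ :+ (q :+ con 1ℚ) :* con 1ℚ) :* (con 0ℚ :+ (q :+ con 1ℚ) :* con 1ℚ)) refl q)
      (p≤p+q q _ (ℚ.+-mono-≤ 0≤q (ℚ.+-mono-≤ (*-nonNeg 0≤q 0≤q) (ℚ.nonNegative⁻¹ 1ℚ))))
    q≤upper² (suc k) = root-elim
      (λ r → q ℚ.≤ (r ℚ.+ gap q (suc k)) ℚ.* (r ℚ.+ gap q (suc k))) q k
      (λ _ → subst (λ u → q ℚ.≤ u ℚ.* u) (sym (upper-half k)) (q≤upper² k))
      (λ le → le)

    root²-close : ∀ k → ∣ root q k ℚ.* root q k ℚ.- q ∣ ℚ.≤
                        ((q ℚ.+ 1ℚ) ℚ.* (upper 0 ℚ.+ upper 0)) ℚ.* ½^ k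
    root²-close k = ∣p∣≤q _ _
      (ℚ.≤-trans (ℚ.≤-trans (ℚ.+-monoˡ-≤ (ℚ.- q) (root²≤q k)) (ℚ.≤-reflexive (ℚ.+-inverseʳ q)))
        (*-nonNeg (*-nonNeg (ℚ.<⇒≤ 0<q+1) (ℚ.+-mono-≤ 0≤upper 0≤upper)) (ℚ.<⇒≤ (½^-pos k))))
      (begin
        ℚ.- (r ℚ.* r ℚ.- q)
          ≡⟨ solve 2 (λ r q → :- (r :* r :- q) := q :- r :* r) refl r q ⟩
        q ℚ.- r ℚ.* r
          ≤⟨ ℚ.+-monoˡ-≤ (ℚ.- (r ℚ.* r)) (q≤upper² k) ⟩
        (r ℚ.+ g) ℚ.* (r ℚ.+ g) ℚ.- r ℚ.* r
          ≡⟨ solve 2 (λ r g → (r :+ g) :* (r :+ g) :- r :* r := g :* (r :+ (r :+ g))) refl r g ⟩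
        g ℚ.* (r ℚ.+ (r ℚ.+ g))
          ≤⟨ ℚ.*-monoˡ-≤-nonNeg g {{ℚ.nonNegative (0≤gap k)}}
               (ℚ.+-mono-≤ (below {0} {k} ℕ.z≤n) (subst (λ i → upper i ℚ.≤ upper 0) (ℕ.+-identityʳ k) (upper-anti k 0))) ⟩
        g ℚ.* (upper 0 ℚ.+ upper 0)
          ≡⟨ solve 3 (λ a u v → (a :* u) :* v := (a :* v) :* u) refl (q ℚ.+ 1ℚ) (½^ k) (upper 0 ℚ.+ upper 0) ⟩
        ((q ℚ.+ 1ℚ) ℚ.* (upper 0 ℚ.+ upper 0)) ℚ.* ½^ k ∎)
      where
      open ℚ.≤-Reasoning
      r = root q k
      g = gap q k
      0≤upper : 0ℚ ℚ.≤ upper 0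
      0≤upper = below {0} {0} ℕ.z≤n

  √_ : ℝ
  √_ .seq = root q
  √_ .cauchy {ε} 0<ε =
    let k , gap<ε = small 0<q+1 0<ε in
    k , λ m n k≤m k≤n → ℚ.≤-<-trans (root-close m n k≤m k≤n) gap<ε

  √-nonNeg : ∀ k → 0ℚ ℚ.≤ seq √_ k
  √-nonNeg k = lower {0} {k} ℕ.z≤n

  √-seq² : ∀ {ε} → 0ℚ ℚ.< ε → ∃[ n₀ ] ∀ n → n₀ ℕ.≤ n → ∣ seq √_ n ℚ.* seq √_ n ℚ.- q ∣ ℚ.< ε
  √-seq² {ε} 0<ε =
    let k , lt = small 0<B 0<ε in
    k , λ n k≤n → ℚ.≤-<-trans (root²-close n) (ℚ.≤-<-trans (mono k n k≤n) lt)
    where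
    B = (q ℚ.+ 1ℚ) ℚ.* (upper 0 ℚ.+ upper 0)
    0<upper : 0ℚ ℚ.< upper 0
    0<upper = subst (0ℚ ℚ.<_) (solve 1 (λ a → a := con 0ℚ :+ a :* con 1ℚ) refl (q ℚ.+ 1ℚ)) 0<q+1
    0<B : 0ℚ ℚ.< B
    0<B = *-pos 0<q+1 (ℚ.+-mono-< 0<upper 0<upper)
    ½^-anti : ∀ j k → ½^ (j ℕ.+ k) ℚ.≤ ½^ k
    ½^-anti zero    k = ℚ.≤-refl
    ½^-anti (suc j) k = ℚ.≤-trans
      (subst (½^ (j ℕ.+ k) ℚ.* ½ ℚ.≤_) (half-+ (½^ (j ℕ.+ k)))
        (p≤p+q _ _ (ℚ.<⇒≤ (half-pos (½^-pos (j ℕ.+ k))))))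
      (½^-anti j k)
    mono : ∀ k n → k ℕ.≤ n → B ℚ.* ½^ n ℚ.≤ B ℚ.* ½^ k
    mono k n k≤n = ℚ.*-monoˡ-≤-nonNeg B {{ℚ.nonNegative (ℚ.<⇒≤ 0<B)}}
      (subst (λ i → ½^ i ℚ.≤ ½^ k) (ℕ.m∸n+n≡m k≤n) (½^-anti (n ℕ.∸ k) k))

record ℂ : Set where
  constructor _+i_
  field
    re im : ℝ

open ℂ public

infix 4 _≈ℂ_

record _≈ℂ_ (z w : ℂ) : Set where
  constructor _,_
  field
    re≈ : re z ≈ℝ re w
    im≈ : im z ≈ℝ im w

open _≈ℂ_ public

realℂ : ℝ → ℂ
realℂ x = x +i fromℚ 0ℚ

rationalℂ : ℚ → ℂ
rationalℂ = realℂ ∘ fromℚ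

ℂ-rawRing : RawRing 0ℓ 0ℓ
ℂ-rawRing = record
  { Carrier = ℂ
  ; _≈_     = _≈ℂ_
  ; _+_     = λ z w → (re z +ℝ re w) +i (im z +ℝ im w)
  ; _*_     = λ z w → (re z *ℝ re w +ℝ -ℝ (im z *ℝ im w)) +i (re z *ℝ im w +ℝ im z *ℝ re w)
  ; -_      = λ z → (-ℝ re z) +i (-ℝ im z)
  ; 0#      = rationalℂ 0ℚ
  ; 1#      = rationalℂ 1ℚ
  }

open RawRing ℂ-rawRing public
  using (_+_; _*_; -_; _≈_; 0#; 1#)
open RawSemiringDefinitions (RawRing.rawSemiring ℂ-rawRing) public
  using (_^_; sum)

-- The inverse is determined by the value up to _≈_.
record ℂˣ : Set where
  field
    value         : ℂ
    inverse       : ℂ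
    value*inverse : value * inverse ≈ 1#

open ℂˣ public

infixl 7 _/ˣ_

_/ˣ_ : ℂ → ℂˣ → ℂ
z /ˣ u = z * inverse u

module _ (n : ℕ) .{{_ : ℕ.NonZero n}} where

  private
    n/1 : ℚ
    n/1 = + n ℚ./ 1
    instance
      n/1-pos : Positive n/1
      n/1-pos = ℚ.normalize-pos n 1
      n/1-nonNeg : NonNegative n/1
      n/1-nonNeg = ℚ.pos⇒nonNeg n/1
      n/1-nonZero : ℚ.NonZero n/1
      n/1-nonZero = ℚ.pos⇒nonZero n/1

  sqrt : ℂˣ
  sqrt .value = realℂ (√ n/1)
  -- 1/√n = (1/n)·√n
  sqrt .inverse = realℂ (fromℚ (1/ n/1) *ℝ √ n/1)
  sqrt .value*inverse = mk≈ℝ real , mk≈ℝ imaginary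
    where
    c = 1/ n/1
    0<c : 0ℚ ℚ.< c
    0<c = ℚ.positive⁻¹ c {{ℚ.1/pos⇒pos n/1}}
    r = root n/1
    real : ∀ {ε} → 0ℚ ℚ.< ε → ∃[ n₀ ] ∀ k → n₀ ℕ.≤ k →
           ∣ (r k ℚ.* (c ℚ.* r k) ℚ.+ ℚ.- (0ℚ ℚ.* 0ℚ)) ℚ.- 1ℚ ∣ ℚ.< ε
    real {ε} 0<ε =
      let δ , 0<δ , cδ≡ε = ratio 0<ε 0<c
          k₀ , near      = √-seq² n/1 0<δ
      in k₀ , λ k k₀≤k → subst₂ ℚ._<_ (cong ∣_∣ (eq (r k))) cδ≡ε
              (∣p*q∣<B*δ c (r k ℚ.* r k ℚ.- n/1) 0<c
                (ℚ.≤-reflexive (ℚ.0≤p⇒∣p∣≡p (ℚ.<⇒≤ 0<c))) (near k k₀≤k))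
      where
      eq : ∀ s → c ℚ.* (s ℚ.* s ℚ.- n/1) ≡ (s ℚ.* (c ℚ.* s) ℚ.+ ℚ.- (0ℚ ℚ.* 0ℚ)) ℚ.- 1ℚ
      eq s = trans
        (solve 3 (λ s c m → c :* (s :* s :- m) :=
           (s :* (c :* s) :+ :- (con 0ℚ :* con 0ℚ)) :- c :* m) refl s c n/1)
        (cong (λ t → (s ℚ.* (c ℚ.* s) ℚ.+ ℚ.- (0ℚ ℚ.* 0ℚ)) ℚ.- t) (ℚ.*-inverseˡ n/1))
    imaginary : ∀ {ε} → 0ℚ ℚ.< ε → ∃[ n₀ ] ∀ k → n₀ ℕ.≤ k →
                ∣ (r k ℚ.* 0ℚ ℚ.+ 0ℚ ℚ.* (c ℚ.* r k)) ℚ.- 0ℚ ∣ ℚ.< ε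
    imaginary {ε} 0<ε = 0 , λ k _ → subst (λ p → ∣ p ∣ ℚ.< ε)
      (solve 2 (λ s c → con 0ℚ := (s :* con 0ℚ :+ con 0ℚ :* (c :* s)) :- con 0ℚ) refl (r k) c)
      0<ε

-- z is a root of a polynomial Σ aᵢ Xⁱ of formal degree d with rational
-- coefficients, not all of them zero.
IsAlgebraic : ℂ → Set
IsAlgebraic z = ∃[ d ] Σ (Fin (suc d) → ℚ) λ a →
  (∃[ i ] a i ≢ 0ℚ) × sum (λ i → rationalℂ (a i) * z ^ toℕ i) ≈ 0#

record FiniteAbelianGroup : Set₁ where
  infixl 6 _∙_
  field
    Carrier        : Set
    _∙_            : Carrier → Carrier → Carrier
    ε              : Carrier
    _⁻¹            : Carrier → Carrier
    isAbelianGroup : IsAbelianGroup _≡_ _∙_ ε _⁻¹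
    order          : ℕ
    enumeration    : Fin order ↔ Carrier

  instance
    order-nonZero : ℕ.NonZero order
    order-nonZero = Fin.nonZeroIndex (Inverse.from enumeration ε)

  open IsAbelianGroup isAbelianGroup public using (_-_)

  ∑ : (Carrier → ℂ) → ℂ
  ∑ f = sum (f ∘ Inverse.to enumeration)

  √order : ℂˣ
  √order = sqrt order

module _ (G : FiniteAbelianGroup) where
  open FiniteAbelianGroup G

  record IsBicharacter (b : Carrier → Carrier → ℂ) : Set where
    field
      multiplicativeˡ : ∀ x y z → b (x ∙ y) z ≈ b x z * b y z
      multiplicativeʳ : ∀ x y z → b x (y ∙ z) ≈ b x y * b x z

  record IsNondegenerate (b : Carrier → Carrier → ℂ) : Set where
    field
      nondegenerateˡ : ∀ x → (∀ y → b x y ≈ 1#) → x ≡ ε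
      nondegenerateʳ : ∀ y → (∀ x → b x y ≈ 1#) → y ≡ ε

  record MetricStructure : Set where
    field
      ⟨_⟩ : Carrier → ℂˣ

    ⟨_︔_⟩ : Carrier → Carrier → ℂ
    ⟨ x ︔ y ⟩ = value ⟨ x ∙ y ⟩ /ˣ ⟨ x ⟩ /ˣ ⟨ y ⟩

    field
      even          : ∀ x → value ⟨ x ⟩ ≈ value ⟨ x ⁻¹ ⟩
      bicharacter   : IsBicharacter ⟨_︔_⟩
      nondegenerate : IsNondegenerate ⟨_︔_⟩

  record IsFiniteQuantumDilogarithm (M : MetricStructure) (E : Carrier → ℂ) : Set where
    open MetricStructure M
    field
      C          : ℂˣ
      functional : ∀ x y → ⟨ x ︔ y ⟩ * E x * E y ≈
        value C + ∑ (λ z → E (y - z) * E z * value ⟨ z ⟩ * E (x - z)) /ˣ √order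
      small-order : order ℕ.≤ 4 → E ε ^ 2 ≈ value √order * E ε + 1#

module _ (n : ℕ) .{{_ : ℕ.NonZero n}} where

  private
    infixl 6 _⊕_

    _⊕_ : Fin n → Fin n → Fin n
    i ⊕ j = (toℕ i ℕ.+ toℕ j) mod n

    𝟘 : Fin n
    𝟘 = 0 mod n

    ⊖_ : Fin n → Fin n
    ⊖ i = (n ℕ.∸ toℕ i) mod n

    toℕ-mod : ∀ m → toℕ (m mod n) ≡ m % n
    toℕ-mod m = Fin.toℕ-fromℕ< (m%n<n m n)

    mod-toℕ : ∀ i → toℕ i mod n ≡ i
    mod-toℕ i = Fin.toℕ-injective (trans (toℕ-mod (toℕ i)) (m<n⇒m%n≡m (Fin.toℕ<n i)))

    mod-cong : ∀ {k m} → k % n ≡ m % n → k mod n ≡ m mod n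
    mod-cong {k} {m} eq = Fin.toℕ-injective (trans (toℕ-mod k) (trans eq (sym (toℕ-mod m))))

    mod-⊕-mod : ∀ k m → (k mod n) ⊕ (m mod n) ≡ (k ℕ.+ m) mod n
    mod-⊕-mod k m = mod-cong (begin
      (toℕ (k mod n) ℕ.+ toℕ (m mod n)) % n ≡⟨ cong₂ (λ a b → (a ℕ.+ b) % n) (toℕ-mod k) (toℕ-mod m) ⟩
      (k % n ℕ.+ m % n) % n                 ≡⟨ %-distribˡ-+ k m n ⟨
      (k ℕ.+ m) % n                         ∎)
      where open ≡-Reasoning

    ⊕-comm : ∀ i j → i ⊕ j ≡ j ⊕ i
    ⊕-comm i j = cong (_mod n) (ℕ.+-comm (toℕ i) (toℕ j))

    ⊕-assoc : ∀ i j k → (i ⊕ j) ⊕ k ≡ i ⊕ (j ⊕ k)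
    ⊕-assoc i j k = begin
      (i ⊕ j) ⊕ k                              ≡⟨ cong ((i ⊕ j) ⊕_) (mod-toℕ k) ⟨
      ((a ℕ.+ b) mod n) ⊕ (c mod n)            ≡⟨ mod-⊕-mod (a ℕ.+ b) c ⟩
      (a ℕ.+ b ℕ.+ c) mod n                    ≡⟨ cong (_mod n) (ℕ.+-assoc a b c) ⟩
      (a ℕ.+ (b ℕ.+ c)) mod n                  ≡⟨ mod-⊕-mod a (b ℕ.+ c) ⟨
      (a mod n) ⊕ (j ⊕ k)                      ≡⟨ cong (_⊕ (j ⊕ k)) (mod-toℕ i) ⟩
      i ⊕ (j ⊕ k)                              ∎
      where
      open ≡-Reasoning
      a = toℕ i
      b = toℕ j
      c = toℕ k

    ⊕-identityˡ : ∀ i → 𝟘 ⊕ i ≡ i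
    ⊕-identityˡ i = begin
      𝟘 ⊕ i                      ≡⟨ cong (𝟘 ⊕_) (mod-toℕ i) ⟨
      (0 mod n) ⊕ (toℕ i mod n)  ≡⟨ mod-⊕-mod 0 (toℕ i) ⟩
      toℕ i mod n                ≡⟨ mod-toℕ i ⟩
      i                          ∎
      where open ≡-Reasoning

    ⊕-inverseˡ : ∀ i → (⊖ i) ⊕ i ≡ 𝟘
    ⊕-inverseˡ i = begin
      (⊖ i) ⊕ i                                ≡⟨ cong ((⊖ i) ⊕_) (mod-toℕ i) ⟨
      ((n ℕ.∸ toℕ i) mod n) ⊕ (toℕ i mod n)    ≡⟨ mod-⊕-mod (n ℕ.∸ toℕ i) (toℕ i) ⟩
      (n ℕ.∸ toℕ i ℕ.+ toℕ i) mod n            ≡⟨ cong (_mod n) (ℕ.m∸n+n≡m (Fin.toℕ≤n i)) ⟩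
      n mod n                                  ≡⟨ mod-cong (trans (n%n≡0 n) (sym (m<n⇒m%n≡m (ℕ.>-nonZero⁻¹ n)))) ⟩
      𝟘                                        ∎
      where open ≡-Reasoning

  ℤ/_ℤ : FiniteAbelianGroup
  ℤ/_ℤ = record
    { Carrier        = Fin n
    ; _∙_            = _⊕_
    ; ε              = 𝟘
    ; _⁻¹            = ⊖_
    ; isAbelianGroup = record
      { isGroup = record
        { isMonoid = record
          { isSemigroup = record
            { isMagma = record { isEquivalence = isEquivalence ; ∙-cong = cong₂ _⊕_ }
            ; assoc   = ⊕-assoc
            }
          ; identity = ⊕-identityˡ , λ i → trans (⊕-comm i 𝟘) (⊕-identityˡ i)
          }
        ; inverse = ⊕-inverseˡ , λ i → trans (⊕-comm i (⊖ i)) (⊕-inverseˡ i)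
        ; ⁻¹-cong = cong ⊖_
        }
      ; comm = ⊕-comm
      }
    ; order          = n
    ; enumeration    = ↔-id (Fin n)
    }

{-# OPTIONS --safe #-}
-- If E u is transcendental, ℚ(E u) has a place sending E u to infinity. By Chevalley's argument it
-- extends to the finitely many elements that matter: there are a subring R ⊂ ℂ containing ⟨x⟩, ⟨x⟩⁻¹
-- and √p, a proper ideal J of R, and a value E x₀ with 1/E x₀ ∈ J and e = E/E x₀ valued in R. Then
-- ν ⟨x;y⟩ e(x) e(y) = const + Σ_z e(y - z) e(z) ⟨z⟩ e(x - z), where ν = √p/E x₀ ∈ J. The Fourier
-- transform in x and y gives ν ℓ(k,l) = a(k) a(l) b(k + l) for (k,l) ≠ (0,0), where a, b
-- and ℓ are the transforms of e, e⟨·⟩ and ⟨x;y⟩ e(x) e(y).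
--
-- If a(s) were invertible modulo an ideal containing J for some s ≠ 0, then a(l) b(l + s) would vanish
-- there for all l. As b is a Gaussian convolution of a, this gives a vector v, the product of a with
-- characters and Gaussians, such that v(l) or its Fourier coefficient at l vanishes for each l. The
-- vectors supported on S whose transform vanishes on S are zero, because the principal minors of the
-- Fourier matrix of prime order are nonsingular (Chebotarev); so a(s) vanishes, a contradiction. Hence,
-- modulo J, a is concentrated at 0, so e = 1 and b is an invertible multiple of ⟨·⟩⁻¹. But the relations
-- at (k,0) and (k,k) give ν ℓ(k,0)² b(2k) = ℓ(k,k) (a(0) b(k))², of which the left side is in J and the
-- right side is now a unit.
module Submission where

open import Algebra.Bundles using (CommutativeRing; Group)
open import Algebra.Bundles.Raw using (RawRing; RawSemiring)
open import Algebra.Core using (Op₁; Op₂)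
import Algebra.Definitions.RawSemiring as RawSemiringDefinitions
import Algebra.Properties.AbelianGroup as AbelianGroupProperties
import Algebra.Properties.CommutativeSemiring.Binomial as Binomial
import Algebra.Properties.CommutativeSemiring.Exp as CommutativeExp
import Algebra.Properties.Group as GroupProperties
import Algebra.Properties.Ring as RingProperties
import Algebra.Properties.Semiring.Exp as ExpProperties
import Algebra.Properties.Semiring.Mult as MultProperties
import Algebra.Properties.Semiring.Mult.TCOptimised as TCMult
import Algebra.Properties.Semiring.Sum as SumProperties
import Algebra.Solver.Ring as RingSolver
open import Algebra.Solver.Ring.AlmostCommutativeRing using (_-Raw-AlmostCommutative⟶_; fromCommutativeRing)
open import Algebra.Structures using (IsAbelianGroup; IsCommutativeRing)
open import Axiom.ExcludedMiddle using (ExcludedMiddle)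
open import Data.Bool.Base using (if_then_else_)
open import Data.Empty using (⊥; ⊥-elim)
open import Data.Fin.Base using (Fin; fromℕ; fromℕ<; suc; toℕ; zero)
open import Data.Fin.Permutation using (permutation)
import Data.Fin.Properties as Fin
open import Data.Integer.Base as ℤ using (ℤ)
import Data.Integer.Properties as ℤ
open import Data.List.Base as List using (List; []; _∷_; allFin; filter; length)
open import Data.List.Membership.Propositional using () renaming (_∈_ to _∈ₗ_)
open import Data.List.Membership.Propositional.Properties using (∈-allFin; ∈-filter⁺)
import Data.List.Properties as List
open import Data.List.Relation.Unary.All as All using (All; []; _∷_)
import Data.List.Relation.Unary.All.Properties as All
open import Data.List.Relation.Unary.AllPairs as AllPairs using (AllPairs; []; _∷_)
import Data.List.Relation.Unary.AllPairs.Properties as AllPairs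
import Data.List.Relation.Unary.Unique.Propositional.Properties as Unique
open import Data.Maybe.Base using (Maybe; just; nothing)
open import Data.Nat.Base as ℕ using (NonZero; _!; suc; zero; ℕ)
open import Data.Nat.Combinatorics using (_C_; k![n∸k]!∣n!; nCk≡n!/k![n-k]!; nCk≡nC[n∸k]; nCn≡1)
open import Data.Nat.Coprimality using (coprime-Bézout; prime⇒coprime)
open import Data.Nat.DivMod using (%-distribˡ-+; _%_; _mod_; m%n<n; m/n*n≡m; m<n⇒m%n≡m; n%n≡0)
open import Data.Nat.Divisibility as ∣ using (>⇒∤; _∣_; divides; m∣m*n; ∣1⇒≡1)
open import Data.Nat.GCD using (module Bézout)
open import Data.Nat.Primality using (Prime; euclidsLemma; prime⇒nonTrivial; prime⇒nonZero)
import Data.Nat.Properties as ℕ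
open import Data.Product.Base using (_,_; _×_; proj₁; proj₂; Σ; ∃-syntax)
open import Data.Rational.Base as ℚ using (0ℚ; 1/_; 1ℚ; ½; ℚ; ∣_∣)
import Data.Rational.Properties as ℚ
import Data.Rational.Unnormalised.Base as ℚᵘ
import Data.Rational.Unnormalised.Properties as ℚᵘ
open import Data.Sum.Base as Sum using ([_,_]′; _⊎_; inj₁; inj₂)
open import Data.Unit.Base using (⊤)
open import Function.Base using (_∘_; id)
open import Level using (0ℓ)
open import Relation.Binary.Core using (Rel)
open import Relation.Binary.Definitions using (tri<; tri>; tri≈)
open import Relation.Binary.PropositionalEquality as ≡ using (_≡_; _≢_)
import Relation.Binary.Reasoning.Setoid as SetoidReasoning
open import Relation.Nullary.Decidable using (Dec; _×-dec_; does; no; yes; ¬?)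
open import Relation.Nullary.Negation.Core using (contradiction; ¬_)
open import Relation.Unary using (Pred; _∈_; _∉_; _⊆_)

-- No valuation ring of ℂ is ever constructed. Only finitely many elements have to be compared, so
-- finitely many extensions of a pair (R, J) replace a maximal one, and ideals are enlarged only as
-- far as the finitely many products at hand require. The price is that R/J need be neither local
-- nor a domain, and every later step has to work over such a ring: determinants and dimension
-- counts give way to Nakayama's lemma, and "nonzero" to "invertible" or "not a zero divisor". What
-- survives is characteristic zero. R contains ℚ, so its quotients by ideals are torsion-free, and
-- Chebotarev's theorem is proved from that.
--
-- The theorem enters as the uncertainty principle for prime order: a nonzero v and its transform
-- have supports of total size greater than p, whereas a(l) b(l + s) = 0 makes the two supports
-- disjoint.
--
-- The final contradiction cannot be read off modulo J directly. Combining the relations at (k,0)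
-- and (k,k) gives an equation both of whose sides carry a factor ν; one ν has to be cancelled in R
-- before reducing, which is legitimate because ν is invertible in ℂ.

ℤ-rawRing : RawRing 0ℓ 0ℓ
ℤ-rawRing = record
  { Carrier = ℤ ; _≈_ = _≡_ ; _+_ = ℤ._+_ ; _*_ = ℤ._*_ ; -_ = ℤ.-_ ; 0# = ℤ.0ℤ ; 1# = ℤ.1ℤ }

-- Commutative rings: a solver with integer coefficients, and finite sums

module CommutativeRingTools (R : CommutativeRing 0ℓ 0ℓ) where
  open CommutativeRing R hiding (zero) public
  open SumProperties semiring public
    using (sum; sum-cong-≋; ∑-distrib-+; ∑-comm; sum-permute; *-distribˡ-sum; *-distribʳ-sum; sum-replicate-zero)
  open ExpProperties semiring public using (_^_; ^-congˡ; ^-homo-*; ^-assocʳ)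
  open RingProperties ring public using (-‿distribˡ-*; -‿distribʳ-*; -0#≈0#; -1*x≈-x)
  open SetoidReasoning setoid

  private
    open TCMult semiring using (×-homo-+; ×1-homo-*; 1+×) renaming (_×_ to _·_)
    open AbelianGroupProperties +-abelianGroup using (⁻¹-involutive; ⁻¹-∙-comm)

    -- The optimised multiple sends 1 to `1#` itself, so in the solver `con ℤ.1ℤ` and `con ℤ.0ℤ`
    -- denote literally `1#` and `0#`.
    fromℤ : ℤ → Carrier
    fromℤ (ℤ.+ n)    = n · 1#
    fromℤ ℤ.-[1+ n ] = - (suc n · 1#)

    fromℤ-neg : ∀ i → fromℤ (ℤ.- i) ≈ - fromℤ i
    fromℤ-neg (ℤ.+ zero)  = sym -0#≈0#
    fromℤ-neg (ℤ.+ suc n) = refl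
    fromℤ-neg ℤ.-[1+ n ]  = sym (⁻¹-involutive _)

    cancel : ∀ a b → (1# + a) + - (1# + b) ≈ a + - b
    cancel a b = begin
      (1# + a) + - (1# + b)     ≈⟨ +-cong (+-comm 1# a) (sym (⁻¹-∙-comm 1# b)) ⟩
      (a + 1#) + (- 1# + - b)   ≈⟨ +-assoc a 1# _ ⟩
      a + (1# + (- 1# + - b))   ≈⟨ +-congˡ (+-assoc 1# (- 1#) (- b)) ⟨
      a + ((1# + - 1#) + - b)   ≈⟨ +-congˡ (+-congʳ (-‿inverseʳ 1#)) ⟩
      a + (0# + - b)            ≈⟨ +-congˡ (+-identityˡ _) ⟩
      a + - b                   ∎

    fromℤ-⊖ : ∀ m n → fromℤ (m ℤ.⊖ n) ≈ m · 1# + - (n · 1#)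
    fromℤ-⊖ m       zero    = sym (trans (+-congˡ -0#≈0#) (+-identityʳ _))
    fromℤ-⊖ zero    (suc n) = sym (+-identityˡ _)
    fromℤ-⊖ (suc m) (suc n) = begin
      fromℤ (suc m ℤ.⊖ suc n)              ≡⟨ ≡.cong fromℤ (ℤ.[1+m]⊖[1+n]≡m⊖n m n) ⟩
      fromℤ (m ℤ.⊖ n)                      ≈⟨ fromℤ-⊖ m n ⟩
      m · 1# + - (n · 1#)                  ≈⟨ cancel _ _ ⟨
      (1# + m · 1#) + - (1# + n · 1#)      ≈⟨ +-cong (1+× m 1#) (-‿cong (1+× n 1#)) ⟨
      suc m · 1# + - (suc n · 1#)          ∎

    fromℤ-+ : ∀ i j → fromℤ (i ℤ.+ j) ≈ fromℤ i + fromℤ j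
    fromℤ-+ (ℤ.+ m)    (ℤ.+ n)    = ×-homo-+ 1# m n
    fromℤ-+ (ℤ.+ m)    ℤ.-[1+ n ] = fromℤ-⊖ m (suc n)
    fromℤ-+ ℤ.-[1+ m ] (ℤ.+ n)    = trans (fromℤ-⊖ n (suc m)) (+-comm _ _)
    fromℤ-+ ℤ.-[1+ m ] ℤ.-[1+ n ] = begin
      - (suc (suc (m ℕ.+ n)) · 1#)      ≡⟨ ≡.cong (λ k → - (k · 1#)) (ℕ.+-suc (suc m) n) ⟨
      - ((suc m ℕ.+ suc n) · 1#)        ≈⟨ -‿cong (×-homo-+ 1# (suc m) (suc n)) ⟩
      - (suc m · 1# + suc n · 1#)       ≈⟨ ⁻¹-∙-comm _ _ ⟨
      - (suc m · 1#) + - (suc n · 1#)   ∎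

    fromℤ-*⁺ : ∀ m j → fromℤ (ℤ.+ m ℤ.* j) ≈ m · 1# * fromℤ j
    fromℤ-*⁺ m (ℤ.+ n) = trans (reflexive (≡.cong fromℤ (≡.sym (ℤ.pos-* m n)))) (×1-homo-* m n)
    fromℤ-*⁺ m ℤ.-[1+ n ] = begin
      fromℤ (ℤ.+ m ℤ.* ℤ.-[1+ n ])          ≡⟨ ≡.cong fromℤ (ℤ.neg-distribʳ-* (ℤ.+ m) (ℤ.+ suc n)) ⟨
      fromℤ (ℤ.- (ℤ.+ m ℤ.* ℤ.+ suc n))     ≈⟨ fromℤ-neg (ℤ.+ m ℤ.* ℤ.+ suc n) ⟩
      - fromℤ (ℤ.+ m ℤ.* ℤ.+ suc n)         ≈⟨ -‿cong (fromℤ-*⁺ m (ℤ.+ suc n)) ⟩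
      - (m · 1# * (suc n · 1#))         ≈⟨ -‿distribʳ-* _ _ ⟩
      m · 1# * - (suc n · 1#)           ∎

    fromℤ-* : ∀ i j → fromℤ (i ℤ.* j) ≈ fromℤ i * fromℤ j
    fromℤ-* (ℤ.+ m)    j = fromℤ-*⁺ m j
    fromℤ-* ℤ.-[1+ m ] j = begin
      fromℤ (ℤ.-[1+ m ] ℤ.* j)            ≡⟨ ≡.cong fromℤ (ℤ.neg-distribˡ-* (ℤ.+ suc m) j) ⟨
      fromℤ (ℤ.- (ℤ.+ suc m ℤ.* j))       ≈⟨ fromℤ-neg (ℤ.+ suc m ℤ.* j) ⟩
      - fromℤ (ℤ.+ suc m ℤ.* j)           ≈⟨ -‿cong (fromℤ-*⁺ (suc m) j) ⟩
      - (suc m · 1# * fromℤ j)          ≈⟨ -‿distribˡ-* _ _ ⟩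
      - (suc m · 1#) * fromℤ j          ∎

    fromℤ-homomorphism : ℤ-rawRing -Raw-AlmostCommutative⟶ fromCommutativeRing R
    fromℤ-homomorphism = record
      { ⟦_⟧ = fromℤ ; +-homo = fromℤ-+ ; *-homo = fromℤ-* ; -‿homo = fromℤ-neg
      ; 0-homo = refl ; 1-homo = refl }

    fromℤ≟ : ∀ i j → Maybe (fromℤ i ≈ fromℤ j)
    fromℤ≟ i j with i ℤ.≟ j
    ... | yes i≡j = just (reflexive (≡.cong fromℤ i≡j))
    ... | no _    = nothing

  open RingSolver ℤ-rawRing (fromCommutativeRing R) fromℤ-homomorphism fromℤ≟ public
    using (solve; _:+_; _:*_; _:-_; :-_; _:=_; con)

  ι : ℕ → Carrier
  ι zero    = 0#
  ι (suc n) = 1# + ι n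

  1^ : ∀ n → 1# ^ n ≈ 1#
  1^ zero    = refl
  1^ (suc n) = trans (*-identityˡ _) (1^ n)

  ι-+ : ∀ m n → ι (m ℕ.+ n) ≈ ι m + ι n
  ι-+ zero    n = sym (+-identityˡ _)
  ι-+ (suc m) n = trans (+-congˡ (ι-+ m n)) (sym (+-assoc 1# _ _))

  ι-* : ∀ m n → ι (m ℕ.* n) ≈ ι m * ι n
  ι-* zero    n = sym (zeroˡ _)
  ι-* (suc m) n = begin
    ι (n ℕ.+ m ℕ.* n)   ≈⟨ ι-+ n (m ℕ.* n) ⟩
    ι n + ι (m ℕ.* n)   ≈⟨ +-congˡ (ι-* m n) ⟩
    ι n + ι m * ι n     ≈⟨ solve 2 (λ a b → b :+ a :* b := (con ℤ.1ℤ :+ a) :* b) refl (ι m) (ι n) ⟩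
    (1# + ι m) * ι n    ∎

  x-y≈0⇒x≈y : ∀ {x y} → x - y ≈ 0# → x ≈ y
  x-y≈0⇒x≈y {x} {y} eq = begin
    x            ≈⟨ solve 2 (λ a b → a := (a :- b) :+ b) refl x y ⟩
    (x - y) + y  ≈⟨ +-congʳ eq ⟩
    0# + y       ≈⟨ +-identityˡ y ⟩
    y            ∎

  x≈y⇒x-y≈0 : ∀ {x y} → x ≈ y → x - y ≈ 0#
  x≈y⇒x-y≈0 {x} {y} eq = trans (+-congʳ eq) (-‿inverseʳ y)

  *-invertible-cancelˡ : ∀ {u u⁻¹} → u * u⁻¹ ≈ 1# → ∀ {x y} → u * x ≈ u * y → x ≈ y
  *-invertible-cancelˡ {u} {u⁻¹} inv {x} {y} eq = begin
    x              ≈⟨ expand x ⟩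
    u⁻¹ * (u * x)  ≈⟨ *-congˡ eq ⟩
    u⁻¹ * (u * y)  ≈⟨ expand y ⟨
    y              ∎
    where
    expand : ∀ z → z ≈ u⁻¹ * (u * z)
    expand z = begin
      z              ≈⟨ *-identityˡ z ⟨
      1# * z         ≈⟨ *-congʳ inv ⟨
      u * u⁻¹ * z    ≈⟨ solve 3 (λ a b c → a :* b :* c := b :* (a :* c)) refl u u⁻¹ z ⟩
      u⁻¹ * (u * z)  ∎

  sum-neg : ∀ {n} (f : Fin n → Carrier) → sum (λ i → - f i) ≈ - sum f
  sum-neg f = begin
    sum (λ i → - f i)        ≈⟨ sum-cong-≋ (λ i → -1*x≈-x (f i)) ⟨
    sum (λ i → - 1# * f i)   ≈⟨ *-distribˡ-sum (- 1#) f ⟨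
    - 1# * sum f             ≈⟨ -1*x≈-x _ ⟩
    - sum f                  ∎

  sum-≈0 : ∀ {n} {f : Fin n → Carrier} → (∀ i → f i ≈ 0#) → sum f ≈ 0#
  sum-≈0 {n} f≈0 = trans (sum-cong-≋ f≈0) (sum-replicate-zero n)

  sum-const : ∀ {n} x → sum {n} (λ _ → x) ≈ ι n * x
  sum-const {zero}  x = sym (zeroˡ x)
  sum-const {suc n} x = begin
    x + sum {n} (λ _ → x)  ≈⟨ +-congˡ (sum-const {n} x) ⟩
    x + ι n * x            ≈⟨ solve 2 (λ a b → b :+ a :* b := (con ℤ.1ℤ :+ a) :* b) refl (ι n) x ⟩
    (1# + ι n) * x         ∎

  sum-single : ∀ {n} {f : Fin n → Carrier} (j : Fin n) → (∀ i → i ≢ j → f i ≈ 0#) → sum f ≈ f j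
  sum-single {f = f} zero off =
    trans (+-congˡ (sum-≈0 (λ i → off (suc i) λ ()))) (+-identityʳ _)
  sum-single {f = f} (suc j) off = trans (+-cong (off zero λ ())
    (sum-single j (λ i i≢j → off (suc i) (λ eq → i≢j (Fin.suc-injective eq))))) (+-identityˡ _)

-- Spans with coefficients in a subring or an ideal, and Nakayama's lemma

module Spans (R : CommutativeRing 0ℓ 0ℓ) where
  open CommutativeRingTools R
  open SetoidReasoning setoid

  -- Without a unit the notion covers coefficient rings and ideals alike, so that spans and
  -- polynomials with coefficients in an ideal need no separate treatment.
  record IsNonunitalSubring (P : Pred Carrier 0ℓ) : Set where
    field
      resp : ∀ {x y} → x ≈ y → x ∈ P → y ∈ P
      0∈   : 0# ∈ P
      +∈   : ∀ {x y} → x ∈ P → y ∈ P → x + y ∈ P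
      -∈   : ∀ {x} → x ∈ P → - x ∈ P
      *∈   : ∀ {x y} → x ∈ P → y ∈ P → x * y ∈ P

    minus∈ : ∀ {x y} → x ∈ P → y ∈ P → x - y ∈ P
    minus∈ x∈ y∈ = +∈ x∈ (-∈ y∈)

    sum∈ : ∀ {n} {f : Fin n → Carrier} → (∀ i → f i ∈ P) → sum f ∈ P
    sum∈ {zero}  f∈ = 0∈
    sum∈ {suc n} f∈ = +∈ (f∈ zero) (sum∈ (f∈ ∘ suc))

  module Span {P : Pred Carrier 0ℓ} (P-subring : IsNonunitalSubring P) where
    open IsNonunitalSubring P-subring

    Span : ∀ {n} → (Fin n → Carrier) → Pred Carrier 0ℓ
    Span {n} g x = Σ (Fin n → Carrier) λ c → (∀ i → c i ∈ P) × x ≈ sum (λ i → c i * g i)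

    module _ {n} {g : Fin n → Carrier} where

      span-resp : ∀ {x y} → x ≈ y → x ∈ Span g → y ∈ Span g
      span-resp x≈y (c , c∈ , eq) = c , c∈ , trans (sym x≈y) eq

      span-0 : 0# ∈ Span g
      span-0 = (λ _ → 0#) , (λ _ → 0∈) , sym (sum-≈0 (λ i → zeroˡ (g i)))

      span-+ : ∀ {x y} → x ∈ Span g → y ∈ Span g → x + y ∈ Span g
      span-+ {x} {y} (c , c∈ , x≈) (d , d∈ , y≈) =
        (λ i → c i + d i) , (λ i → +∈ (c∈ i) (d∈ i)) , (begin
          x + y                                          ≈⟨ +-cong x≈ y≈ ⟩
          sum (λ i → c i * g i) + sum (λ i → d i * g i)  ≈⟨ ∑-distrib-+ (λ i → c i * g i) (λ i → d i * g i) ⟨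
          sum (λ i → c i * g i + d i * g i)              ≈⟨ sum-cong-≋ (λ i → distribʳ (g i) (c i) (d i)) ⟨
          sum (λ i → (c i + d i) * g i)                  ∎)

      span-scale : ∀ {a x} → (∀ {c} → c ∈ P → a * c ∈ P) → x ∈ Span g → a * x ∈ Span g
      span-scale {a} {x} aP⊆P (c , c∈ , x≈) = (λ i → a * c i) , (λ i → aP⊆P (c∈ i)) , (begin
        a * x                        ≈⟨ *-congˡ x≈ ⟩
        a * sum (λ i → c i * g i)    ≈⟨ *-distribˡ-sum a (λ i → c i * g i) ⟩
        sum (λ i → a * (c i * g i))  ≈⟨ sum-cong-≋ (λ i → *-assoc a (c i) (g i)) ⟨
        sum (λ i → a * c i * g i)    ∎)

      span-neg : ∀ {x} → x ∈ Span g → - x ∈ Span g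
      span-neg {x} x∈ = span-resp (-1*x≈-x x)
        (span-scale (λ {c} c∈ → resp (sym (-1*x≈-x c)) (-∈ c∈)) x∈)

      span-sum : ∀ {m} {f : Fin m → Carrier} → (∀ i → f i ∈ Span g) → sum f ∈ Span g
      span-sum {zero}  f∈ = span-0
      span-sum {suc m} f∈ = span-+ (f∈ zero) (span-sum (f∈ ∘ suc))

      span-gen : ∀ {a} → a ∈ P → ∀ j → a * g j ∈ Span g
      span-gen {a} a∈ j = c , c∈ , sym (trans (sum-single j off) on)
        where
        c : Fin n → Carrier
        c i = if does (i Fin.≟ j) then a else 0#
        c∈ : ∀ i → c i ∈ P
        c∈ i with i Fin.≟ j
        ... | yes _ = a∈
        ... | no _  = 0∈
        off : ∀ i → i ≢ j → c i * g i ≈ 0#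
        off i i≢j with i Fin.≟ j
        ... | yes i≡j = contradiction i≡j i≢j
        ... | no _    = zeroˡ (g i)
        on : c j * g j ≈ a * g j
        on with j Fin.≟ j
        ... | yes _  = refl
        ... | no j≢j = contradiction ≡.refl j≢j

    -- Eliminating g₀ keeps the shape of the relations: with u = 1 - c₀ one has
    -- u g₀ ∈ Span (g₁, …), and gᵢ = c₀ gᵢ + u gᵢ.
    nakayama : ∀ {n} (g : Fin n → Carrier) → (∀ i → g i ∈ Span g) →
               ∃[ u ] 1# - u ∈ P × (∀ i → u * g i ≈ 0#)
    nakayama {zero}  g g∈ = 1# , resp (sym (-‿inverseʳ 1#)) 0∈ , λ ()
    nakayama {suc n} g g∈ with g∈ zero
    ... | c , c∈ , g₀≈ = u′ * u , 1-u′u∈ , λ { zero → u′u*g₀ ; (suc i) → u′u*gᵢ i }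
      where
      h : Fin n → Carrier
      h = g ∘ suc
      u = 1# - c zero
      w = sum (λ i → c (suc i) * h i)
      u*g₀ : u * g zero ≈ w
      u*g₀ = begin
        (1# - c zero) * g zero                 ≈⟨ solve 2 (λ a b → (con ℤ.1ℤ :- a) :* b := b :- a :* b) refl (c zero) (g zero) ⟩
        g zero - c zero * g zero               ≈⟨ +-congʳ g₀≈ ⟩
        (c zero * g zero + w) - c zero * g zero ≈⟨ solve 2 (λ a b → (a :+ b) :- a := b) refl (c zero * g zero) w ⟩
        w                                      ∎
      w∈ : w ∈ Span h
      w∈ = (c ∘ suc) , (c∈ ∘ suc) , refl
      h∈ : ∀ i → h i ∈ Span h
      h∈ i with g∈ (suc i)
      ... | d , d∈ , hᵢ≈ = span-resp (sym eq) (span-+ (span-gen (c∈ zero) i)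
          (span-+ (span-scale (*∈ (d∈ zero)) w∈)
            (span-+ v∈ (span-neg (span-scale (*∈ (c∈ zero)) v∈)))))
        where
        v = sum (λ i → d (suc i) * h i)
        v∈ : v ∈ Span h
        v∈ = (d ∘ suc) , (d∈ ∘ suc) , refl
        eq : h i ≈ c zero * h i + (d zero * w + (v - c zero * v))
        eq = begin
          h i
            ≈⟨ solve 2 (λ a b → b := a :* b :+ (con ℤ.1ℤ :- a) :* b) refl (c zero) (h i) ⟩
          c zero * h i + u * h i
            ≈⟨ +-congˡ (*-congˡ hᵢ≈) ⟩
          c zero * h i + u * (d zero * g zero + v)
            ≈⟨ solve 5 (λ a b d g v → a :* b :+ (con ℤ.1ℤ :- a) :* (d :* g :+ v) :=
                 a :* b :+ (d :* ((con ℤ.1ℤ :- a) :* g) :+ (v :- a :* v)))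
                 refl (c zero) (h i) (d zero) (g zero) v ⟩
          c zero * h i + (d zero * (u * g zero) + (v - c zero * v))
            ≈⟨ +-congˡ (+-congʳ (*-congˡ u*g₀)) ⟩
          c zero * h i + (d zero * w + (v - c zero * v)) ∎
      IH = nakayama h h∈
      u′ = proj₁ IH
      u′*h : ∀ i → u′ * h i ≈ 0#
      u′*h = proj₂ (proj₂ IH)
      1-u′u∈ : 1# - u′ * u ∈ P
      1-u′u∈ = resp
        (solve 2 (λ a b → (con ℤ.1ℤ :- b) :+ (a :- (con ℤ.1ℤ :- b) :* a) :=
          con ℤ.1ℤ :- b :* (con ℤ.1ℤ :- a)) refl (c zero) u′)
        (+∈ (proj₁ (proj₂ IH)) (minus∈ (c∈ zero) (*∈ (proj₁ (proj₂ IH)) (c∈ zero))))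
      u′u*g₀ : u′ * u * g zero ≈ 0#
      u′u*g₀ = begin
        u′ * u * g zero                        ≈⟨ *-assoc u′ u _ ⟩
        u′ * (u * g zero)                      ≈⟨ *-congˡ u*g₀ ⟩
        u′ * w                                 ≈⟨ *-distribˡ-sum u′ (λ i → c (suc i) * h i) ⟩
        sum (λ i → u′ * (c (suc i) * h i))     ≈⟨ sum-≈0 (λ i → trans
          (solve 3 (λ a b c → a :* (b :* c) := b :* (a :* c)) refl u′ (c (suc i)) (h i))
          (trans (*-congˡ (u′*h i)) (zeroʳ _))) ⟩
        0#                                     ∎
      u′u*gᵢ : ∀ i → u′ * u * h i ≈ 0#
      u′u*gᵢ i = begin
        u′ * u * h i    ≈⟨ solve 3 (λ a b c → a :* b :* c := b :* (a :* c)) refl u′ u (h i) ⟩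
        u * (u′ * h i)  ≈⟨ *-congˡ (u′*h i) ⟩
        u * 0#          ≈⟨ zeroʳ u ⟩
        0#              ∎

-- Chebotarev's theorem on minors of the Fourier matrix, over a torsion-free ring

prime∤! : ∀ {p} → Prime p → ∀ {n} → n ℕ.< p → ¬ p ∣ n !
prime∤! p-prime {zero} _ p∣1 = ℕ.<⇒≢ (ℕ.nonTrivial⇒n>1 _ {{prime⇒nonTrivial p-prime}}) (≡.sym (∣1⇒≡1 p∣1))
prime∤! p-prime {suc n} n<p p∣ with euclidsLemma (suc n) (n !) p-prime p∣
... | inj₁ p∣1+n = >⇒∤ n<p p∣1+n
... | inj₂ p∣n!  = prime∤! p-prime (ℕ.<-trans (ℕ.n<1+n n) n<p) p∣n!

prime∣C : ∀ {p} → Prime p → ∀ {k} → 0 ℕ.< k → k ℕ.< p → p ∣ p C k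
prime∣C {p} p-prime {k} 0<k k<p with euclidsLemma (p C k) (k ! ℕ.* (p ℕ.∸ k) !) p-prime p∣product
  where
  instance
    _ = k ℕ.!* (p ℕ.∸ k) !≢0
    _ = prime⇒nonZero p-prime
  product≡p! : (p C k) ℕ.* (k ! ℕ.* (p ℕ.∸ k) !) ≡ p !
  product≡p! = ≡.trans (≡.cong (λ c → c ℕ.* (k ! ℕ.* (p ℕ.∸ k) !)) (nCk≡n!/k![n-k]! (ℕ.<⇒≤ k<p))) (m/n*n≡m (k![n∸k]!∣n! (ℕ.<⇒≤ k<p)))
  p∣p! : p ∣ p !
  p∣p! = ≡.subst (λ n → p ∣ n !) (ℕ.suc-pred p) (≡.subst (_∣ (suc (ℕ.pred p) !)) (ℕ.suc-pred p) (m∣m*n _))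
  p∣product : p ∣ (p C k) ℕ.* (k ! ℕ.* (p ℕ.∸ k) !)
  p∣product = ≡.subst (p ∣_) (≡.sym product≡p!) p∣p!
... | inj₁ p∣C = p∣C
... | inj₂ p∣k!* with euclidsLemma (k !) ((p ℕ.∸ k) !) p-prime p∣k!*
...   | inj₁ p∣k!    = contradiction p∣k! (prime∤! p-prime k<p)
...   | inj₂ p∣[p-k]! = contradiction p∣[p-k]! (prime∤! p-prime (ℕ.∸-monoʳ-< 0<k (ℕ.<⇒≤ k<p)))

-- Linear functionals that vanish on geometric sequences

module Frequencies (Λ : CommutativeRing 0ℓ 0ℓ) where
  open CommutativeRingTools Λ
  open Spans Λ
  open SetoidReasoning setoid

  Δ : Carrier → (ℕ → Carrier) → ℕ → Carrier
  Δ y φ n = φ (suc n) - y * φ n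

  -- The solution of ψ(n+1) = y ψ(n) + φ(n) with ψ(0) = 0. It is a right inverse of `Δ y`, whose
  -- kernel consists of the multiples of the powers of y.
  ∫ : Carrier → (ℕ → Carrier) → ℕ → Carrier
  ∫ y φ zero    = 0#
  ∫ y φ (suc n) = y * ∫ y φ n + φ n

  ∫-cong : ∀ y {φ ψ : ℕ → Carrier} → (∀ n → φ n ≈ ψ n) → ∀ n → ∫ y φ n ≈ ∫ y ψ n
  ∫-cong y φ≈ψ zero    = refl
  ∫-cong y φ≈ψ (suc n) = +-cong (*-congˡ (∫-cong y φ≈ψ n)) (φ≈ψ n)

  ∫-+ : ∀ y φ ψ n → ∫ y (λ k → φ k + ψ k) n ≈ ∫ y φ n + ∫ y ψ n
  ∫-+ y φ ψ zero    = sym (+-identityˡ 0#)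
  ∫-+ y φ ψ (suc n) = trans (+-congʳ (*-congˡ (∫-+ y φ ψ n)))
    (solve 5 (λ y a b c d → y :* (a :+ b) :+ (c :+ d) := (y :* a :+ c) :+ (y :* b :+ d))
      refl y (∫ y φ n) (∫ y ψ n) (φ n) (ψ n))

  ∫-* : ∀ y a φ n → ∫ y (λ k → a * φ k) n ≈ a * ∫ y φ n
  ∫-* y a φ zero    = sym (zeroʳ a)
  ∫-* y a φ (suc n) = trans (+-congʳ (*-congˡ (∫-* y a φ n)))
    (solve 4 (λ y a b c → y :* (a :* b) :+ a :* c := a :* (y :* b :+ c)) refl y a (∫ y φ n) (φ n))

  ∫-Δ : ∀ y φ n → ∫ y (Δ y φ) n ≈ φ n - φ 0 * y ^ n
  ∫-Δ y φ zero    = solve 1 (λ a → con ℤ.0ℤ := a :- a :* con ℤ.1ℤ) refl (φ 0)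
  ∫-Δ y φ (suc n) = trans (+-congʳ (*-congˡ (∫-Δ y φ n)))
    (solve 5 (λ y a b c d → y :* (a :- b :* c) :+ (d :- y :* a) := d :- b :* (y :* c))
      refl y (φ n) (φ 0) (y ^ n) (φ (suc n)))

  record IsLinear (L : (ℕ → Carrier) → Carrier) : Set where
    field
      cong   : ∀ {φ ψ} → (∀ n → φ n ≈ ψ n) → L φ ≈ L ψ
      +-homo : ∀ φ ψ → L (λ n → φ n + ψ n) ≈ L φ + L ψ
      *-homo : ∀ a φ → L (λ n → a * φ n) ≈ a * L φ

  ∘∫-linear : ∀ {L} → IsLinear L → ∀ y → IsLinear (L ∘ ∫ y)
  ∘∫-linear L-linear y = record
    { cong   = λ φ≈ψ → cong (∫-cong y φ≈ψ)
    ; +-homo = λ φ ψ → trans (cong (∫-+ y φ ψ)) (+-homo _ _)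
    ; *-homo = λ a φ → trans (cong (∫-* y a φ)) (*-homo a _)
    }
    where open IsLinear L-linear

  module _ {L : (ℕ → Carrier) → Carrier} (L-linear : IsLinear L) where
    open IsLinear L-linear

    L-∫Δ : ∀ {y} → L (y ^_) ≈ 0# → ∀ φ → L (∫ y (Δ y φ)) ≈ L φ
    L-∫Δ {y} Ly≈0 φ = begin
      L (∫ y (Δ y φ))                    ≈⟨ cong (∫-Δ y φ) ⟩
      L (λ n → φ n - φ 0 * y ^ n)        ≈⟨ cong (λ n → +-congˡ (-‿distribˡ-* (φ 0) (y ^ n))) ⟩
      L (λ n → φ n + (- φ 0) * y ^ n)    ≈⟨ +-homo φ _ ⟩
      L φ + L (λ n → (- φ 0) * y ^ n)    ≈⟨ +-congˡ (*-homo (- φ 0) (y ^_)) ⟩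
      L φ + (- φ 0) * L (y ^_)           ≈⟨ +-congˡ (trans (*-congˡ Ly≈0) (zeroʳ _)) ⟩
      L φ + 0#                           ≈⟨ +-identityʳ _ ⟩
      L φ                                ∎

    -- `∫ y` turns the powers of z into the divided differences (z^n - y^n)/(z - y). Once z - y can
    -- be cancelled, the functional L ∘ `∫ y` vanishes at z again, which keeps the induction over
    -- the nodes going.
    L-∫^ : ∀ {y z} → L (y ^_) ≈ 0# → L (z ^_) ≈ 0# → (z - y) * L (∫ y (z ^_)) ≈ 0#
    L-∫^ {y} {z} Ly≈0 Lz≈0 = begin
      (z - y) * L (∫ y (z ^_))           ≈⟨ *-homo (z - y) _ ⟨
      L (λ n → (z - y) * ∫ y (z ^_) n)   ≈⟨ cong (∫-* y (z - y) (z ^_)) ⟨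
      L (∫ y (λ n → (z - y) * z ^ n))    ≈⟨ cong (∫-cong y (λ n →
        solve 3 (λ z y w → (z :- y) :* w := z :* w :- y :* w) refl z y (z ^ n))) ⟩
      L (∫ y (Δ y (z ^_)))               ≈⟨ L-∫Δ Ly≈0 (z ^_) ⟩
      L (z ^_)                           ≈⟨ Lz≈0 ⟩
      0#                                 ∎

  Regular : Pred Carrier 0ℓ
  Regular a = ∀ x → a * x ≈ 0# → x ≈ 0#

  ∫Δ : List Carrier → (ℕ → Carrier) → ℕ → Carrier
  ∫Δ []       φ = φ
  ∫Δ (y ∷ ys) φ = ∫ y (∫Δ ys (Δ y φ))

  -- Newton interpolation with remainder: φ and `∫Δ ys φ` differ by iterated divided differences of
  -- the geometric sequences at the nodes, and L kills those.
  L-∫Δs : ∀ {L} → IsLinear L → ∀ {ys} → AllPairs (λ y z → z - y ∈ Regular) ys →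
          All (λ y → L (y ^_) ≈ 0#) ys → ∀ φ → L φ ≈ L (∫Δ ys φ)
  L-∫Δs L-linear []                 []            φ = refl
  L-∫Δs {L} L-linear {y ∷ ys} (regular ∷ pairs) (Ly≈0 ∷ Lys≈0) φ = begin
    L φ                       ≈⟨ L-∫Δ L-linear Ly≈0 φ ⟨
    L (∫ y (Δ y φ))           ≈⟨ L-∫Δs (∘∫-linear L-linear y) pairs
      (All.zipWith (λ (r , Lz≈0) → r _ (L-∫^ L-linear Ly≈0 Lz≈0)) (regular , Lys≈0)) (Δ y φ) ⟩
    L (∫Δ (y ∷ ys) φ)         ∎

  module Filtration {O 𝔭 : Pred Carrier 0ℓ} (O-subring : IsNonunitalSubring O)
    (𝔭-subring : IsNonunitalSubring 𝔭) (𝔭⊆O : ∀ {x} → x ∈ 𝔭 → x ∈ O)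
    (O𝔭⊆𝔭 : ∀ {a x} → a ∈ O → x ∈ 𝔭 → a * x ∈ 𝔭) (ι∈O : ∀ n → ι n ∈ O) where

    private
      module O = IsNonunitalSubring O-subring
      module 𝔭 = IsNonunitalSubring 𝔭-subring

    -- Modulo 𝔭, φ is a polynomial function of degree < m.
    Degree< : ℕ → Pred (ℕ → Carrier) 0ℓ
    Degree< zero    φ = ∀ n → φ n ∈ 𝔭
    Degree< (suc m) φ = (∀ n → φ n ∈ O) × Degree< m (λ n → φ (suc n) - φ n)

    Degree<-resp : ∀ m {φ ψ} → (∀ n → φ n ≈ ψ n) → φ ∈ Degree< m → ψ ∈ Degree< m
    Degree<-resp zero    eq φ∈ n        = 𝔭.resp (eq n) (φ∈ n)
    Degree<-resp (suc m) eq (φ∈O , Δφ∈) = (λ n → O.resp (eq n) (φ∈O n)) ,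
      Degree<-resp m (λ n → +-cong (eq (suc n)) (-‿cong (eq n))) Δφ∈

    Degree<-𝔭 : ∀ m {φ} → (∀ n → φ n ∈ 𝔭) → φ ∈ Degree< m
    Degree<-𝔭 zero    φ∈ = φ∈
    Degree<-𝔭 (suc m) φ∈ = (λ n → 𝔭⊆O (φ∈ n)) , Degree<-𝔭 m (λ n → 𝔭.minus∈ (φ∈ (suc n)) (φ∈ n))

    Degree<-+ : ∀ m {φ ψ} → φ ∈ Degree< m → ψ ∈ Degree< m → (λ n → φ n + ψ n) ∈ Degree< m
    Degree<-+ zero    φ∈ ψ∈ n = 𝔭.+∈ (φ∈ n) (ψ∈ n)
    Degree<-+ (suc m) {φ} {ψ} (φ∈O , Δφ∈) (ψ∈O , Δψ∈) = (λ n → O.+∈ (φ∈O n) (ψ∈O n)) ,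
      Degree<-resp m (λ n → solve 4 (λ a b c d → (a :- b) :+ (c :- d) := (a :+ c) :- (b :+ d))
        refl (φ (suc n)) (φ n) (ψ (suc n)) (ψ n)) (Degree<-+ m Δφ∈ Δψ∈)

    Degree<-* : ∀ m {a φ} → a ∈ O → φ ∈ Degree< m → (λ n → a * φ n) ∈ Degree< m
    Degree<-* zero    a∈ φ∈ n = O𝔭⊆𝔭 a∈ (φ∈ n)
    Degree<-* (suc m) {a} {φ} a∈ (φ∈O , Δφ∈) = (λ n → O.*∈ a∈ (φ∈O n)) ,
      Degree<-resp m (λ n → solve 3 (λ a b c → a :* (b :- c) := a :* b :- a :* c)
        refl a (φ (suc n)) (φ n)) (Degree<-* m a∈ Δφ∈)

    -- Modulo 𝔭 the node y equals 1, so `Δ y` becomes the ordinary difference operator.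
    Degree<-Δ : ∀ m {y φ} → 1# - y ∈ 𝔭 → φ ∈ Degree< (suc m) → Δ y φ ∈ Degree< m
    Degree<-Δ m {y} {φ} 1-y∈ (φ∈O , Δφ∈) = Degree<-resp m
      (λ n → solve 3 (λ y a b → (a :- b) :+ b :* (con ℤ.1ℤ :- y) := a :- y :* b) refl y (φ (suc n)) (φ n))
      (Degree<-+ m Δφ∈ (Degree<-𝔭 m (λ n → O𝔭⊆𝔭 (φ∈O n) 1-y∈)))

    ∫-𝔭 : ∀ {y} → y ∈ O → ∀ {φ} → (∀ n → φ n ∈ 𝔭) → ∀ n → ∫ y φ n ∈ 𝔭
    ∫-𝔭 y∈ φ∈ zero    = 𝔭.0∈
    ∫-𝔭 y∈ φ∈ (suc n) = 𝔭.+∈ (O𝔭⊆𝔭 y∈ (∫-𝔭 y∈ φ∈ n)) (φ∈ n)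

    -- There are as many differences as the degree bound, so nothing is left modulo 𝔭; the
    -- summations that follow stay inside 𝔭.
    ∫Δ-𝔭 : ∀ {ys} → All (λ y → y ∈ O × 1# - y ∈ 𝔭) ys → ∀ {φ} → φ ∈ Degree< (length ys) →
           ∀ n → ∫Δ ys φ n ∈ 𝔭
    ∫Δ-𝔭 []                          φ∈ = φ∈
    ∫Δ-𝔭 {_ ∷ ys} ((y∈ , 1-y∈) ∷ ok) φ∈ = ∫-𝔭 y∈ (∫Δ-𝔭 ok (Degree<-Δ (length ys) 1-y∈ φ∈))

    Degree<-linear : ∀ m {a c φ} → a ∈ O → c ∈ O → φ ∈ Degree< m →
                     (λ n → a * (ι n - c) * φ n) ∈ Degree< (suc m)
    Degree<-linear zero a∈ c∈ φ∈ = (λ n → 𝔭⊆O (ψ∈ n)) , λ n → 𝔭.minus∈ (ψ∈ (suc n)) (ψ∈ n)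
      where ψ∈ = λ n → O𝔭⊆𝔭 (O.*∈ a∈ (O.minus∈ (ι∈O n) c∈)) (φ∈ n)
    Degree<-linear (suc m) {a} {c} {φ} a∈ c∈ φ∈@(φ∈O , Δφ∈) =
      (λ n → O.*∈ (O.*∈ a∈ (O.minus∈ (ι∈O n) c∈)) (φ∈O n)) ,
      -- Leibniz rule: the difference of a (n - c) φ(n) is a φ(n) + a (n - (c - 1)) Δφ(n). The
      -- induction therefore has to run over all c.
      Degree<-resp (suc m)
        (λ n → solve 5 (λ a c x s t → a :* t :+ a :* (x :- (c :- (con ℤ.1ℤ :+ con ℤ.0ℤ))) :* (s :- t) :=
           a :* ((con ℤ.1ℤ :+ x) :- c) :* s :- a :* (x :- c) :* t) refl a c (ι n) (φ (suc n)) (φ n))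
        (Degree<-+ (suc m) (Degree<-* (suc m) a∈ φ∈)
          (Degree<-linear m a∈ (O.minus∈ c∈ (ι∈O 1)) Δφ∈))

-- Arithmetic of ℤ[ζ] acting on a torsion-free ring

module PrimitiveRoot (Λ : CommutativeRing 0ℓ 0ℓ) where
  open CommutativeRingTools Λ
  open Spans Λ
  open Frequencies Λ
  open SetoidReasoning setoid
  open CommutativeExp commutativeSemiring using (^-distrib-*)
  private module Mult = MultProperties semiring

  -- The characteristic-zero shadow of a primitive p-th root of unity: Λ need not be a domain.
  record IsPrimitiveRoot (p : ℕ) (ζ : Carrier) : Set where
    field
      ζ^p≈1    : ζ ^ p ≈ 1#
      geometric : ∀ {j} → 0 ℕ.< j → j ℕ.< p → sum {p} (λ i → ζ ^ (toℕ i ℕ.* j)) ≈ 0#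

  TorsionFree : Set
  TorsionFree = ∀ n → ι (suc n) ∈ Regular

  ι-distinct : TorsionFree → ∀ {m n} → m ≢ n → ∀ {x} → ι m * x ≈ ι n * x → x ≈ 0#
  ι-distinct torsionFree {zero}  {zero}  m≢n eq = contradiction ≡.refl m≢n
  ι-distinct torsionFree {suc m} {zero}  m≢n eq = torsionFree m _ (trans eq (zeroˡ _))
  ι-distinct torsionFree {zero}  {suc n} m≢n eq = torsionFree n _ (trans (sym eq) (zeroˡ _))
  ι-distinct torsionFree {suc m} {suc n} m≢n {x} eq = ι-distinct torsionFree (m≢n ∘ ≡.cong suc) (begin
    ι m * x              ≈⟨ peel m ⟩
    ι (suc m) * x - x    ≈⟨ +-congʳ eq ⟩
    ι (suc n) * x - x    ≈⟨ peel n ⟨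
    ι n * x              ∎)
    where
    peel : ∀ k → ι k * x ≈ ι (suc k) * x - x
    peel k = solve 2 (λ a x → a :* x := (con ℤ.1ℤ :+ a) :* x :- x) refl (ι k) x

  module _ {p ζ} (p-prime : Prime p) (ζ-primitive : IsPrimitiveRoot p ζ) (torsionFree : TorsionFree) where
    open IsPrimitiveRoot ζ-primitive

    private
      1<p : 1 ℕ.< p
      1<p = ℕ.nonTrivial⇒n>1 p {{prime⇒nonTrivial p-prime}}

      0<p : 0 ℕ.< p
      0<p = ℕ.<-trans ℕ.z<s 1<p

      instance
        p-nonZero : NonZero p
        p-nonZero = prime⇒nonZero p-prime

    -- Generated inductively, so that stability of a span under all of ℤ[ζ] can be checked on
    -- generators.
    data ℤ[ζ] : Pred Carrier 0ℓ where
      one  : 1# ∈ ℤ[ζ]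
      root : ζ ∈ ℤ[ζ]
      add  : ∀ {x y} → x ∈ ℤ[ζ] → y ∈ ℤ[ζ] → x + y ∈ ℤ[ζ]
      neg  : ∀ {x} → x ∈ ℤ[ζ] → - x ∈ ℤ[ζ]
      mul  : ∀ {x y} → x ∈ ℤ[ζ] → y ∈ ℤ[ζ] → x * y ∈ ℤ[ζ]
      conv : ∀ {x y} → x ≈ y → x ∈ ℤ[ζ] → y ∈ ℤ[ζ]

    ℤ[ζ]-subring : IsNonunitalSubring ℤ[ζ]
    ℤ[ζ]-subring = record
      { resp = conv ; 0∈ = conv (-‿inverseʳ 1#) (add one (neg one)) ; +∈ = add ; -∈ = neg ; *∈ = mul }

    private module O = IsNonunitalSubring ℤ[ζ]-subring

    ι∈ℤ[ζ] : ∀ n → ι n ∈ ℤ[ζ]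
    ι∈ℤ[ζ] zero    = O.0∈
    ι∈ℤ[ζ] (suc n) = add one (ι∈ℤ[ζ] n)

    ^∈ℤ[ζ] : ∀ {x} → x ∈ ℤ[ζ] → ∀ n → x ^ n ∈ ℤ[ζ]
    ^∈ℤ[ζ] x∈ zero    = one
    ^∈ℤ[ζ] x∈ (suc n) = mul x∈ (^∈ℤ[ζ] x∈ n)

    ideal-subring : ∀ {a} {P : Pred Carrier 0ℓ} → IsNonunitalSubring P → (∀ {x} → x ∈ P → a * x ∈ P) →
                    IsNonunitalSubring (λ x → ∃[ y ] y ∈ P × x ≈ a * y)
    ideal-subring {a} P-subring aP⊆P = record
      { resp = λ x≈y (z , z∈ , eq) → z , z∈ , trans (sym x≈y) eq
      ; 0∈   = 0# , 0∈ , sym (zeroʳ a)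
      ; +∈   = λ (y , y∈ , x≈) (y′ , y′∈ , x′≈) →
          y + y′ , +∈ y∈ y′∈ , trans (+-cong x≈ x′≈) (sym (distribˡ a y y′))
      ; -∈   = λ (y , y∈ , x≈) → - y , -∈ y∈ , trans (-‿cong x≈) (-‿distribʳ-* a y)
      ; *∈   = λ (y , y∈ , x≈) (y′ , y′∈ , x′≈) → y * (a * y′) , *∈ y∈ (aP⊆P y′∈) ,
          trans (*-cong x≈ x′≈) (*-assoc a y (a * y′))
      }
      where open IsNonunitalSubring P-subring

    π : Carrier
    π = 1# - ζ

    π∈ℤ[ζ] : π ∈ ℤ[ζ]
    π∈ℤ[ζ] = add one (neg root)

    ⟨π⟩ : Pred Carrier 0ℓ
    ⟨π⟩ x = ∃[ y ] y ∈ ℤ[ζ] × x ≈ π * y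

    ⟨π⟩-subring : IsNonunitalSubring ⟨π⟩
    ⟨π⟩-subring = ideal-subring ℤ[ζ]-subring (mul π∈ℤ[ζ])

    private module 𝔭 = IsNonunitalSubring ⟨π⟩-subring

    ⟨π⟩⊆ℤ[ζ] : ∀ {x} → x ∈ ⟨π⟩ → x ∈ ℤ[ζ]
    ⟨π⟩⊆ℤ[ζ] (y , y∈ , x≈) = conv (sym x≈) (mul π∈ℤ[ζ] y∈)

    ℤ[ζ]*⟨π⟩ : ∀ {a x} → a ∈ ℤ[ζ] → x ∈ ⟨π⟩ → a * x ∈ ⟨π⟩
    ℤ[ζ]*⟨π⟩ {a} {x} a∈ (y , y∈ , x≈) = a * y , mul a∈ y∈ ,
      trans (*-congˡ x≈) (solve 3 (λ a b c → a :* (b :* c) := b :* (a :* c)) refl a π y)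

    1-ζ^∈⟨π⟩ : ∀ n → 1# - ζ ^ n ∈ ⟨π⟩
    1-ζ^∈⟨π⟩ zero    = 𝔭.resp (sym (-‿inverseʳ 1#)) 𝔭.0∈
    1-ζ^∈⟨π⟩ (suc n) = 𝔭.resp
      (solve 2 (λ z w → (con ℤ.1ℤ :- z) :+ z :* (con ℤ.1ℤ :- w) := con ℤ.1ℤ :- z :* w) refl ζ (ζ ^ n))
      (𝔭.+∈ (1# , one , sym (*-identityʳ π)) (ℤ[ζ]*⟨π⟩ root (1-ζ^∈⟨π⟩ n)))

    -- The powers of ζ sum to zero, so p is the sum of the 1 - ζ^i.
    ιp∈⟨π⟩ : ι p ∈ ⟨π⟩
    ιp∈⟨π⟩ = 𝔭.resp eq (𝔭.sum∈ {p} (λ i → 1-ζ^∈⟨π⟩ (toℕ i ℕ.* 1)))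
      where
      eq : sum {p} (λ i → 1# - ζ ^ (toℕ i ℕ.* 1)) ≈ ι p
      eq = begin
        sum {p} (λ i → 1# - ζ ^ (toℕ i ℕ.* 1))
          ≈⟨ ∑-distrib-+ {p} (λ _ → 1#) (λ i → - ζ ^ (toℕ i ℕ.* 1)) ⟩
        sum {p} (λ _ → 1#) + sum {p} (λ i → - ζ ^ (toℕ i ℕ.* 1))
          ≈⟨ +-cong (trans (sum-const {p} 1#) (*-identityʳ _))
               (trans (sum-neg {p} (λ i → ζ ^ (toℕ i ℕ.* 1))) (-‿cong (geometric ℕ.z<s 1<p))) ⟩
        ι p - 0#
          ≈⟨ solve 1 (λ a → a :- con ℤ.0ℤ := a) refl (ι p) ⟩
        ι p ∎

    ιp-regular : ι p ∈ Regular
    ιp-regular = ≡.subst (λ n → ι n ∈ Regular) (ℕ.suc-pred p) (torsionFree (ℕ.pred p))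

    -- Averaging: x is fixed by every ζ^(ij), and these sum to zero, so p x = 0. This replaces the
    -- absence of zero divisors.
    ζ^-fix : ∀ {j} → 0 ℕ.< j → j ℕ.< p → ∀ {x} → ζ ^ j * x ≈ x → x ≈ 0#
    ζ^-fix {j} 0<j j<p {x} ζʲx≈x = ιp-regular x (begin
      ι p * x                                  ≈⟨ sum-const {p} x ⟨
      sum {p} (λ _ → x)                        ≈⟨ sum-cong-≋ {p} (λ i → fix (toℕ i)) ⟨
      sum {p} (λ i → ζ ^ (toℕ i ℕ.* j) * x)    ≈⟨ *-distribʳ-sum {p} x (λ i → ζ ^ (toℕ i ℕ.* j)) ⟨
      sum {p} (λ i → ζ ^ (toℕ i ℕ.* j)) * x    ≈⟨ *-congʳ (geometric 0<j j<p) ⟩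
      0# * x                                   ≈⟨ zeroˡ x ⟩
      0#                                       ∎)
      where
      fix : ∀ i → ζ ^ (i ℕ.* j) * x ≈ x
      fix zero    = *-identityˡ x
      fix (suc i) = begin
        ζ ^ (j ℕ.+ i ℕ.* j) * x        ≈⟨ *-congʳ (^-homo-* ζ j (i ℕ.* j)) ⟩
        ζ ^ j * ζ ^ (i ℕ.* j) * x      ≈⟨ *-assoc _ _ x ⟩
        ζ ^ j * (ζ ^ (i ℕ.* j) * x)    ≈⟨ *-congˡ (fix i) ⟩
        ζ ^ j * x                      ≈⟨ ζʲx≈x ⟩
        x                              ∎

    ζ^-invertible : ∀ {n} → n ℕ.< p → ζ ^ n * ζ ^ (p ℕ.∸ n) ≈ 1#
    ζ^-invertible {n} n<p = begin
      ζ ^ n * ζ ^ (p ℕ.∸ n)   ≈⟨ ^-homo-* ζ n (p ℕ.∸ n) ⟨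
      ζ ^ (n ℕ.+ (p ℕ.∸ n))   ≡⟨ ≡.cong (ζ ^_) (ℕ.m+[n∸m]≡n (ℕ.<⇒≤ n<p)) ⟩
      ζ ^ p                   ≈⟨ ζ^p≈1 ⟩
      1#                      ∎

    ζ^-agree : ∀ {m n} → m ℕ.< n → n ℕ.< p → ∀ {x} → ζ ^ m * x ≈ ζ ^ n * x → x ≈ 0#
    ζ^-agree {m} {n} m<n n<p {x} eq = ζ^-fix (ℕ.m<n⇒0<n∸m m<n) (ℕ.≤-<-trans (ℕ.m∸n≤m n m) n<p)
      (*-invertible-cancelˡ (ζ^-invertible (ℕ.<-trans m<n n<p)) (begin
        ζ ^ m * (ζ ^ (n ℕ.∸ m) * x)  ≈⟨ *-assoc _ _ x ⟨
        ζ ^ m * ζ ^ (n ℕ.∸ m) * x    ≈⟨ *-congʳ (^-homo-* ζ m (n ℕ.∸ m)) ⟨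
        ζ ^ (m ℕ.+ (n ℕ.∸ m)) * x    ≡⟨ ≡.cong (λ k → ζ ^ k * x) (ℕ.m+[n∸m]≡n (ℕ.<⇒≤ m<n)) ⟩
        ζ ^ n * x                    ≈⟨ eq ⟨
        ζ ^ m * x                    ∎))

    ζ^-regular : ∀ {m n} → m ≢ n → m ℕ.< p → n ℕ.< p → ζ ^ n - ζ ^ m ∈ Regular
    ζ^-regular {m} {n} m≢n m<p n<p x eq with ℕ.<-cmp m n
    ... | tri< m<n _ _ = ζ^-agree m<n n<p (sym same)
      where
      same = x-y≈0⇒x≈y (trans (solve 3 (λ a b x → a :* x :- b :* x := (a :- b) :* x) refl (ζ ^ n) (ζ ^ m) x) eq)
    ... | tri≈ _ m≡n _ = contradiction m≡n m≢n
    ... | tri> _ _ n<m = ζ^-agree n<m m<p same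
      where
      same = x-y≈0⇒x≈y (trans (solve 3 (λ a b x → a :* x :- b :* x := (a :- b) :* x) refl (ζ ^ n) (ζ ^ m) x) eq)

    sum∈-except : ∀ {P} → IsNonunitalSubring P → ∀ {n} {f : Fin n → Carrier} j →
                  (∀ i → i ≢ j → f i ∈ P) → sum f - f j ∈ P
    sum∈-except P-subring {suc n} {f} zero    off = resp
      (solve 2 (λ a b → b := (a :+ b) :- a) refl (f zero) (sum (f ∘ suc))) (sum∈ (λ i → off (suc i) λ ()))
      where open IsNonunitalSubring P-subring
    sum∈-except P-subring {suc n} {f} (suc j) off = resp
      (sym (+-assoc (f zero) (sum (f ∘ suc)) (- f (suc j))))
      (+∈ (off zero λ ()) (sum∈-except P-subring j (λ i i≢j → off (suc i) (i≢j ∘ Fin.suc-injective))))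
      where open IsNonunitalSubring P-subring

    ⟨p⟩ : Pred Carrier 0ℓ
    ⟨p⟩ x = ∃[ y ] y ∈ ℤ[ζ] × x ≈ ι p * y

    private
      ϖ : Carrier
      ϖ = ζ - 1#

      ⟨p⟩-subring : IsNonunitalSubring ⟨p⟩
      ⟨p⟩-subring = ideal-subring ℤ[ζ]-subring (mul (ι∈ℤ[ζ] p))

      term : Fin (suc p) → Carrier
      term = Binomial.binomialTerm commutativeSemiring ϖ 1# p

      ×≈ι* : ∀ n x → n Mult.× x ≈ ι n * x
      ×≈ι* zero    x = sym (zeroˡ x)
      ×≈ι* (suc n) x = trans (+-congˡ (×≈ι* n x))
        (solve 2 (λ a x → x :+ a :* x := (con ℤ.1ℤ :+ a) :* x) refl (ι n) x)

      term-edge : ∀ {k : Fin (suc p)} → p C toℕ k ≡ 1 → term k ≈ ϖ ^ toℕ k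
      term-edge {k} eq = begin
        (p C toℕ k) Mult.× (ϖ ^ toℕ k * 1# ^ (p ℕ.∸ toℕ k))  ≡⟨ ≡.cong (Mult._× (ϖ ^ toℕ k * 1# ^ (p ℕ.∸ toℕ k))) eq ⟩
        ϖ ^ toℕ k * 1# ^ (p ℕ.∸ toℕ k) + 0#                ≈⟨ +-identityʳ _ ⟩
        ϖ ^ toℕ k * 1# ^ (p ℕ.∸ toℕ k)                     ≈⟨ *-congˡ (1^ (p ℕ.∸ toℕ k)) ⟩
        ϖ ^ toℕ k * 1#                                     ≈⟨ *-identityʳ _ ⟩
        ϖ ^ toℕ k                                          ∎

      last : Fin p
      last = fromℕ< (ℕ.≤-reflexive (ℕ.suc-pred p))

      toℕ-last : suc (toℕ last) ≡ p
      toℕ-last = ≡.trans (≡.cong suc (Fin.toℕ-fromℕ< (ℕ.≤-reflexive (ℕ.suc-pred p)))) (ℕ.suc-pred p)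

      term-middle : ∀ i → i ≢ last → term (suc i) ∈ ⟨p⟩
      term-middle i i≢last with prime∣C p-prime (ℕ.z<s {toℕ i})
        (ℕ.≤∧≢⇒< (Fin.toℕ<n i) (λ eq → i≢last (Fin.toℕ-injective (ℕ.suc-injective (≡.trans eq (≡.sym toℕ-last))))))
      ... | divides q eq = ι q * x , mul (ι∈ℤ[ζ] q) (mul (^∈ℤ[ζ] (add root (neg one)) (suc (toℕ i))) (^∈ℤ[ζ] one (p ℕ.∸ suc (toℕ i)))) , (begin
        (p C suc (toℕ i)) Mult.× x    ≈⟨ ×≈ι* (p C suc (toℕ i)) x ⟩
        ι (p C suc (toℕ i)) * x       ≡⟨ ≡.cong (λ k → ι k * x) eq ⟩
        ι (q ℕ.* p) * x               ≈⟨ *-congʳ (ι-* q p) ⟩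
        ι q * ι p * x                 ≈⟨ solve 3 (λ a b c → a :* b :* c := b :* (a :* c)) refl (ι q) (ι p) x ⟩
        ι p * (ι q * x)               ∎)
        where x = ϖ ^ suc (toℕ i) * 1# ^ (p ℕ.∸ suc (toℕ i))

    -- Expand 1 = ζ^p = ((ζ - 1) + 1)^p by the binomial theorem. The constant term cancels the 1 on
    -- the left, and every remaining term except the top one carries a binomial coefficient
    -- divisible by p.
    [ζ-1]^p∈⟨p⟩ : (ζ - 1#) ^ p ∈ ⟨p⟩
    [ζ-1]^p∈⟨p⟩ = resp eq (-∈ (sum∈-except ⟨p⟩-subring last term-middle))
      where
      open IsNonunitalSubring ⟨p⟩-subring
      rest = sum (term ∘ suc)
      rest≈0 : rest ≈ 0#
      rest≈0 = begin
        rest                  ≈⟨ solve 2 (λ a b → b := (a :+ b) :- a) refl (term zero) rest ⟩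
        sum term - term zero  ≈⟨ +-cong (sym (Binomial.theorem commutativeSemiring p ϖ 1#))
          (-‿cong (term-edge {zero} (≡.trans (nCk≡nC[n∸k] {0} {p} ℕ.z≤n) (nCn≡1 p)))) ⟩
        (ϖ + 1#) ^ p - 1#     ≈⟨ +-congʳ (^-congˡ p (solve 1 (λ z → (z :- con ℤ.1ℤ) :+ con ℤ.1ℤ := z) refl ζ)) ⟩
        ζ ^ p - 1#            ≈⟨ +-congʳ ζ^p≈1 ⟩
        1# - 1#               ≈⟨ -‿inverseʳ 1# ⟩
        0#                    ∎
      eq : - (rest - term (suc last)) ≈ ϖ ^ p
      eq = begin
        - (rest - term (suc last))   ≈⟨ -‿cong (+-congʳ rest≈0) ⟩
        - (0# - term (suc last))     ≈⟨ solve 1 (λ a → :- (con ℤ.0ℤ :- a) := a) refl (term (suc last)) ⟩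
        term (suc last)              ≈⟨ term-edge {suc last} (≡.trans (≡.cong (p C_) toℕ-last) (nCn≡1 p)) ⟩
        ϖ ^ suc (toℕ last)           ≡⟨ ≡.cong (ϖ ^_) toℕ-last ⟩
        ϖ ^ p                        ∎

    -- Differences of naturals: membership supplies two natural numbers, which `ι-distinct` can
    -- compare.
    ℤ-image : Pred Carrier 0ℓ
    ℤ-image x = ∃[ m ] ∃[ n ] x ≈ ι m - ι n

    ℤ-image-subring : IsNonunitalSubring ℤ-image
    ℤ-image-subring = record
      { resp = λ x≈y (m , n , eq) → m , n , trans (sym x≈y) eq
      ; 0∈   = 0 , 0 , sym (-‿inverseʳ 0#)
      ; +∈   = λ (m , n , x≈) (m′ , n′ , y≈) → m ℕ.+ m′ , n ℕ.+ n′ ,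
          trans (+-cong x≈ y≈) (trans
            (solve 4 (λ a b c d → (a :- b) :+ (c :- d) := (a :+ c) :- (b :+ d)) refl (ι m) (ι n) (ι m′) (ι n′))
            (sym (+-cong (ι-+ m m′) (-‿cong (ι-+ n n′)))))
      ; -∈   = λ (m , n , x≈) → n , m ,
          trans (-‿cong x≈) (solve 2 (λ a b → :- (a :- b) := b :- a) refl (ι m) (ι n))
      ; *∈   = λ (m , n , x≈) (m′ , n′ , y≈) → m ℕ.* m′ ℕ.+ n ℕ.* n′ , m ℕ.* n′ ℕ.+ n ℕ.* m′ ,
          trans (*-cong x≈ y≈) (trans
            (solve 4 (λ a b c d → (a :- b) :* (c :- d) := (a :* c :+ b :* d) :- (a :* d :+ b :* c))
              refl (ι m) (ι n) (ι m′) (ι n′))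
            (sym (+-cong (ι-+* m m′ n n′) (-‿cong (ι-+* m n′ n m′)))))
      }
      where
      ι-+* : ∀ a b c d → ι (a ℕ.* b ℕ.+ c ℕ.* d) ≈ ι a * ι b + ι c * ι d
      ι-+* a b c d = trans (ι-+ (a ℕ.* b) (c ℕ.* d)) (+-cong (ι-* a b) (ι-* c d))

    private module ℤ-im = IsNonunitalSubring ℤ-image-subring

    ιp*-ℤ-image : ∀ {x} → x ∈ ℤ-image → ι p * x ∈ ℤ-image
    ιp*-ℤ-image = ℤ-im.*∈ (p , 0 , solve 1 (λ a → a := a :- con ℤ.0ℤ) refl (ι p))

    pℤ : Pred Carrier 0ℓ
    pℤ x = ∃[ y ] y ∈ ℤ-image × x ≈ ι p * y

    pℤ-subring : IsNonunitalSubring pℤ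
    pℤ-subring = ideal-subring ℤ-image-subring ιp*-ℤ-image

    -- Cleared of signs, u x = 0 reads (1 + p n) x = p m x. The two naturals differ modulo p, so
    -- torsion-freeness gives x = 0.
    1+pℤ-regular : ∀ {u} → 1# - u ∈ pℤ → u ∈ Regular
    1+pℤ-regular {u} (y , (m , n , y≈) , 1-u≈) x ux≈0 = ι-distinct torsionFree 1+pn≢pm (begin
      ι (suc (p ℕ.* n)) * x            ≈⟨ *-congʳ (+-congˡ (ι-* p n)) ⟩
      (1# + ι p * ι n) * x             ≈⟨ solve 5 (λ a b c u x → (con ℤ.1ℤ :+ a :* c) :* x :=
        a :* b :* x :+ (u :* x :+ ((con ℤ.1ℤ :- u) :- a :* (b :- c)) :* x)) refl (ι p) (ι m) (ι n) u x ⟩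
      ι p * ι m * x + (u * x + ((1# - u) - ι p * (ι m - ι n)) * x)
        ≈⟨ +-congˡ (+-cong ux≈0 (*-congʳ (x≈y⇒x-y≈0 (trans 1-u≈ (*-congˡ y≈))))) ⟩
      ι p * ι m * x + (0# + 0# * x)    ≈⟨ solve 2 (λ a x → a :+ (con ℤ.0ℤ :+ con ℤ.0ℤ :* x) := a) refl (ι p * ι m * x) x ⟩
      ι p * ι m * x                    ≈⟨ *-congʳ (ι-* p m) ⟨
      ι (p ℕ.* m) * x                  ∎)
      where
      1+pn≢pm : suc (p ℕ.* n) ≢ p ℕ.* m
      1+pn≢pm eq = ℕ.<⇒≢ 1<p (≡.sym (∣1⇒≡1
        (∣.∣m+n∣m⇒∣n (≡.subst (p ∣_) (≡.trans (≡.sym eq) (ℕ.+-comm 1 (p ℕ.* n))) (m∣m*n m)) (m∣m*n n))))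

    module _ (x : Carrier) where
      open Span ℤ-image-subring

      private
        ζ^*x : Fin p → Carrier
        ζ^*x i = ζ ^ toℕ i * x

        ζ^n*x∈ : ∀ {n} → n ℕ.< p → ζ ^ n * x ∈ Span ζ^*x
        ζ^n*x∈ {n} n<p = span-resp
          (trans (*-identityˡ _) (reflexive (≡.cong (λ k → ζ ^ k * x) (Fin.toℕ-fromℕ< n<p))))
          (span-gen (1 , 0 , solve 0 (con ℤ.1ℤ := (con ℤ.1ℤ :+ con ℤ.0ℤ) :- con ℤ.0ℤ) refl) (fromℕ< n<p))

        ζ-step : ∀ i → ζ * ζ^*x i ∈ Span ζ^*x
        ζ-step i with ℕ.m≤n⇒m<n∨m≡n (Fin.toℕ<n i)
        ... | inj₁ 1+i<p = span-resp (*-assoc ζ (ζ ^ toℕ i) x) (ζ^n*x∈ 1+i<p)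
        ... | inj₂ 1+i≡p = span-resp (begin
          1# * x                  ≈⟨ *-congʳ ζ^p≈1 ⟨
          ζ ^ p * x               ≡⟨ ≡.cong (λ k → ζ ^ k * x) 1+i≡p ⟨
          ζ ^ suc (toℕ i) * x     ≈⟨ *-assoc ζ (ζ ^ toℕ i) x ⟩
          ζ * (ζ ^ toℕ i * x)     ∎) (ζ^n*x∈ 0<p)

        ℤ[ζ]*span : ∀ {a y} → a ∈ ℤ[ζ] → y ∈ Span ζ^*x → a * y ∈ Span ζ^*x
        ℤ[ζ]*span one        y∈ = span-resp (sym (*-identityˡ _)) y∈
        ℤ[ζ]*span {y = y} root (c , c∈ , y≈) = span-resp (begin
          sum {p} (λ i → c i * (ζ * ζ^*x i))   ≈⟨ sum-cong-≋ {p} (λ i →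
            solve 3 (λ a b c → a :* (b :* c) := b :* (a :* c)) refl (c i) ζ (ζ^*x i)) ⟩
          sum {p} (λ i → ζ * (c i * ζ^*x i))   ≈⟨ *-distribˡ-sum {p} ζ (λ i → c i * ζ^*x i) ⟨
          ζ * sum {p} (λ i → c i * ζ^*x i)     ≈⟨ *-congˡ y≈ ⟨
          ζ * y                                ∎)
          (span-sum {p} (λ i → span-scale (ℤ-im.*∈ (c∈ i)) (ζ-step i)))
        ℤ[ζ]*span (add a∈ b∈) y∈ = span-resp (sym (distribʳ _ _ _)) (span-+ (ℤ[ζ]*span a∈ y∈) (ℤ[ζ]*span b∈ y∈))
        ℤ[ζ]*span (neg a∈)    y∈ = span-resp (-‿distribˡ-* _ _) (span-neg (ℤ[ζ]*span a∈ y∈))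
        ℤ[ζ]*span (mul a∈ b∈) y∈ = span-resp (sym (*-assoc _ _ _)) (ℤ[ζ]*span a∈ (ℤ[ζ]*span b∈ y∈))
        ℤ[ζ]*span (conv eq a∈) y∈ = span-resp (*-congʳ eq) (ℤ[ζ]*span a∈ y∈)

      -- Nakayama over ℤ: the group spanned by the ζ^i x is finitely generated and, by x = a x,
      -- contained in p times itself. Hence an integer congruent to 1 modulo p kills it.
      p-divisible⇒0 : ∀ {a} → a ∈ ⟨p⟩ → x ≈ a * x → x ≈ 0#
      p-divisible⇒0 {a} (b , b∈ , a≈) x≈ax = 1+pℤ-regular (proj₁ (proj₂ killed)) x
        (trans (*-congˡ (trans (sym (*-identityˡ x)) (reflexive (≡.cong (λ k → ζ ^ k * x) (≡.sym (Fin.toℕ-fromℕ< 0<p))))))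
          (proj₂ (proj₂ killed) (fromℕ< 0<p)))
        where
        generate : ∀ i → ζ^*x i ∈ Span.Span pℤ-subring ζ^*x
        generate i with ℤ[ζ]*span b∈ (ζ^n*x∈ (Fin.toℕ<n i))
        ... | c , c∈ , eq = (λ j → ι p * c j) , (λ j → c j , c∈ j , refl) , (begin
          ζ^*x i                                 ≈⟨ *-congˡ (trans x≈ax (*-congʳ a≈)) ⟩
          ζ ^ toℕ i * (ι p * b * x)              ≈⟨ solve 4 (λ z p b x → z :* (p :* b :* x) := p :* (b :* (z :* x))) refl (ζ ^ toℕ i) (ι p) b x ⟩
          ι p * (b * ζ^*x i)                     ≈⟨ *-congˡ eq ⟩
          ι p * sum {p} (λ j → c j * ζ^*x j)     ≈⟨ *-distribˡ-sum {p} (ι p) (λ j → c j * ζ^*x j) ⟩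
          sum {p} (λ j → ι p * (c j * ζ^*x j))   ≈⟨ sum-cong-≋ {p} (λ j → *-assoc (ι p) (c j) (ζ^*x j)) ⟨
          sum {p} (λ j → ι p * c j * ζ^*x j)     ∎)
        killed = Span.nakayama pℤ-subring ζ^*x generate

    -- With u = 1 - π y, the equation u x = 0 says x = r x for r = π y, hence x = r^p x. As (ζ -
    -- 1)^p is divisible by p, so is r^p, and `p-divisible⇒0` applies.
    1+⟨π⟩-regular : ∀ {u} → 1# - u ∈ ⟨π⟩ → u ∈ Regular
    1+⟨π⟩-regular {u} (y , y∈ , 1-u≈) x ux≈0 = p-divisible⇒0 x r^p∈⟨p⟩ (r^n 0<p)
      where
      -- This is π y with the sign moved onto y, to match the base in `[ζ-1]^p∈⟨p⟩`.
      r = (ζ - 1#) * - y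
      x≈rx : x ≈ r * x
      x≈rx = begin
        x                     ≈⟨ solve 2 (λ u x → x := (con ℤ.1ℤ :- u) :* x :+ u :* x) refl u x ⟩
        (1# - u) * x + u * x  ≈⟨ +-cong (*-congʳ 1-u≈) ux≈0 ⟩
        π * y * x + 0#        ≈⟨ solve 3 (λ z y x → (con ℤ.1ℤ :- z) :* y :* x :+ con ℤ.0ℤ := (z :- con ℤ.1ℤ) :* (:- y) :* x) refl ζ y x ⟩
        r * x                 ∎
      r^n : ∀ {n} → 0 ℕ.< n → x ≈ r ^ n * x
      r^n {suc zero}    _ = trans x≈rx (*-congʳ (sym (*-identityʳ r)))
      r^n {suc (suc n)} _ = trans (trans x≈rx (*-congˡ (r^n {suc n} ℕ.z<s))) (sym (*-assoc r (r ^ suc n) x))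
      r^p∈⟨p⟩ : r ^ p ∈ ⟨p⟩
      r^p∈⟨p⟩ =
        let z , z∈ , eq = [ζ-1]^p∈⟨p⟩ in
        z * (- y) ^ p , mul z∈ (^∈ℤ[ζ] (neg y∈) p) , (begin
        r ^ p                        ≈⟨ ^-distrib-* (ζ - 1#) (- y) p ⟩
        (ζ - 1#) ^ p * (- y) ^ p     ≈⟨ *-congʳ eq ⟩
        ι p * z * (- y) ^ p          ≈⟨ *-assoc (ι p) z _ ⟩
        ι p * (z * (- y) ^ p)        ∎)

    private
      open Filtration ℤ[ζ]-subring ⟨π⟩-subring ⟨π⟩⊆ℤ[ζ] ℤ[ζ]*⟨π⟩ ι∈ℤ[ζ]

      ι*ιp∈⟨π⟩ : ∀ n → ι (n ℕ.* p) ∈ ⟨π⟩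
      ι*ιp∈⟨π⟩ n = 𝔭.resp (sym (ι-* n p)) (ℤ[ζ]*⟨π⟩ (ι∈ℤ[ζ] n) ιp∈⟨π⟩)

      -- Bézout for d and p, where p lies in ⟨π⟩.
      ι-unit : ∀ {d} → 0 ℕ.< d → d ℕ.< p → ∃[ e ] e ∈ ℤ[ζ] × e * ι d - 1# ∈ ⟨π⟩
      ι-unit {d} 0<d d<p with coprime-Bézout (prime⇒coprime p-prime {{ℕ.>-nonZero 0<d}} d<p)
      ... | Bézout.+- x y eq = - ι y , neg (ι∈ℤ[ζ] y) , 𝔭.resp (begin
        - ι (x ℕ.* p)            ≡⟨ ≡.cong (λ n → - ι n) eq ⟨
        - (1# + ι (y ℕ.* d))     ≈⟨ -‿cong (+-congˡ (ι-* y d)) ⟩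
        - (1# + ι y * ι d)       ≈⟨ solve 2 (λ a b → :- (con ℤ.1ℤ :+ a :* b) := (:- a) :* b :- con ℤ.1ℤ) refl (ι y) (ι d) ⟩
        - ι y * ι d - 1#         ∎) (𝔭.-∈ (ι*ιp∈⟨π⟩ x))
      ... | Bézout.-+ x y eq = ι y , ι∈ℤ[ζ] y , 𝔭.resp (begin
        ι (x ℕ.* p)                   ≈⟨ solve 1 (λ a → a := (con ℤ.1ℤ :+ a) :- con ℤ.1ℤ) refl (ι (x ℕ.* p)) ⟩
        ι (suc (x ℕ.* p)) - 1#        ≡⟨ ≡.cong (λ n → ι n - 1#) eq ⟩
        ι (y ℕ.* d) - 1#              ≈⟨ +-congʳ (ι-* y d) ⟩
        ι y * ι d - 1#                ∎) (ι*ιp∈⟨π⟩ x)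

      ι-∸ : ∀ {m n} → n ℕ.≤ m → ι (m ℕ.∸ n) ≈ ι m - ι n
      ι-∸ {m} {n} n≤m = begin
        ι (m ℕ.∸ n)                   ≈⟨ solve 2 (λ a b → a := (a :+ b) :- b) refl (ι (m ℕ.∸ n)) (ι n) ⟩
        (ι (m ℕ.∸ n) + ι n) - ι n     ≈⟨ +-congʳ (ι-+ (m ℕ.∸ n) n) ⟨
        ι (m ℕ.∸ n ℕ.+ n) - ι n       ≡⟨ ≡.cong (λ k → ι k - ι n) (ℕ.m∸n+n≡m n≤m) ⟩
        ι m - ι n                     ∎

      difference-unit : ∀ {m n} → m ≢ n → m ℕ.< p → n ℕ.< p → ∃[ e ] e ∈ ℤ[ζ] × e * (ι m - ι n) - 1# ∈ ⟨π⟩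
      difference-unit {m} {n} m≢n m<p n<p with ℕ.<-cmp m n
      ... | tri≈ _ m≡n _ = contradiction m≡n m≢n
      ... | tri> _ _ n<m =
        let e , e∈ , eq = ι-unit (ℕ.m<n⇒0<n∸m n<m) (ℕ.≤-<-trans (ℕ.m∸n≤m m n) m<p) in
        e , e∈ , 𝔭.resp (+-congʳ (*-congˡ (ι-∸ (ℕ.<⇒≤ n<m)))) eq
      ... | tri< m<n _ _ =
        let e , e∈ , eq = ι-unit (ℕ.m<n⇒0<n∸m m<n) (ℕ.≤-<-trans (ℕ.m∸n≤m n m) n<p) in
        - e , neg e∈ , 𝔭.resp (+-congʳ (trans (*-congˡ (ι-∸ (ℕ.<⇒≤ m<n)))
          (solve 3 (λ e a b → e :* (b :- a) := (:- e) :* (a :- b)) refl e (ι m) (ι n)))) eq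

      -- Lagrange interpolation by the product of the (n - c)/(b - c). The denominators are
      -- invertible only modulo π, so the zeros are exact while the value at b is 1 only modulo π.
      separate : ∀ {b} → b ℕ.< p → ∀ {cs} → All (λ c → c ℕ.< p × b ≢ c) cs →
        Σ (ℕ → Carrier) λ φ → φ ∈ Degree< (suc (length cs)) × φ b - 1# ∈ ⟨π⟩ × All (λ c → φ c ≈ 0#) cs
      separate b<p [] = (λ _ → 1#) , ((λ _ → one) , (λ _ → 𝔭.resp (sym (-‿inverseʳ 1#)) 𝔭.0∈)) ,
        𝔭.resp (sym (-‿inverseʳ 1#)) 𝔭.0∈ , []
      separate {b} b<p {c ∷ cs} ((c<p , b≢c) ∷ ok) =
        let φ , φ-degree , φb , φcs = separate b<p ok
            e , e∈ , eb             = difference-unit b≢c b<p c<p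
        in (λ n → e * (ι n - ι c) * φ n) ,
           Degree<-linear (suc (length cs)) e∈ (ι∈ℤ[ζ] c) φ-degree ,
           𝔭.resp (solve 2 (λ x y → (x :- con ℤ.1ℤ) :* (y :- con ℤ.1ℤ) :+ ((x :- con ℤ.1ℤ) :+ (y :- con ℤ.1ℤ)) :=
               x :* y :- con ℤ.1ℤ) refl (e * (ι b - ι c)) (φ b))
             (𝔭.+∈ (𝔭.*∈ eb φb) (𝔭.+∈ eb φb)) ,
           trans (*-congʳ (trans (*-congˡ (-‿inverseʳ (ι c))) (zeroʳ e))) (zeroˡ (φ c)) ∷
           All.map (λ {c′} φc′≈0 → trans (*-congˡ φc′≈0) (zeroʳ _)) φcs

    module _ (v : Fin p → Carrier)
      (vanish : ∀ t → v t ≈ 0# ⊎ sum {p} (λ s → v s * ζ ^ (toℕ t ℕ.* toℕ s)) ≈ 0#) where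

      private
        L : (ℕ → Carrier) → Carrier
        L φ = sum {p} (λ s → v s * φ (toℕ s))

        L-linear : IsLinear L
        L-linear = record
          { cong   = λ φ≈ψ → sum-cong-≋ {p} (λ s → *-congˡ (φ≈ψ (toℕ s)))
          ; +-homo = λ φ ψ → trans (sum-cong-≋ {p} (λ s → distribˡ (v s) (φ (toℕ s)) (ψ (toℕ s))))
              (∑-distrib-+ {p} (λ s → v s * φ (toℕ s)) (λ s → v s * ψ (toℕ s)))
          ; *-homo = λ a φ → trans (sum-cong-≋ {p} (λ s →
              solve 3 (λ x y z → x :* (y :* z) := y :* (x :* z)) refl (v s) a (φ (toℕ s))))
              (sym (*-distribˡ-sum {p} a (λ s → v s * φ (toℕ s))))
          }

        -- The set S of those t for which `vanish` returns its second alternative. Reading S off the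
        -- given evidence makes it decidable without deciding equality in Λ; v vanishes outside S
        -- and its transform vanishes on S.
        Zero-frequency : Fin p → Set
        Zero-frequency t = [ (λ _ → ⊥) , (λ _ → ⊤) ]′ (vanish t)

        zero-frequency? : ∀ t → Dec (Zero-frequency t)
        zero-frequency? t with vanish t
        ... | inj₁ _ = no id
        ... | inj₂ _ = yes _

        L-ζ^ : ∀ t → Zero-frequency t → L ((ζ ^ toℕ t) ^_) ≈ 0#
        L-ζ^ t _ with vanish t
        ... | inj₂ eq = trans (sum-cong-≋ {p} (λ s → *-congˡ (^-assocʳ ζ (toℕ t) (toℕ s)))) eq

        -- For b in S, a polynomial φ that is 1 modulo π at b and 0 on the rest of S isolates v(b):
        -- L φ = v(b) φ(b). On the other hand L φ = L (`∫Δ nodes φ`), a combination of the v(t) with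
        -- coefficients in ⟨π⟩, since the degree of φ is below the number of nodes.
        generate : ∀ b → v b ∈ Span.Span ⟨π⟩-subring v
        generate b with zero-frequency? b
        generate b | no ¬zero with vanish b
        ... | inj₁ vb≈0 = Span.span-resp ⟨π⟩-subring (sym vb≈0) (Span.span-0 ⟨π⟩-subring)
        ... | inj₂ _    = contradiction _ ¬zero
        generate b | yes zero-b = span-resp (begin
          sum {p} (λ t → ∫Δ nodes φ (toℕ t) * v t) - (φ (toℕ b) - 1#) * v b
            ≈⟨ +-congʳ (sum-cong-≋ {p} (λ t → *-comm (∫Δ nodes φ (toℕ t)) (v t))) ⟩
          L (∫Δ nodes φ) - (φ (toℕ b) - 1#) * v b
            ≈⟨ +-congʳ (L-∫Δs L-linear distinct zeros φ) ⟨
          L φ - (φ (toℕ b) - 1#) * v b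
            ≈⟨ +-congʳ (sum-single b off) ⟩
          v b * φ (toℕ b) - (φ (toℕ b) - 1#) * v b
            ≈⟨ solve 2 (λ a x → a :* x :- (x :- con ℤ.1ℤ) :* a := a) refl (v b) (φ (toℕ b)) ⟩
          v b ∎)
          (span-+ (span-sum {p} (λ t → span-gen (∫Δ-𝔭 nodes-ok φ-degree (toℕ t)) t))
            (span-neg (span-gen φb b)))
          where
          open Span ⟨π⟩-subring
          other? = λ t → ¬? (b Fin.≟ t) ×-dec zero-frequency? t
          others = filter other? (allFin p)
          others-ok = All.all-filter other? (allFin p)
          separation = separate (Fin.toℕ<n b)
            (All.map⁺ (All.map (λ {t} (b≢t , _) → Fin.toℕ<n t , b≢t ∘ Fin.toℕ-injective) others-ok))
          φ = proj₁ separation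
          frequencies = b ∷ others
          nodes = List.map (λ t → ζ ^ toℕ t) frequencies
          -- `separate` bounds the degree by one more than the number of other points, and b itself
          -- supplies the missing node. The bound matches because support and frequencies are the
          -- same set S.
          φ-degree : φ ∈ Degree< (length nodes)
          φ-degree = ≡.subst (λ n → φ ∈ Degree< (suc n))
            (≡.trans (List.length-map toℕ others) (≡.sym (List.length-map (λ t → ζ ^ toℕ t) others)))
            (proj₁ (proj₂ separation))
          φb = proj₁ (proj₂ (proj₂ separation))
          φ-others = All.map⁻ (proj₂ (proj₂ (proj₂ separation)))
          nodes-ok : All (λ y → y ∈ ℤ[ζ] × 1# - y ∈ ⟨π⟩) nodes
          nodes-ok = All.map⁺ (All.universal (λ t → ^∈ℤ[ζ] root (toℕ t) , 1-ζ^∈⟨π⟩ (toℕ t)) frequencies)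
          zeros : All (λ y → L (y ^_) ≈ 0#) nodes
          zeros = All.map⁺ zero-frequencies
            where
            zero-frequencies : All (λ t → L ((ζ ^ toℕ t) ^_) ≈ 0#) frequencies
            zero-frequencies = L-ζ^ b zero-b ∷ All.map (λ {t} (_ , zero-t) → L-ζ^ t zero-t) others-ok
          distinct : AllPairs (λ y z → z - y ∈ Regular) nodes
          distinct = AllPairs.map⁺ (AllPairs.map
            (λ {s} {t} s≢t → ζ^-regular (s≢t ∘ Fin.toℕ-injective) (Fin.toℕ<n s) (Fin.toℕ<n t))
            (All.map proj₁ others-ok ∷ Unique.filter⁺ other? (Unique.allFin⁺ p)))
          off : ∀ t → t ≢ b → v t * φ (toℕ t) ≈ 0#
          off t t≢b with zero-frequency? t
          ... | yes zero-t = trans (*-congˡ (All.lookup φ-others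
            (∈-filter⁺ other? (∈-allFin t) (t≢b ∘ ≡.sym , zero-t)))) (zeroʳ (v t))
          ... | no ¬zero with vanish t
          ...   | inj₁ vt≈0 = trans (*-congʳ vt≈0) (zeroˡ _)
          ...   | inj₂ _    = contradiction _ ¬zero

      -- Nakayama gives one u congruent to 1 modulo π that kills all the v(t); it can be cancelled
      -- although Λ may have zero divisors.
      chebotarev : ∀ t → v t ≈ 0#
      chebotarev t =
        let _ , 1-u∈ , uv≈0 = Span.nakayama ⟨π⟩-subring v generate in
        1+⟨π⟩-regular 1-u∈ (v t) (uv≈0 t)

-- Fourier transform of the functional equation

module FourierAnalysis (R : CommutativeRing 0ℓ 0ℓ) {n : ℕ} {_∙_ : Op₂ (Fin n)} {ε : Fin n} {_⁻¹ : Op₁ (Fin n)}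
  (isAbelianGroup : IsAbelianGroup _≡_ _∙_ ε _⁻¹) where

  open CommutativeRingTools R
  open SetoidReasoning setoid

  private
    group : Group 0ℓ 0ℓ
    group = record { isGroup = IsAbelianGroup.isGroup isAbelianGroup }

  open IsAbelianGroup isAbelianGroup
    using () renaming (assoc to ∙-assoc; comm to ∙-comm; identityˡ to ∙-identityˡ; identityʳ to ∙-identityʳ;
      inverseˡ to ⁻¹-inverseˡ; inverseʳ to ⁻¹-inverseʳ)
  open GroupProperties group using (inverseʳ-unique; ⁻¹-involutive; ε⁻¹≈ε; x∙y⁻¹≈ε⇒x≈y)

  ∑ : (Fin n → Carrier) → Carrier
  ∑ f = sum f

  ∑-cong : ∀ {f g} → (∀ i → f i ≈ g i) → ∑ f ≈ ∑ g
  ∑-cong = sum-cong-≋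

  ∑-*ˡ : ∀ a f → a * ∑ f ≈ ∑ (λ x → a * f x)
  ∑-*ˡ a f = *-distribˡ-sum a f

  ∑-*ʳ : ∀ a f → ∑ f * a ≈ ∑ (λ x → f x * a)
  ∑-*ʳ a f = *-distribʳ-sum a f

  ∑-translate : ∀ d f → ∑ (λ x → f (d ∙ x)) ≈ ∑ f
  ∑-translate d f = sym (sum-permute f (permutation (d ∙_) ((d ⁻¹) ∙_) there back))
    where
    there : ∀ x → d ∙ ((d ⁻¹) ∙ x) ≡ x
    there x = ≡.trans (≡.sym (∙-assoc d (d ⁻¹) x)) (≡.trans (≡.cong (_∙ x) (⁻¹-inverseʳ d)) (∙-identityˡ x))
    back : ∀ x → (d ⁻¹) ∙ (d ∙ x) ≡ x
    back x = ≡.trans (≡.sym (∙-assoc (d ⁻¹) d x)) (≡.trans (≡.cong (_∙ x) (⁻¹-inverseˡ d)) (∙-identityˡ x))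

  ∑∑-product : ∀ f g → ∑ f * ∑ g ≈ ∑ (λ x → ∑ (λ y → f x * g y))
  ∑∑-product f g = trans (∑-*ʳ (∑ g) f) (∑-cong (λ x → ∑-*ˡ (f x) g))

  [z∙x]∙z⁻¹ : ∀ z x → (z ∙ x) ∙ (z ⁻¹) ≡ x
  [z∙x]∙z⁻¹ z x = ≡.trans (≡.cong (_∙ (z ⁻¹)) (∙-comm z x))
    (≡.trans (∙-assoc x z (z ⁻¹)) (≡.trans (≡.cong (x ∙_) (⁻¹-inverseʳ z)) (∙-identityʳ x)))

  -- Nondegeneracy is recorded as orthogonality of characters: being an equation, it passes to
  -- subrings and to quotients.
  record IsGaussian (w w⁻ : Fin n → Carrier) : Set where
    χ : Fin n → Fin n → Carrier
    χ x y = w (x ∙ y) * w⁻ x * w⁻ y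

    field
      inverse    : ∀ x → w x * w⁻ x ≈ 1#
      even       : ∀ x → w (x ⁻¹) ≈ w x
      χ-∙ˡ       : ∀ x y z → χ (x ∙ y) z ≈ χ x z * χ y z
      orthogonal : ∀ {y} → y ≢ ε → ∑ (λ x → χ x y) ≈ 0#

    χ-comm : ∀ x y → χ x y ≈ χ y x
    χ-comm x y = trans (*-congʳ (*-congʳ (reflexive (≡.cong w (∙-comm x y)))))
      (solve 3 (λ a b c → a :* b :* c := a :* c :* b) refl (w (y ∙ x)) (w⁻ x) (w⁻ y))

    χ-∙ʳ : ∀ x y z → χ x (y ∙ z) ≈ χ x y * χ x z
    χ-∙ʳ x y z = trans (χ-comm x (y ∙ z)) (trans (χ-∙ˡ y z x) (*-cong (χ-comm y x) (χ-comm z x)))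

    w-∙ : ∀ x y → w (x ∙ y) ≈ w x * w y * χ x y
    w-∙ x y = sym (begin
      w x * w y * (w (x ∙ y) * w⁻ x * w⁻ y)          ≈⟨ solve 5 (λ a b c d e →
        a :* b :* (c :* d :* e) := c :* ((a :* d) :* (b :* e))) refl (w x) (w y) (w (x ∙ y)) (w⁻ x) (w⁻ y) ⟩
      w (x ∙ y) * ((w x * w⁻ x) * (w y * w⁻ y))      ≈⟨ *-congˡ (*-cong (inverse x) (inverse y)) ⟩
      w (x ∙ y) * (1# * 1#)                          ≈⟨ solve 1 (λ a → a :* (con ℤ.1ℤ :* con ℤ.1ℤ) := a) refl (w (x ∙ y)) ⟩
      w (x ∙ y)                                      ∎)

    -- An invertible idempotent is 1.
    χ-εˡ : ∀ z → χ ε z ≈ 1#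
    χ-εˡ z = sym (*-invertible-cancelˡ χ-inverse (begin
      χ ε z * 1#       ≈⟨ *-identityʳ _ ⟩
      χ ε z            ≡⟨ ≡.cong (λ x → χ x z) (∙-identityˡ ε) ⟨
      χ (ε ∙ ε) z      ≈⟨ χ-∙ˡ ε ε z ⟩
      χ ε z * χ ε z    ∎))
      where
      χ-inverse : χ ε z * (w⁻ (ε ∙ z) * w ε * w z) ≈ 1#
      χ-inverse = begin
        w (ε ∙ z) * w⁻ ε * w⁻ z * (w⁻ (ε ∙ z) * w ε * w z)          ≈⟨ solve 6 (λ a b c d e f →
          a :* b :* c :* (d :* e :* f) := (a :* d) :* (e :* b) :* (f :* c)) refl (w (ε ∙ z)) (w⁻ ε) (w⁻ z) (w⁻ (ε ∙ z)) (w ε) (w z) ⟩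
        (w (ε ∙ z) * w⁻ (ε ∙ z)) * (w ε * w⁻ ε) * (w z * w⁻ z)      ≈⟨ *-cong (*-cong (inverse _) (inverse ε)) (inverse z) ⟩
        1# * 1# * 1#                                                ≈⟨ solve 0 (con ℤ.1ℤ :* con ℤ.1ℤ :* con ℤ.1ℤ := con ℤ.1ℤ) refl ⟩
        1#                                                          ∎

    χ-εʳ : ∀ z → χ z ε ≈ 1#
    χ-εʳ z = trans (χ-comm z ε) (χ-εˡ z)

    wε≈1 : w ε ≈ 1#
    wε≈1 = begin
      w ε                            ≈⟨ solve 1 (λ a → a := a :* con ℤ.1ℤ) refl (w ε) ⟩
      w ε * 1#                       ≈⟨ *-congˡ (χ-εˡ ε) ⟨
      w ε * (w (ε ∙ ε) * w⁻ ε * w⁻ ε) ≈⟨ *-congˡ (*-congʳ (*-congʳ (reflexive (≡.cong w (∙-identityˡ ε))))) ⟩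
      w ε * (w ε * w⁻ ε * w⁻ ε)      ≈⟨ solve 2 (λ a b → a :* (a :* b :* b) := (a :* b) :* (a :* b)) refl (w ε) (w⁻ ε) ⟩
      (w ε * w⁻ ε) * (w ε * w⁻ ε)    ≈⟨ *-cong (inverse ε) (inverse ε) ⟩
      1# * 1#                        ≈⟨ *-identityˡ 1# ⟩
      1#                             ∎

    χ-⁻¹ˡ : ∀ x y → χ x y * χ (x ⁻¹) y ≈ 1#
    χ-⁻¹ˡ x y = trans (sym (χ-∙ˡ x (x ⁻¹) y))
      (trans (reflexive (≡.cong (λ z → χ z y) (⁻¹-inverseʳ x))) (χ-εˡ y))

    χ-⁻¹ʳ : ∀ x y → χ x y * χ x (y ⁻¹) ≈ 1#
    χ-⁻¹ʳ x y = trans (*-cong (χ-comm x y) (χ-comm x (y ⁻¹))) (χ-⁻¹ˡ y x)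

    χ-⁻¹ : ∀ x y → χ (x ⁻¹) y ≈ χ x (y ⁻¹)
    χ-⁻¹ x y = *-invertible-cancelˡ (χ-⁻¹ˡ x y) (trans (χ-⁻¹ˡ x y) (sym (χ-⁻¹ʳ x y)))

    -- This identity turns convolution with the Gaussian into a Fourier transform between two
    -- multiplications by Gaussians. Evenness absorbs the inverse in w (y ⁻¹).
    w⁻-difference : ∀ x y → w⁻ (x ∙ (y ⁻¹)) ≈ w⁻ x * w⁻ y * χ x y
    w⁻-difference x y = *-invertible-cancelˡ (inverse (x ∙ (y ⁻¹))) (trans (inverse _) (sym (begin
      w (x ∙ (y ⁻¹)) * (w⁻ x * w⁻ y * χ x y)
        ≈⟨ *-congʳ (trans (w-∙ x (y ⁻¹)) (*-congʳ (*-congˡ (even y)))) ⟩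
      w x * w y * χ x (y ⁻¹) * (w⁻ x * w⁻ y * χ x y)
        ≈⟨ solve 6 (λ a b c d e f → a :* b :* c :* (d :* e :* f) := (a :* d) :* (b :* e) :* (f :* c)) refl
             (w x) (w y) (χ x (y ⁻¹)) (w⁻ x) (w⁻ y) (χ x y) ⟩
      (w x * w⁻ x) * (w y * w⁻ y) * (χ x y * χ x (y ⁻¹))
        ≈⟨ *-cong (*-cong (inverse x) (inverse y)) (χ-⁻¹ʳ x y) ⟩
      1# * 1# * 1#
        ≈⟨ solve 0 (con ℤ.1ℤ :* con ℤ.1ℤ :* con ℤ.1ℤ := con ℤ.1ℤ) refl ⟩
      1# ∎)))

    orthogonalʳ : ∀ {x} → x ≢ ε → ∑ (χ x) ≈ 0#
    orthogonalʳ {x} x≢ε = trans (∑-cong (χ-comm x)) (orthogonal x≢ε)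

    ∑χε : ∀ {y} → y ≡ ε → ∑ (λ x → χ x y) ≈ ι n
    ∑χε ≡.refl = trans (∑-cong χ-εʳ) (trans (sum-const {n} 1#) (*-identityʳ _))

    gauss gauss⁻ : Carrier
    gauss  = ∑ w
    gauss⁻ = ∑ w⁻

    -- Translating z by u turns the double sum into that of w(z) χ(u,z), and summing over u leaves
    -- only z = `ε`. So the Gauss sum is a unit as soon as n is.
    gauss*gauss⁻ : gauss * gauss⁻ ≈ ι n
    gauss*gauss⁻ = begin
      gauss * gauss⁻                               ≈⟨ *-comm gauss gauss⁻ ⟩
      gauss⁻ * gauss                               ≈⟨ ∑∑-product w⁻ w ⟩
      ∑ (λ u → ∑ (λ z → w⁻ u * w z))               ≈⟨ ∑-cong (λ u → ∑-translate u (λ z → w⁻ u * w z)) ⟨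
      ∑ (λ u → ∑ (λ z → w⁻ u * w (u ∙ z)))         ≈⟨ ∑-cong (λ u → ∑-cong (λ z → pointwise u z)) ⟩
      ∑ (λ u → ∑ (λ z → w z * χ u z))              ≈⟨ ∑-comm (λ u z → w z * χ u z) ⟩
      ∑ (λ z → ∑ (λ u → w z * χ u z))              ≈⟨ ∑-cong (λ z → ∑-*ˡ (w z) (λ u → χ u z)) ⟨
      ∑ (λ z → w z * ∑ (λ u → χ u z))              ≈⟨ sum-single ε (λ z z≢ε → trans (*-congˡ (orthogonal z≢ε)) (zeroʳ _)) ⟩
      w ε * ∑ (λ u → χ u ε)                        ≈⟨ *-cong wε≈1 (∑χε ≡.refl) ⟩
      1# * ι n                                     ≈⟨ *-identityˡ _ ⟩
      ι n                                          ∎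
      where
      pointwise : ∀ u z → w⁻ u * w (u ∙ z) ≈ w z * χ u z
      pointwise u z = begin
        w⁻ u * w (u ∙ z)               ≈⟨ *-congˡ (w-∙ u z) ⟩
        w⁻ u * (w u * w z * χ u z)     ≈⟨ solve 4 (λ a b c d → a :* (b :* c :* d) := (b :* a) :* (c :* d)) refl (w⁻ u) (w u) (w z) (χ u z) ⟩
        (w u * w⁻ u) * (w z * χ u z)   ≈⟨ *-congʳ (inverse u) ⟩
        1# * (w z * χ u z)             ≈⟨ *-identityˡ _ ⟩
        w z * χ u z                    ∎

  module Transforms {w w⁻ : Fin n → Carrier} (w-gaussian : IsGaussian w w⁻) (e : Fin n → Carrier) where
    open IsGaussian w-gaussian

    a b : Fin n → Carrier
    a k = ∑ (λ y → χ k y * e y)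
    b m = ∑ (λ z → e z * w z * χ m z)

    ℓ : Fin n → Fin n → Carrier
    ℓ k l = ∑ (λ x → ∑ (λ y → χ l x * χ k y * (χ x y * e x * e y)))

    ∑-shift : ∀ k z → ∑ (λ y → χ k y * e (y ∙ (z ⁻¹))) ≈ χ k z * a k
    ∑-shift k z = begin
      ∑ (λ y → χ k y * e (y ∙ (z ⁻¹)))                ≈⟨ ∑-translate z (λ y → χ k y * e (y ∙ (z ⁻¹))) ⟨
      ∑ (λ y → χ k (z ∙ y) * e ((z ∙ y) ∙ (z ⁻¹)))    ≈⟨ ∑-cong (λ y → *-cong (χ-∙ʳ k z y) (reflexive (≡.cong e ([z∙x]∙z⁻¹ z y)))) ⟩
      ∑ (λ y → χ k z * χ k y * e y)                   ≈⟨ ∑-cong (λ y → *-assoc (χ k z) (χ k y) (e y)) ⟩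
      ∑ (λ y → χ k z * (χ k y * e y))                 ≈⟨ ∑-*ˡ (χ k z) (λ y → χ k y * e y) ⟨
      χ k z * a k                                     ∎

    convolution : Fin n → Fin n → Carrier
    convolution x y = ∑ (λ z → e (y ∙ (z ⁻¹)) * e z * w z * e (x ∙ (z ⁻¹)))

    -- For fixed z the sums over x and y separate. Translation by z extracts χ(l,z) and χ(k,z),
    -- whose product is χ(k ∙ l, z), and the sum over z becomes the transform b.
    ∑∑-convolution : ∀ k l → ∑ (λ x → ∑ (λ y → χ l x * χ k y * convolution x y)) ≈ a k * a l * b (k ∙ l)
    ∑∑-convolution k l = begin
      ∑ (λ x → ∑ (λ y → χ l x * χ k y * convolution x y))
        ≈⟨ ∑-cong (λ x → ∑-cong (λ y → trans (∑-*ˡ (χ l x * χ k y) (λ z → T x y z)) (∑-cong (λ z → U≈ x y z)))) ⟩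
      ∑ (λ x → ∑ (λ y → ∑ (λ z → U x y z)))
        ≈⟨ ∑-cong (λ x → ∑-comm (λ y z → U x y z)) ⟩
      ∑ (λ x → ∑ (λ z → ∑ (λ y → U x y z)))
        ≈⟨ ∑-comm (λ x z → ∑ (λ y → U x y z)) ⟩
      ∑ (λ z → ∑ (λ x → ∑ (λ y → U x y z)))
        ≈⟨ ∑-cong (λ z → trans (∑-cong (λ x → sym (∑-*ˡ (e z * w z) (λ y → f z x * h z y))))
             (sym (∑-*ˡ (e z * w z) (λ x → ∑ (λ y → f z x * h z y))))) ⟩
      ∑ (λ z → e z * w z * ∑ (λ x → ∑ (λ y → f z x * h z y)))
        ≈⟨ ∑-cong (λ z → *-congˡ (∑∑-product (f z) (h z))) ⟨
      ∑ (λ z → e z * w z * (∑ (f z) * ∑ (h z)))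
        ≈⟨ ∑-cong (λ z → *-congˡ (*-cong (∑-shift l z) (∑-shift k z))) ⟩
      ∑ (λ z → e z * w z * (χ l z * a l * (χ k z * a k)))
        ≈⟨ ∑-cong (λ z → trans
             (solve 5 (λ s x p y q → s :* (x :* p :* (y :* q)) := (q :* p) :* (s :* (y :* x))) refl (e z * w z) (χ l z) (a l) (χ k z) (a k))
             (*-congˡ (*-congˡ (sym (χ-∙ˡ k l z))))) ⟩
      ∑ (λ z → a k * a l * (e z * w z * χ (k ∙ l) z))
        ≈⟨ ∑-*ˡ (a k * a l) (λ z → e z * w z * χ (k ∙ l) z) ⟨
      a k * a l * b (k ∙ l) ∎
      where
      T U : Fin n → Fin n → Fin n → Carrier
      T x y z = e (y ∙ (z ⁻¹)) * e z * w z * e (x ∙ (z ⁻¹))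
      f h : Fin n → Fin n → Carrier
      f z x = χ l x * e (x ∙ (z ⁻¹))
      h z y = χ k y * e (y ∙ (z ⁻¹))
      U x y z = e z * w z * (f z x * h z y)
      U≈ : ∀ x y z → χ l x * χ k y * T x y z ≈ U x y z
      U≈ x y z = solve 6 (λ p q r s t u → p :* q :* (r :* s :* t :* u) := s :* t :* (p :* u :* (q :* r)))
        refl (χ l x) (χ k y) (e (y ∙ (z ⁻¹))) (e z) (w z) (e (x ∙ (z ⁻¹)))

    -- By orthogonality the unknown constant c transforms to zero away from (`ε`, `ε`).
    spectral : ∀ {ν c} → (∀ x y → ν * (χ x y * e x * e y) ≈ c + convolution x y) →
               ∀ {k l} → k ≢ ε ⊎ l ≢ ε → ν * ℓ k l ≈ a k * a l * b (k ∙ l)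
    spectral {ν} {c} equation {k} {l} k,l≢ε = begin
      ν * ℓ k l
        ≈⟨ trans (∑-*ˡ ν (λ x → ∑ (λ y → χ l x * χ k y * (χ x y * e x * e y))))
             (∑-cong (λ x → ∑-*ˡ ν (λ y → χ l x * χ k y * (χ x y * e x * e y)))) ⟩
      ∑ (λ x → ∑ (λ y → ν * (χ l x * χ k y * (χ x y * e x * e y))))
        ≈⟨ ∑-cong (λ x → ∑-cong (λ y → trans
             (solve 4 (λ s p q r → s :* (p :* q :* r) := p :* q :* (s :* r)) refl ν (χ l x) (χ k y) (χ x y * e x * e y))
             (trans (*-congˡ (equation x y)) (distribˡ _ c (convolution x y))))) ⟩
      ∑ (λ x → ∑ (λ y → χ l x * χ k y * c + χ l x * χ k y * convolution x y))
        ≈⟨ trans (∑-cong (λ x → ∑-distrib-+ (λ y → χ l x * χ k y * c) (λ y → χ l x * χ k y * convolution x y)))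
             (∑-distrib-+ (λ x → ∑ (λ y → χ l x * χ k y * c)) (λ x → ∑ (λ y → χ l x * χ k y * convolution x y))) ⟩
      ∑ (λ x → ∑ (λ y → χ l x * χ k y * c)) + ∑ (λ x → ∑ (λ y → χ l x * χ k y * convolution x y))
        ≈⟨ +-cong constant (∑∑-convolution k l) ⟩
      0# + a k * a l * b (k ∙ l)
        ≈⟨ +-identityˡ _ ⟩
      a k * a l * b (k ∙ l) ∎
      where
      product≈0 : k ≢ ε ⊎ l ≢ ε → ∑ (χ l) * ∑ (χ k) ≈ 0#
      product≈0 (inj₁ k≢ε) = trans (*-congˡ (orthogonalʳ k≢ε)) (zeroʳ _)
      product≈0 (inj₂ l≢ε) = trans (*-congʳ (orthogonalʳ l≢ε)) (zeroˡ _)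
      constant : ∑ (λ x → ∑ (λ y → χ l x * χ k y * c)) ≈ 0#
      constant = begin
        ∑ (λ x → ∑ (λ y → χ l x * χ k y * c))   ≈⟨ ∑-cong (λ x → ∑-*ʳ c (λ y → χ l x * χ k y)) ⟨
        ∑ (λ x → ∑ (λ y → χ l x * χ k y) * c)   ≈⟨ ∑-*ʳ c (λ x → ∑ (λ y → χ l x * χ k y)) ⟨
        ∑ (λ x → ∑ (λ y → χ l x * χ k y)) * c   ≈⟨ *-congʳ (∑∑-product (χ l) (χ k)) ⟨
        ∑ (χ l) * ∑ (χ k) * c                   ≈⟨ *-congʳ (product≈0 k,l≢ε) ⟩
        0# * c                                  ≈⟨ zeroˡ c ⟩
        0#                                      ∎

    inversion : ∀ z → ∑ (λ t → a t * χ t (z ⁻¹)) ≈ ι n * e z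
    inversion z = begin
      ∑ (λ t → a t * χ t (z ⁻¹))
        ≈⟨ ∑-cong (λ t → trans (∑-*ʳ (χ t (z ⁻¹)) (λ y → χ t y * e y)) (∑-cong (λ y → trans
             (solve 3 (λ p q r → p :* q :* r := q :* (p :* r)) refl (χ t y) (e y) (χ t (z ⁻¹)))
             (*-congˡ (sym (χ-∙ʳ t y (z ⁻¹))))))) ⟩
      ∑ (λ t → ∑ (λ y → e y * χ t (y ∙ (z ⁻¹))))
        ≈⟨ ∑-comm (λ t y → e y * χ t (y ∙ (z ⁻¹))) ⟩
      ∑ (λ y → ∑ (λ t → e y * χ t (y ∙ (z ⁻¹))))
        ≈⟨ ∑-cong (λ y → ∑-*ˡ (e y) (λ t → χ t (y ∙ (z ⁻¹)))) ⟨
      ∑ (λ y → e y * ∑ (λ t → χ t (y ∙ (z ⁻¹))))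
        ≈⟨ sum-single z (λ y y≢z → trans (*-congˡ (orthogonal (λ eq → y≢z (x∙y⁻¹≈ε⇒x≈y y z eq)))) (zeroʳ _)) ⟩
      e z * ∑ (λ t → χ t (z ∙ (z ⁻¹)))
        ≈⟨ *-congˡ (∑χε (⁻¹-inverseʳ z)) ⟩
      e z * ι n
        ≈⟨ *-comm (e z) (ι n) ⟩
      ι n * e z ∎

    -- The Fourier transform of e ⟨·⟩ is a Gaussian convolution of that of e.
    b-gaussian : ∀ m → ι n * b m ≈ gauss * ∑ (λ t → a t * w⁻ (m ∙ (t ⁻¹)))
    b-gaussian m = begin
      ι n * b m
        ≈⟨ ∑-*ˡ (ι n) (λ z → e z * w z * χ m z) ⟩
      ∑ (λ z → ι n * (e z * w z * χ m z))
        ≈⟨ ∑-cong (λ z → trans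
             (solve 4 (λ p q r s → p :* (q :* r :* s) := p :* q :* (r :* s)) refl (ι n) (e z) (w z) (χ m z))
             (trans (*-congʳ (sym (inversion z))) (∑-*ʳ (w z * χ m z) (λ t → a t * χ t (z ⁻¹))))) ⟩
      ∑ (λ z → ∑ (λ t → a t * χ t (z ⁻¹) * (w z * χ m z)))
        ≈⟨ ∑-comm (λ z t → a t * χ t (z ⁻¹) * (w z * χ m z)) ⟩
      ∑ (λ t → ∑ (λ z → a t * χ t (z ⁻¹) * (w z * χ m z)))
        ≈⟨ ∑-cong (λ t → ∑-cong (λ z → pointwise t z)) ⟩
      ∑ (λ t → ∑ (λ z → a t * w⁻ (m ∙ (t ⁻¹)) * w ((m ∙ (t ⁻¹)) ∙ z)))
        ≈⟨ ∑-cong (λ t → trans (sym (∑-*ˡ (a t * w⁻ (m ∙ (t ⁻¹))) (λ z → w ((m ∙ (t ⁻¹)) ∙ z))))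
             (trans (*-congˡ (∑-translate (m ∙ (t ⁻¹)) w)) (*-comm _ gauss))) ⟩
      ∑ (λ t → gauss * (a t * w⁻ (m ∙ (t ⁻¹))))
        ≈⟨ ∑-*ˡ gauss (λ t → a t * w⁻ (m ∙ (t ⁻¹))) ⟨
      gauss * ∑ (λ t → a t * w⁻ (m ∙ (t ⁻¹))) ∎
      where
      -- Completing the square: with d = m ∙ t⁻¹, both w(z) χ(d,z) and w⁻(d) w(d ∙ z) are the same
      -- value, and translation by d then makes the sum over z a Gauss sum.
      pointwise : ∀ t z → a t * χ t (z ⁻¹) * (w z * χ m z) ≈ a t * w⁻ (m ∙ (t ⁻¹)) * w ((m ∙ (t ⁻¹)) ∙ z)
      pointwise t z = begin
        a t * χ t (z ⁻¹) * (w z * χ m z)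
          ≈⟨ *-congʳ (*-congˡ (χ-⁻¹ t z)) ⟨
        a t * χ (t ⁻¹) z * (w z * χ m z)
          ≈⟨ solve 4 (λ p q r s → p :* q :* (r :* s) := p :* (con ℤ.1ℤ :* (r :* (s :* q)))) refl (a t) (χ (t ⁻¹) z) (w z) (χ m z) ⟩
        a t * (1# * (w z * (χ m z * χ (t ⁻¹) z)))
          ≈⟨ *-congˡ (*-cong (inverse d) (*-congˡ (χ-∙ˡ m (t ⁻¹) z))) ⟨
        a t * (w d * w⁻ d * (w z * χ d z))
          ≈⟨ solve 5 (λ p q r s u → p :* (q :* r :* (s :* u)) := p :* r :* (q :* s :* u)) refl (a t) (w d) (w⁻ d) (w z) (χ d z) ⟩
        a t * w⁻ d * (w d * w z * χ d z)
          ≈⟨ *-congˡ (w-∙ d z) ⟨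
        a t * w⁻ d * w (d ∙ z) ∎
        where d = m ∙ (t ⁻¹)

    module _ {n⁻¹ : Carrier} (n-inverse : ι n * n⁻¹ ≈ 1#) where

      module Concentrated (a≈0 : ∀ {k} → k ≢ ε → a k ≈ 0#) {x₀} (ex₀≈1 : e x₀ ≈ 1#) where

        aε≈ : ∀ z → a ε ≈ ι n * e z
        aε≈ z = begin
          a ε                              ≈⟨ *-identityʳ _ ⟨
          a ε * 1#                         ≈⟨ *-congˡ (χ-εˡ (z ⁻¹)) ⟨
          a ε * χ ε (z ⁻¹)                 ≈⟨ sum-single ε (λ t t≢ε → trans (*-congʳ (a≈0 t≢ε)) (zeroˡ _)) ⟨
          ∑ (λ t → a t * χ t (z ⁻¹))       ≈⟨ inversion z ⟩
          ι n * e z                        ∎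

        aε≈n : a ε ≈ ι n
        aε≈n = trans (aε≈ x₀) (trans (*-congˡ ex₀≈1) (*-identityʳ _))

        e≈1 : ∀ z → e z ≈ 1#
        e≈1 z = *-invertible-cancelˡ n-inverse (trans (sym (aε≈ z)) (trans (aε≈ x₀) (*-congˡ ex₀≈1)))

        b≈ : ∀ m → b m ≈ gauss * w⁻ m
        b≈ m = *-invertible-cancelˡ n-inverse (begin
          ι n * b m                                   ≈⟨ b-gaussian m ⟩
          gauss * ∑ (λ t → a t * w⁻ (m ∙ (t ⁻¹)))     ≈⟨ *-congˡ (sum-single ε (λ t t≢ε → trans (*-congʳ (a≈0 t≢ε)) (zeroˡ _))) ⟩
          gauss * (a ε * w⁻ (m ∙ (ε ⁻¹)))             ≈⟨ *-congˡ (*-cong aε≈n (reflexive (≡.cong w⁻ m∙ε⁻¹))) ⟩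
          gauss * (ι n * w⁻ m)                        ≈⟨ solve 3 (λ p q r → p :* (q :* r) := q :* (p :* r)) refl gauss (ι n) (w⁻ m) ⟩
          ι n * (gauss * w⁻ m)                        ∎)
          where
          m∙ε⁻¹ : m ∙ (ε ⁻¹) ≡ m
          m∙ε⁻¹ = ≡.trans (≡.cong (m ∙_) ε⁻¹≈ε) (∙-identityʳ m)

        ℓ≈ : ∀ k l → ℓ k l ≈ χ l (k ⁻¹) * ι n
        ℓ≈ k l = begin
          ∑ (λ x → ∑ (λ y → χ l x * χ k y * (χ x y * e x * e y)))
            ≈⟨ ∑-cong (λ x → trans (∑-cong (λ y → pointwise x y)) (sym (∑-*ˡ (χ l x) (χ (x ∙ k))))) ⟩
          ∑ (λ x → χ l x * ∑ (χ (x ∙ k)))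
            ≈⟨ sum-single (k ⁻¹) (λ x x≢k⁻¹ → trans (*-congˡ (orthogonalʳ (x≢k⁻¹ ∘ inverseˡ-unique x))) (zeroʳ _)) ⟩
          χ l (k ⁻¹) * ∑ (χ ((k ⁻¹) ∙ k))
            ≈⟨ *-congˡ (trans (∑-cong (χ-comm ((k ⁻¹) ∙ k))) (∑χε (⁻¹-inverseˡ k))) ⟩
          χ l (k ⁻¹) * ι n ∎
          where
          inverseˡ-unique : ∀ x → x ∙ k ≡ ε → x ≡ k ⁻¹
          inverseˡ-unique x eq = GroupProperties.inverseˡ-unique group x k eq
          pointwise : ∀ x y → χ l x * χ k y * (χ x y * e x * e y) ≈ χ l x * χ (x ∙ k) y
          pointwise x y = begin
            χ l x * χ k y * (χ x y * e x * e y)    ≈⟨ *-congˡ (*-cong (*-congˡ (e≈1 x)) (e≈1 y)) ⟩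
            χ l x * χ k y * (χ x y * 1# * 1#)      ≈⟨ solve 3 (λ p q r → p :* q :* (r :* con ℤ.1ℤ :* con ℤ.1ℤ) := p :* (r :* q)) refl (χ l x) (χ k y) (χ x y) ⟩
            χ l x * (χ x y * χ k y)                ≈⟨ *-congˡ (χ-∙ˡ x k y) ⟨
            χ l x * χ (x ∙ k) y                    ∎

        collapse : ∀ k → ℓ k k * (a ε * b k * (a ε * b k)) ≈ 0# → 1# ≈ 0#
        collapse k eq = begin
          1#
            ≈⟨ solve 0 (con ℤ.1ℤ := con ℤ.1ℤ :* con ℤ.1ℤ :* (con ℤ.1ℤ :* con ℤ.1ℤ :* con ℤ.1ℤ) :* (con ℤ.1ℤ :* con ℤ.1ℤ :* con ℤ.1ℤ)) refl ⟩
          1# * 1# * (1# * 1# * 1#) * (1# * 1# * 1#)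
            ≈⟨ *-cong (*-cong (*-cong (χ-⁻¹ʳ k (k ⁻¹)) n-inverse) unit) unit ⟨
          χ k (k ⁻¹) * χ k ((k ⁻¹) ⁻¹) * (ι n * n⁻¹) * U * U
            ≈⟨ solve 8 (λ c c′ m m′ g g′ x x′ →
                 c :* c′ :* (m :* m′) :* (m :* m′ :* (g :* g′ :* m′) :* (x :* x′)) :* (m :* m′ :* (g :* g′ :* m′) :* (x :* x′)) :=
                 c′ :* m′ :* (m′ :* (g′ :* m′) :* x) :* (m′ :* (g′ :* m′) :* x) :*
                 (c :* m :* (m :* (g :* x′) :* (m :* (g :* x′))))) refl
                 (χ k (k ⁻¹)) (χ k ((k ⁻¹) ⁻¹)) (ι n) n⁻¹ gauss gauss⁻ (w k) (w⁻ k) ⟩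
          V * (χ k (k ⁻¹) * ι n * (ι n * (gauss * w⁻ k) * (ι n * (gauss * w⁻ k))))
            ≈⟨ *-congˡ (*-cong (ℓ≈ k k) (*-cong (*-cong aε≈n (b≈ k)) (*-cong aε≈n (b≈ k)))) ⟨
          V * (ℓ k k * (a ε * b k * (a ε * b k)))
            ≈⟨ trans (*-congˡ eq) (zeroʳ V) ⟩
          0# ∎
          where
          -- `U` is a product of pairs of inverses, hence 1. `V` is the explicit inverse of ℓ(k,k)
          -- (a(ε) b(k))², whose value follows from `ℓ≈`, `aε≈n` and `b≈`.
          U V : Carrier
          U = ι n * n⁻¹ * (gauss * gauss⁻ * n⁻¹) * (w k * w⁻ k)
          V = χ k ((k ⁻¹) ⁻¹) * n⁻¹ * (n⁻¹ * (gauss⁻ * n⁻¹) * w k) * (n⁻¹ * (gauss⁻ * n⁻¹) * w k)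
          unit : U ≈ 1# * 1# * 1#
          unit = *-cong (*-cong n-inverse (trans (*-congʳ gauss*gauss⁻) n-inverse)) (inverse k)

      module _ (n-prime : Prime n) {ζ} (ζ-primitive : PrimitiveRoot.IsPrimitiveRoot R n ζ)
        (torsionFree : PrimitiveRoot.TorsionFree R) (χ≈ζ^ : ∀ x y → χ x y ≈ ζ ^ (toℕ x ℕ.* toℕ y)) where

        a-vanishes : ∀ s → (∀ l → a l ≈ 0# ⊎ b (l ∙ s) ≈ 0#) → a s ≈ 0#
        a-vanishes s vanish = *-invertible-cancelˡ unit (trans (begin
          w⁻ s * χ s s * a s       ≈⟨ solve 3 (λ p q r → p :* q :* r := r :* p :* q) refl (w⁻ s) (χ s s) (a s) ⟩
          v s                      ≈⟨ PrimitiveRoot.chebotarev R n-prime ζ-primitive torsionFree v (Sum.map v≈0 v̂≈0 ∘ vanish) s ⟩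
          0#                       ∎) (sym (zeroʳ _)))
          where
          v : Fin n → Carrier
          -- By `w⁻-difference`, w⁻(l ∙ s ∙ t⁻¹) is w⁻(l ∙ s) times w⁻(t) χ(s,t) χ(l,t). So n b(l ∙
          -- s) is a unit times the Fourier coefficient at l of this v.
          v t = a t * w⁻ t * χ s t
          unit : w⁻ s * χ s s * (w s * χ s (s ⁻¹)) ≈ 1#
          unit = begin
            w⁻ s * χ s s * (w s * χ s (s ⁻¹))        ≈⟨ solve 4 (λ p q r u → p :* q :* (r :* u) := r :* p :* (q :* u)) refl (w⁻ s) (χ s s) (w s) (χ s (s ⁻¹)) ⟩
            w s * w⁻ s * (χ s s * χ s (s ⁻¹))        ≈⟨ *-cong (inverse s) (χ-⁻¹ʳ s s) ⟩
            1# * 1#                                  ≈⟨ *-identityˡ 1# ⟩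
            1#                                       ∎
          v≈0 : ∀ {l} → a l ≈ 0# → v l ≈ 0#
          v≈0 {l} al≈0 = trans (*-congʳ (*-congʳ al≈0)) (solve 2 (λ p q → con ℤ.0ℤ :* p :* q := con ℤ.0ℤ) refl (w⁻ l) (χ s l))
          v̂≈0 : ∀ {l} → b (l ∙ s) ≈ 0# → ∑ (λ t → v t * ζ ^ (toℕ l ℕ.* toℕ t)) ≈ 0#
          v̂≈0 {l} b≈0 = *-invertible-cancelˡ factor-unit (begin
            gauss * w⁻ m * ∑ (λ t → v t * ζ ^ (toℕ l ℕ.* toℕ t))
              ≈⟨ *-congˡ (∑-cong (λ t → *-congˡ (χ≈ζ^ l t))) ⟨
            gauss * w⁻ m * ∑ (λ t → v t * χ l t)
              ≈⟨ trans (*-assoc gauss (w⁻ m) _) (*-congˡ (∑-*ˡ (w⁻ m) (λ t → v t * χ l t))) ⟩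
            gauss * ∑ (λ t → w⁻ m * (v t * χ l t))
              ≈⟨ *-congˡ (∑-cong pointwise) ⟩
            gauss * ∑ (λ t → a t * w⁻ (m ∙ (t ⁻¹)))
              ≈⟨ b-gaussian m ⟨
            ι n * b m
              ≈⟨ trans (*-congˡ b≈0) (trans (zeroʳ _) (sym (zeroʳ _))) ⟩
            gauss * w⁻ m * 0# ∎)
            where
            m = l ∙ s
            pointwise : ∀ t → w⁻ m * (v t * χ l t) ≈ a t * w⁻ (m ∙ (t ⁻¹))
            pointwise t = begin
              w⁻ m * (a t * w⁻ t * χ s t * χ l t)     ≈⟨ solve 5 (λ p q r x y → p :* (q :* r :* x :* y) := q :* (p :* r :* (y :* x))) refl (w⁻ m) (a t) (w⁻ t) (χ s t) (χ l t) ⟩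
              a t * (w⁻ m * w⁻ t * (χ l t * χ s t))   ≈⟨ *-congˡ (*-congˡ (χ-∙ˡ l s t)) ⟨
              a t * (w⁻ m * w⁻ t * χ m t)             ≈⟨ *-congˡ (w⁻-difference m t) ⟨
              a t * w⁻ (m ∙ (t ⁻¹))                   ∎
            factor-unit : gauss * w⁻ m * (gauss⁻ * n⁻¹ * w m) ≈ 1#
            factor-unit = begin
              gauss * w⁻ m * (gauss⁻ * n⁻¹ * w m)       ≈⟨ solve 5 (λ g u g′ i x → g :* u :* (g′ :* i :* x) := g :* g′ :* i :* (x :* u)) refl gauss (w⁻ m) gauss⁻ n⁻¹ (w m) ⟩
              gauss * gauss⁻ * n⁻¹ * (w m * w⁻ m)       ≈⟨ *-cong (trans (*-congʳ gauss*gauss⁻) n-inverse) (inverse m) ⟩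
              1# * 1#                                   ≈⟨ *-identityˡ 1# ⟩
              1#                                        ∎

-- The functional equation with coefficient ν in an ideal

module IdealTheory (R : CommutativeRing 0ℓ 0ℓ) where
  open CommutativeRingTools R
  open SetoidReasoning setoid

  record IsIdeal (J : Pred Carrier 0ℓ) : Set where
    field
      resp : ∀ {x y} → x ≈ y → x ∈ J → y ∈ J
      0∈   : 0# ∈ J
      +∈   : ∀ {x y} → x ∈ J → y ∈ J → x + y ∈ J
      *∈   : ∀ a {x} → x ∈ J → a * x ∈ J

    -∈ : ∀ {x} → x ∈ J → - x ∈ J
    -∈ {x} x∈ = resp (-1*x≈-x x) (*∈ (- 1#) x∈)

    infix 4 _∼_
    _∼_ : Carrier → Carrier → Set
    x ∼ y = x - y ∈ J

    ≈⇒∼ : ∀ {x y} → x ≈ y → x ∼ y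
    ≈⇒∼ x≈y = resp (sym (x≈y⇒x-y≈0 x≈y)) 0∈

    ∼0 : ∀ {x} → x ∈ J → x ∼ 0#
    ∼0 {x} x∈ = resp (solve 1 (λ a → a := a :- con ℤ.0ℤ) refl x) x∈

    ∼0⁻¹ : ∀ {x} → x ∼ 0# → x ∈ J
    ∼0⁻¹ {x} x∼0 = resp (solve 1 (λ a → a :- con ℤ.0ℤ := a) refl x) x∼0

    -- Carrier and operations are kept and only equality is coarsened, so the transforms a, b and ℓ
    -- need no transport to the quotient.
    quotient : CommutativeRing 0ℓ 0ℓ
    quotient = record
      { Carrier = Carrier ; _≈_ = _∼_ ; _+_ = _+_ ; _*_ = _*_ ; -_ = -_ ; 0# = 0# ; 1# = 1#
      ; isCommutativeRing = record
        { isRing = record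
          { +-isAbelianGroup = record
            { isGroup = record
              { isMonoid = record
                { isSemigroup = record
                  { isMagma = record
                    { isEquivalence = record
                      { refl  = ≈⇒∼ refl
                      ; sym   = λ {x} {y} x∼y → resp (solve 2 (λ a b → :- (a :- b) := b :- a) refl x y) (-∈ x∼y)
                      ; trans = λ {x} {y} {z} x∼y y∼z → resp
                          (solve 3 (λ a b c → (a :- b) :+ (b :- c) := a :- c) refl x y z) (+∈ x∼y y∼z)
                      }
                    ; ∙-cong = λ {x} {y} {u} {v} x∼y u∼v → resp
                        (solve 4 (λ a b c d → (a :- b) :+ (c :- d) := (a :+ c) :- (b :+ d)) refl x y u v) (+∈ x∼y u∼v)
                    }
                  ; assoc = λ x y z → ≈⇒∼ (+-assoc x y z)
                  }
                ; identity = (λ x → ≈⇒∼ (+-identityˡ x)) , (λ x → ≈⇒∼ (+-identityʳ x))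
                }
              ; inverse = (λ x → ≈⇒∼ (-‿inverseˡ x)) , (λ x → ≈⇒∼ (-‿inverseʳ x))
              ; ⁻¹-cong = λ {x} {y} x∼y → resp (solve 2 (λ a b → :- (a :- b) := (:- a) :- (:- b)) refl x y) (-∈ x∼y)
              }
            ; comm = λ x y → ≈⇒∼ (+-comm x y)
            }
          ; *-cong = λ {x} {y} {u} {v} x∼y u∼v → resp
              (solve 4 (λ a b c d → a :* (c :- d) :+ d :* (a :- b) := a :* c :- b :* d) refl x y u v)
              (+∈ (*∈ x u∼v) (*∈ v x∼y))
          ; *-assoc = λ x y z → ≈⇒∼ (*-assoc x y z)
          ; *-identity = (λ x → ≈⇒∼ (*-identityˡ x)) , (λ x → ≈⇒∼ (*-identityʳ x))
          ; distrib = (λ x y z → ≈⇒∼ (distribˡ x y z)) , (λ x y z → ≈⇒∼ (distribʳ x y z))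
          }
        ; *-comm = λ x y → ≈⇒∼ (*-comm x y)
        }
      }

  module _ {J : Pred Carrier 0ℓ} (J-ideal : IsIdeal J) where
    open IsIdeal J-ideal

    adjoin : Carrier → Pred Carrier 0ℓ
    adjoin x y = ∃[ j ] ∃[ r ] j ∈ J × y ≈ j + r * x

    adjoin-ideal : ∀ x → IsIdeal (adjoin x)
    adjoin-ideal x = record
      { resp = λ y≈z (j , r , j∈ , y≈) → j , r , j∈ , trans (sym y≈z) y≈
      ; 0∈   = 0# , 0# , 0∈ , solve 1 (λ x → con ℤ.0ℤ := con ℤ.0ℤ :+ con ℤ.0ℤ :* x) refl x
      ; +∈   = λ (j , r , j∈ , y≈) (i , s , i∈ , z≈) → j + i , r + s , +∈ j∈ i∈ , trans (+-cong y≈ z≈)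
          (solve 5 (λ j r i s x → (j :+ r :* x) :+ (i :+ s :* x) := (j :+ i) :+ (r :+ s) :* x) refl j r i s x)
      ; *∈   = λ a (j , r , j∈ , y≈) → a * j , a * r , *∈ a j∈ , trans (*-congˡ y≈)
          (solve 4 (λ a j r x → a :* (j :+ r :* x) := a :* j :+ a :* r :* x) refl a j r x)
      }

    ⊆-adjoin : ∀ x {y} → y ∈ J → y ∈ adjoin x
    ⊆-adjoin x {y} y∈ = y , 0# , y∈ , solve 2 (λ y x → y := y :+ con ℤ.0ℤ :* x) refl y x

    ∈-adjoin : ∀ x → x ∈ adjoin x
    ∈-adjoin x = 0# , 1# , 0∈ , solve 1 (λ x → x := con ℤ.0ℤ :+ con ℤ.1ℤ :* x) refl x

    adjoin-product : ∀ {x y} → x * y ∈ J → 1# ∈ adjoin x → 1# ∈ adjoin y → 1# ∈ J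
    adjoin-product {x} {y} xy∈ (j , r , j∈ , 1≈) (i , s , i∈ , 1≈′) = resp
      (sym (trans (trans (sym (*-identityˡ 1#)) (*-cong 1≈ 1≈′))
        (solve 6 (λ j r x i s y → (j :+ r :* x) :* (i :+ s :* y) := ((i :+ s :* y) :* j :+ r :* x :* i) :+ r :* s :* (x :* y))
          refl j r x i s y)))
      (+∈ (+∈ (*∈ (i + s * y) j∈) (*∈ (r * x) i∈)) (*∈ (r * s) xy∈))

  -- It suffices to test properness of J on ideals that are prime as far as the given products go.
  split-products : ∀ {m} (xs ys : Fin m → Carrier) {J} → IsIdeal J → (∀ i → xs i * ys i ∈ J) →
    (∀ {J′} → IsIdeal J′ → (∀ {x} → x ∈ J → x ∈ J′) → (∀ i → xs i ∈ J′ ⊎ ys i ∈ J′) → 1# ∈ J′) → 1# ∈ J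
  split-products {zero}  xs ys J-ideal xy∈ test = test J-ideal id λ ()
  split-products {suc m} xs ys {J} J-ideal xy∈ test = adjoin-product J-ideal (xy∈ zero)
    (branch (xs zero) (inj₁ (∈-adjoin J-ideal _))) (branch (ys zero) (inj₂ (∈-adjoin J-ideal _)))
    where
    branch : ∀ z → xs zero ∈ adjoin J-ideal z ⊎ ys zero ∈ adjoin J-ideal z → 1# ∈ adjoin J-ideal z
    branch z z∈ = split-products (xs ∘ suc) (ys ∘ suc) (adjoin-ideal J-ideal z) (λ i → ⊆-adjoin J-ideal z (xy∈ (suc i)))
      λ J′-ideal ⊆J′ split → test J′-ideal (⊆J′ ∘ ⊆-adjoin J-ideal z)
        λ { zero → Sum.map ⊆J′ ⊆J′ z∈ ; (suc i) → split i }

  -- A substitute for a maximal ideal above J: if adjoining an element never makes a proper ideal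
  -- above J improper, a maximal ideal would contain it, so the element may be assumed to lie in the
  -- ideal under test.
  adjoin-all : ∀ {m} (xs : Fin m → Carrier) {J} → IsIdeal J →
    (∀ i {J′} (J′-ideal : IsIdeal J′) → (∀ {x} → x ∈ J → x ∈ J′) → 1# ∈ adjoin J′-ideal (xs i) → 1# ∈ J′) →
    (∀ {J′} → IsIdeal J′ → (∀ {x} → x ∈ J → x ∈ J′) → (∀ i → xs i ∈ J′) → 1# ∈ J′) → 1# ∈ J
  adjoin-all {zero}  xs J-ideal remove test = test J-ideal id λ ()
  adjoin-all {suc m} xs {J} J-ideal remove test = remove zero J-ideal id
    (adjoin-all (xs ∘ suc) (adjoin-ideal J-ideal x)
      (λ i J′-ideal ⊆J′ → remove (suc i) J′-ideal (⊆J′ ∘ ⊆-adjoin J-ideal x))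
      λ J′-ideal ⊆J′ xs∈ → test J′-ideal (⊆J′ ∘ ⊆-adjoin J-ideal x)
        λ { zero → ⊆J′ (∈-adjoin J-ideal x) ; (suc i) → xs∈ i })
    where x = xs zero

module AtInfinity (R : CommutativeRing 0ℓ 0ℓ) {p : ℕ} (p-prime : Prime p)
  {_∙_ : Op₂ (Fin p)} {ε : Fin p} {_⁻¹ : Op₁ (Fin p)} (isAbelianGroup : IsAbelianGroup _≡_ _∙_ ε _⁻¹) where

  open CommutativeRingTools R
  open Frequencies R using (Regular)
  open PrimitiveRoot R using (IsPrimitiveRoot; TorsionFree)
  open IdealTheory R
  open FourierAnalysis R isAbelianGroup
  open SetoidReasoning setoid

  module _ {w w⁻ : Fin p → Carrier} (gaussian : IsGaussian w w⁻) {ζ} (ζ-primitive : IsPrimitiveRoot p ζ)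
    (χ≈ζ^ : ∀ x y → IsGaussian.χ gaussian x y ≈ ζ ^ (toℕ x ℕ.* toℕ y))
    (ι-inverse : ∀ m → ∃[ y ] ι (suc m) * y ≈ 1#) (e : Fin p → Carrier) where

    open IsGaussian gaussian
    open Transforms gaussian e

    private
      module Quotient {J : Pred Carrier 0ℓ} (J-ideal : IsIdeal J) where
        open IsIdeal J-ideal
        module Q = CommutativeRingTools quotient
        module FQ = FourierAnalysis quotient isAbelianGroup

        ι≡ : ∀ m → Q.ι m ≡ ι m
        ι≡ zero    = ≡.refl
        ι≡ (suc m) = ≡.cong (1# +_) (ι≡ m)

        ^≡ : ∀ x m → x Q.^ m ≡ x ^ m
        ^≡ x zero    = ≡.refl
        ^≡ x (suc m) = ≡.cong (x *_) (^≡ x m)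

        gaussianQ : FQ.IsGaussian w w⁻
        gaussianQ = record
          { inverse = ≈⇒∼ ∘ inverse ; even = ≈⇒∼ ∘ even ; χ-∙ˡ = λ x y z → ≈⇒∼ (χ-∙ˡ x y z)
          ; orthogonal = ≈⇒∼ ∘ orthogonal }

        primitiveQ : PrimitiveRoot.IsPrimitiveRoot quotient p ζ
        primitiveQ = record
          { ζ^p≈1 = Q.trans (Q.reflexive (^≡ ζ p)) (≈⇒∼ (IsPrimitiveRoot.ζ^p≈1 ζ-primitive))
          ; geometric = λ {j} 0<j j<p → Q.trans (Q.sum-cong-≋ {p} (λ i → Q.reflexive (^≡ ζ (toℕ i ℕ.* j))))
              (≈⇒∼ (IsPrimitiveRoot.geometric ζ-primitive 0<j j<p)) }

        inverseQ : ∀ m → Q.ι (suc m) * proj₁ (ι-inverse m) ∼ 1#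
        inverseQ m = Q.trans (Q.reflexive (≡.cong (_* proj₁ (ι-inverse m)) (ι≡ (suc m)))) (≈⇒∼ (proj₂ (ι-inverse m)))

        torsionFreeQ : PrimitiveRoot.TorsionFree quotient
        torsionFreeQ m x eq = Q.*-invertible-cancelˡ (inverseQ m) (Q.trans eq (Q.sym (Q.zeroʳ _)))

        n⁻¹ : Carrier
        n⁻¹ = proj₁ (ι-inverse (ℕ.pred p))

        n-inverseQ : Q.ι p * n⁻¹ ∼ 1#
        n-inverseQ = ≡.subst (λ m → Q.ι m * n⁻¹ ∼ 1#) (ℕ.suc-pred p {{prime⇒nonZero p-prime}}) (inverseQ (ℕ.pred p))

        χ≈ζ^Q : ∀ x y → χ x y ∼ ζ Q.^ (toℕ x ℕ.* toℕ y)
        χ≈ζ^Q x y = Q.trans (≈⇒∼ (χ≈ζ^ x y)) (Q.reflexive (≡.sym (^≡ ζ (toℕ x ℕ.* toℕ y))))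

        a-vanishesQ : ∀ s → (∀ l → a l ∈ J ⊎ b (l ∙ s) ∈ J) → a s ∈ J
        a-vanishesQ s vanish = ∼0⁻¹ (FQ.Transforms.a-vanishes gaussianQ e n-inverseQ p-prime primitiveQ torsionFreeQ χ≈ζ^Q s
          (Sum.map ∼0 ∼0 ∘ vanish))

        collapseQ : (∀ {k} → k ≢ ε → a k ∈ J) → ∀ {x₀} → e x₀ ≈ 1# →
                    ∀ k → ℓ k k * (a ε * b k * (a ε * b k)) ∈ J → 1# ∈ J
        collapseQ a∈ ex₀≈1 k eq = ∼0⁻¹ (FQ.Transforms.Concentrated.collapse gaussianQ e n-inverseQ
          (λ k≢ε → ∼0 (a∈ k≢ε)) (≈⇒∼ ex₀≈1) k (∼0 eq))

    module _ {ν c : Carrier} (equation : ∀ x y → ν * (χ x y * e x * e y) ≈ c + convolution x y) where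

      private
        -- Modulo J, `spectral` at (l, s) reads a(l) a(s) b(l ∙ s) = 0, and a(s) can be cancelled.
        -- Over an ideal containing one factor of each product a(l) b(l ∙ s), a(s) vanishes by
        -- Chebotarev, although y a(s) is 1 there.
        invertible⇒1∈ : ∀ {J} → IsIdeal J → ν ∈ J → ∀ {s} → s ≢ ε → ∀ {y} → 1# - y * a s ∈ J → 1# ∈ J
        invertible⇒1∈ {J} J-ideal ν∈ {s} s≢ε {y} ys∈ = split-products a (λ l → b (l ∙ s)) J-ideal product∈
          λ J′-ideal ⊆J′ split → IsIdeal.resp J′-ideal
            (solve 2 (λ y a → (con ℤ.1ℤ :- y :* a) :+ y :* a := con ℤ.1ℤ) refl y (a s))
            (IsIdeal.+∈ J′-ideal (⊆J′ ys∈) (IsIdeal.*∈ J′-ideal y (Quotient.a-vanishesQ J′-ideal s split)))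
          where
          open IsIdeal J-ideal
          product∈ : ∀ l → a l * b (l ∙ s) ∈ J
          product∈ l = resp (begin
            y * (ℓ l s * ν) + a l * b (l ∙ s) * (1# - y * a s)
              ≈⟨ +-congʳ (*-congˡ (trans (*-comm (ℓ l s) ν) (spectral equation (inj₂ s≢ε)))) ⟩
            y * (a l * a s * b (l ∙ s)) + a l * b (l ∙ s) * (1# - y * a s)
              ≈⟨ solve 4 (λ y a s b → y :* (a :* s :* b) :+ a :* b :* (con ℤ.1ℤ :- y :* s) := a :* b) refl y (a l) (a s) (b (l ∙ s)) ⟩
            a l * b (l ∙ s) ∎)
            (+∈ (*∈ y (*∈ (ℓ l s) ν∈)) (*∈ (a l * b (l ∙ s)) ys∈))

        -- The entry at `ε` is replaced by 0, so that the family is indexed by all of `Fin p`;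
        -- adjoining 0 changes no ideal.
        off-ε : Fin p → Carrier
        off-ε k = if does (k Fin.≟ ε) then 0# else a k

      -- Comparing the relations at (k, ε) and (k, k): the first makes a k of the size of ν, the second makes its square so.
      module _ (ν-regular : ν ∈ Regular) {x₀} (ex₀≈1 : e x₀ ≈ 1#) {k} (k≢ε : k ≢ ε) where

        ν-relation : ν * (ℓ k ε * ℓ k ε * b (k ∙ k)) ≈ ℓ k k * (a ε * b k * (a ε * b k))
        -- Times ν, both sides equal a(k)² (a(ε) b(k))² b(k ∙ k). The cancellation of ν has to
        -- precede any reduction modulo J, where both of these products are zero.
        ν-relation = x-y≈0⇒x≈y (ν-regular _ (begin
          ν * (ν * (ℓ k ε * ℓ k ε * b (k ∙ k)) - ℓ k k * (a ε * b k * (a ε * b k)))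
            ≈⟨ solve 5 (λ ν x z y u → ν :* (ν :* (x :* x :* z) :- y :* (u :* u)) := ν :* x :* (ν :* x) :* z :- ν :* y :* (u :* u))
                 refl ν (ℓ k ε) (b (k ∙ k)) (ℓ k k) (a ε * b k) ⟩
          ν * ℓ k ε * (ν * ℓ k ε) * b (k ∙ k) - ν * ℓ k k * (a ε * b k * (a ε * b k))
            ≈⟨ +-cong (*-congʳ (*-cong at-kε at-kε)) (-‿cong (*-congʳ (spectral equation (inj₁ k≢ε)))) ⟩
          a k * a ε * b k * (a k * a ε * b k) * b (k ∙ k) - a k * a k * b (k ∙ k) * (a ε * b k * (a ε * b k))
            ≈⟨ solve 4 (λ x y z u → x :* y :* z :* (x :* y :* z) :* u :- x :* x :* u :* (y :* z :* (y :* z)) := con ℤ.0ℤ)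
                 refl (a k) (a ε) (b k) (b (k ∙ k)) ⟩
          0# ∎))
          where
          at-kε : ν * ℓ k ε ≈ a k * a ε * b k
          at-kε = trans (spectral equation (inj₁ k≢ε))
            (*-congˡ (reflexive (≡.cong b (IsAbelianGroup.identityʳ isAbelianGroup k))))

        improper : ∀ {J} → IsIdeal J → ν ∈ J → 1# ∈ J
        improper J-ideal ν∈ = adjoin-all off-ε J-ideal remove
          λ J′-ideal ⊆J′ off∈ → let open IsIdeal J′-ideal in
            Quotient.collapseQ J′-ideal (λ {j} j≢ε → resp (reflexive (off-ε≡ j≢ε)) (off∈ j)) ex₀≈1 k
              (resp (trans (*-comm _ ν) ν-relation) (*∈ (ℓ k ε * ℓ k ε * b (k ∙ k)) (⊆J′ ν∈)))
          where
          off-ε≡ : ∀ {j} → j ≢ ε → off-ε j ≡ a j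
          off-ε≡ {j} j≢ε with j Fin.≟ ε
          ... | yes j≡ε = contradiction j≡ε j≢ε
          ... | no _    = ≡.refl
          remove : ∀ j {J′} (J′-ideal : IsIdeal J′) → _ → 1# ∈ adjoin J′-ideal (off-ε j) → 1# ∈ J′
          remove j J′-ideal ⊆J′ (i , r , i∈ , 1≈) with j Fin.≟ ε
          ... | yes _   = IsIdeal.resp J′-ideal (sym (trans 1≈ (trans (+-congˡ (zeroʳ r)) (+-identityʳ i)))) i∈
          ... | no j≢ε = invertible⇒1∈ J′-ideal (⊆J′ ν∈) j≢ε (IsIdeal.resp J′-ideal
            (trans (solve 2 (λ i x → i := (i :+ x) :- x) refl i (r * a j)) (+-congʳ (sym 1≈))) i∈)

-- Places

module PlaceTheory (F : CommutativeRing 0ℓ 0ℓ) where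
  open CommutativeRingTools F
  open Spans F using (IsNonunitalSubring; module IsNonunitalSubring)
  open SetoidReasoning setoid

  -- Values at x of polynomials of degree at most n in Horner form. The bound is kept because
  -- Chevalley's argument descends on it, and since P need not contain 1, the statement 1 ∈
  -- `Poly P x n` is a genuine relation.
  Poly : Pred Carrier 0ℓ → Carrier → ℕ → Pred Carrier 0ℓ
  Poly P x zero    z = z ∈ P
  Poly P x (suc n) z = ∃[ a ] ∃[ z′ ] a ∈ P × z′ ∈ Poly P x n × z ≈ a + x * z′

  poly-mono : ∀ {P Q} → P ⊆ Q → ∀ {x} n → Poly P x n ⊆ Poly Q x n
  poly-mono P⊆Q zero    z∈                     = P⊆Q z∈
  poly-mono P⊆Q (suc n) (a , z′ , a∈ , z′∈ , eq) = a , z′ , P⊆Q a∈ , poly-mono P⊆Q n z′∈ , eq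

  module _ {P : Pred Carrier 0ℓ} (P-subring : IsNonunitalSubring P) where
    open IsNonunitalSubring P-subring

    module _ {x : Carrier} where

      poly-resp : ∀ n {y z} → y ≈ z → y ∈ Poly P x n → z ∈ Poly P x n
      poly-resp zero    y≈z y∈                      = resp y≈z y∈
      poly-resp (suc n) y≈z (a , z′ , a∈ , z′∈ , eq) = a , z′ , a∈ , z′∈ , trans (sym y≈z) eq

      poly-const : ∀ n {a} → a ∈ P → a ∈ Poly P x n
      poly-const zero        a∈ = a∈
      poly-const (suc n) {a} a∈ = a , 0# , a∈ , poly-const n 0∈ , solve 2 (λ a x → a := a :+ x :* con ℤ.0ℤ) refl a x

      poly-pad : ∀ {m n} → m ℕ.≤ n → Poly P x m ⊆ Poly P x n
      poly-pad {n = n} ℕ.z≤n       z∈                       = poly-const n z∈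
      poly-pad         (ℕ.s≤s m≤n) (a , z′ , a∈ , z′∈ , eq) = a , z′ , a∈ , poly-pad m≤n z′∈ , eq

      poly-+ : ∀ n {y z} → y ∈ Poly P x n → z ∈ Poly P x n → y + z ∈ Poly P x n
      poly-+ zero    y∈ z∈ = +∈ y∈ z∈
      poly-+ (suc n) (a , y′ , a∈ , y′∈ , eq) (b , z′ , b∈ , z′∈ , eq′) =
        a + b , y′ + z′ , +∈ a∈ b∈ , poly-+ n y′∈ z′∈ , trans (+-cong eq eq′)
          (solve 5 (λ a b x y z → (a :+ x :* y) :+ (b :+ x :* z) := (a :+ b) :+ x :* (y :+ z)) refl a b x y′ z′)

      poly-shift : ∀ n {z} → z ∈ Poly P x n → x * z ∈ Poly P x (suc n)
      poly-shift n {z} z∈ = 0# , z , 0∈ , z∈ , sym (+-identityˡ _)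

      poly-monomial : ∀ n {a} → a ∈ P → x ^ n * a ∈ Poly P x n
      poly-monomial zero    a∈ = resp (sym (*-identityˡ _)) a∈
      poly-monomial (suc n) a∈ = poly-resp (suc n) (sym (*-assoc x (x ^ n) _)) (poly-shift n (poly-monomial n a∈))

      poly-top : ∀ n {z} → z ∈ Poly P x (suc n) → ∃[ w ] ∃[ a ] w ∈ Poly P x n × a ∈ P × z ≈ w + a * x ^ suc n
      poly-top zero (a , z′ , a∈ , z′∈ , eq) = a , z′ , a∈ , z′∈ ,
        trans eq (solve 3 (λ a x z → a :+ x :* z := a :+ z :* (x :* con ℤ.1ℤ)) refl a x z′)
      poly-top (suc n) (a , z′ , a∈ , z′∈ , eq) =
        let w , c , w∈ , c∈ , eq′ = poly-top n z′∈ in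
        a + x * w , c , (a , w , a∈ , w∈ , refl) , c∈ , trans eq (trans (+-congˡ (*-congˡ eq′))
          (solve 5 (λ a x w c y → a :+ x :* (w :+ c :* y) := (a :+ x :* w) :+ c :* (x :* y)) refl a x w c (x ^ suc n)))

    poly-scale : ∀ {x a} {Q : Pred Carrier 0ℓ} → (∀ {c} → c ∈ Q → a * c ∈ P) →
                 ∀ n {z} → z ∈ Poly Q x n → a * z ∈ Poly P x n
    poly-scale aQ⊆P zero    z∈                       = aQ⊆P z∈
    poly-scale {x} {a} aQ⊆P (suc n) (b , z′ , b∈ , z′∈ , eq) = a * b , a * z′ , aQ⊆P b∈ , poly-scale aQ⊆P n z′∈ ,
      trans (*-congˡ eq) (solve 4 (λ a b x z → a :* (b :+ x :* z) := a :* b :+ x :* (a :* z)) refl a b x z′)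

    poly-* : ∀ {x} {Q : Pred Carrier 0ℓ} → (∀ {a c} → a ∈ Q → c ∈ P → a * c ∈ P) →
             ∀ m n {y z} → y ∈ Poly Q x m → z ∈ Poly P x n → y * z ∈ Poly P x (m ℕ.+ n)
    poly-* QP⊆P zero    n y∈ z∈ = poly-scale (QP⊆P y∈) n z∈
    poly-* {x} QP⊆P (suc m) n {y} {z} (b , y′ , b∈ , y′∈ , eq) z∈ = poly-resp (suc m ℕ.+ n)
      (sym (trans (*-congʳ eq) (solve 4 (λ b x y z → (b :+ x :* y) :* z := b :* z :+ x :* (y :* z)) refl b x y′ z)))
      (poly-+ (suc m ℕ.+ n) (poly-pad (ℕ.m≤n+m n (suc m)) (poly-scale (QP⊆P b∈) n z∈))
        (poly-shift (m ℕ.+ n) (poly-* QP⊆P m n y′∈ z∈)))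

    -- Multiplication by x^l reverses the coefficients of a polynomial in y = 1/x.
    poly-reverse : ∀ {x y} → x * y ≈ 1# → ∀ {k l} → k ℕ.≤ l → ∀ {v} → v ∈ Poly P y k → x ^ l * v ∈ Poly P x l
    poly-reverse xy≈1 {l = l} ℕ.z≤n v∈ = poly-monomial l v∈
    poly-reverse {x} {y} xy≈1 {suc k} {suc l} (ℕ.s≤s k≤l) {v} (b , v′ , b∈ , v′∈ , eq) = poly-resp (suc l) (sym (begin
      x ^ suc l * v                                  ≈⟨ *-congˡ eq ⟩
      x * x ^ l * (b + y * v′)                       ≈⟨ solve 5 (λ x p b y v → x :* p :* (b :+ y :* v) := x :* p :* b :+ x :* y :* (p :* v)) refl x (x ^ l) b y v′ ⟩
      x ^ suc l * b + x * y * (x ^ l * v′)           ≈⟨ +-congˡ (trans (*-congʳ xy≈1) (*-identityˡ _)) ⟩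
      x ^ suc l * b + x ^ l * v′                     ∎))
      (poly-+ (suc l) (poly-monomial (suc l) b∈) (poly-pad (ℕ.n≤1+n l) (poly-reverse xy≈1 k≤l v′∈)))

    private
      -- Write 1 = w + a x^(n+1) and 1 - b = y v. In 1 = b + (1 - b)(w + a x^(n+1)) the top term
      -- becomes a x^n v, a polynomial in x of degree at most n because v has degree m ≤ n in y. The
      -- usual argument divides by 1 - b, which would require a local ring.
      lower-degree : ∀ {x y} → x * y ≈ 1# → ∀ {m n} → m ℕ.≤ n →
        1# ∈ Poly P x (suc n) → 1# ∈ Poly P y (suc m) → 1# ∈ Poly P x n
      lower-degree {x} {y} xy≈1 {m} {n} m≤n 1∈ (b , v , b∈ , v∈ , eq′) =
        let w , a , w∈ , a∈ , eq = poly-top n 1∈ in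
        poly-resp n (begin
          b + (w + (- b * w + a * (x ^ n * v)))
            ≈⟨ +-congˡ (+-congˡ (+-congˡ (trans (*-congˡ (sym (*-identityˡ _))) (*-congˡ (*-congʳ (sym xy≈1)))))) ⟩
          b + (w + (- b * w + a * (x * y * (x ^ n * v))))
            ≈⟨ solve 7 (λ b w a x y p v → b :+ (w :+ ((:- b) :* w :+ a :* (x :* y :* (p :* v)))) :=
                 b :+ (w :- b :* w :+ (w :+ a :* (x :* p)) :* ((b :+ y :* v) :- b) :- w :* ((b :+ y :* v) :- b)))
                 refl b w a x y (x ^ n) v ⟩
          b + (w - b * w + (w + a * x ^ suc n) * ((b + y * v) - b) - w * ((b + y * v) - b))
            ≈⟨ +-congˡ (+-cong (+-congˡ (*-cong (sym eq) (+-congʳ (sym eq′)))) (-‿cong (*-congˡ (+-congʳ (sym eq′))))) ⟩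
          b + (w - b * w + 1# * (1# - b) - w * (1# - b))
            ≈⟨ solve 2 (λ b w → b :+ (w :- b :* w :+ con ℤ.1ℤ :* (con ℤ.1ℤ :- b) :- w :* (con ℤ.1ℤ :- b)) := con ℤ.1ℤ) refl b w ⟩
          1# ∎)
          (poly-+ n (poly-const n b∈) (poly-+ n w∈ (poly-+ n (poly-scale (*∈ (-∈ b∈)) n w∈)
            (poly-scale (*∈ a∈) n (poly-reverse xy≈1 m≤n v∈)))))

    chevalley : ∀ {x y} → x * y ≈ 1# → ∀ m n → 1# ∈ Poly P x m → 1# ∈ Poly P y n → 1# ∈ P
    chevalley {x} {y} xy≈1 m n = go m n (m ℕ.+ n) ℕ.≤-refl
      where
      -- The larger of the two degrees is lowered each time, until one of them is 0, where the
      -- hypothesis is 1 ∈ P. `fuel` bounds their sum.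
      go : ∀ m n fuel → m ℕ.+ n ℕ.≤ fuel → 1# ∈ Poly P x m → 1# ∈ Poly P y n → 1# ∈ P
      go zero    n       fuel _ 1∈ _  = 1∈
      go (suc m) zero    fuel _ _  1∈ = 1∈
      go (suc m) (suc n) (suc fuel) (ℕ.s≤s le) 1∈ˣ 1∈ʸ with ℕ.≤-total n m
      ... | inj₁ n≤m = go m (suc n) fuel le (lower-degree xy≈1 n≤m 1∈ˣ 1∈ʸ) 1∈ʸ
      ... | inj₂ m≤n = go (suc m) n fuel (≡.subst (ℕ._≤ fuel) (ℕ.+-suc m n) le) 1∈ˣ
        (lower-degree (trans (*-comm y x) xy≈1) m≤n 1∈ʸ 1∈ˣ)

  record IsSubring (R : Pred Carrier 0ℓ) : Set where
    field
      isNonunitalSubring : IsNonunitalSubring R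
      1∈                 : 1# ∈ R
    open IsNonunitalSubring isNonunitalSubring public

    ι∈ : ∀ n → ι n ∈ R
    ι∈ zero    = 0∈
    ι∈ (suc n) = +∈ 1∈ (ι∈ n)

    ^∈ : ∀ {x} → x ∈ R → ∀ n → x ^ n ∈ R
    ^∈ x∈ zero    = 1∈
    ^∈ x∈ (suc n) = *∈ x∈ (^∈ x∈ n)

    subring : CommutativeRing 0ℓ 0ℓ
    subring = record
      { Carrier = ∃[ x ] x ∈ R
      ; _≈_ = λ x y → proj₁ x ≈ proj₁ y
      ; _+_ = λ x y → proj₁ x + proj₁ y , +∈ (proj₂ x) (proj₂ y)
      ; _*_ = λ x y → proj₁ x * proj₁ y , *∈ (proj₂ x) (proj₂ y)
      ; -_ = λ x → - proj₁ x , -∈ (proj₂ x)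
      ; 0# = 0# , 0∈
      ; 1# = 1# , 1∈
      ; isCommutativeRing = record
        { isRing = record
          { +-isAbelianGroup = record
            { isGroup = record
              { isMonoid = record
                { isSemigroup = record
                  { isMagma = record
                    { isEquivalence = record { refl = refl ; sym = sym ; trans = trans }
                    ; ∙-cong = +-cong }
                  ; assoc = λ x y z → +-assoc (proj₁ x) (proj₁ y) (proj₁ z) }
                ; identity = (λ x → +-identityˡ (proj₁ x)) , (λ x → +-identityʳ (proj₁ x)) }
              ; inverse = (λ x → -‿inverseˡ (proj₁ x)) , (λ x → -‿inverseʳ (proj₁ x))
              ; ⁻¹-cong = -‿cong }
            ; comm = λ x y → +-comm (proj₁ x) (proj₁ y) }
          ; *-cong = *-cong
          ; *-assoc = λ x y z → *-assoc (proj₁ x) (proj₁ y) (proj₁ z)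
          ; *-identity = (λ x → *-identityˡ (proj₁ x)) , (λ x → *-identityʳ (proj₁ x))
          ; distrib = (λ x y z → distribˡ (proj₁ x) (proj₁ y) (proj₁ z)) ,
                      (λ x y z → distribʳ (proj₁ x) (proj₁ y) (proj₁ z)) }
        ; *-comm = λ x y → *-comm (proj₁ x) (proj₁ y) } }

  -- A finite approximation to a valuation ring with its maximal ideal.
  record Pair : Set₁ where
    field
      R J       : Pred Carrier 0ℓ
      R-subring : IsSubring R
      J-subring : IsNonunitalSubring J
      J⊆R       : J ⊆ R
      RJ⊆J      : ∀ {a x} → a ∈ R → x ∈ J → a * x ∈ J
      proper    : 1# ∉ J

  open Pair

  infix 4 _≼_
  record _≼_ (V W : Pair) : Set where
    constructor _,_
    field
      R⊆ : R V ⊆ R W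
      J⊆ : J V ⊆ J W

  open _≼_ public

  ≼-refl : ∀ {V} → V ≼ V
  ≼-refl = id , id

  ≼-trans : ∀ {U V W} → U ≼ V → V ≼ W → U ≼ W
  ≼-trans (r , j) (r′ , j′) = (λ x∈ → r′ (r x∈)) , (λ x∈ → j′ (j x∈))

  poly-subring : ∀ {P} → IsNonunitalSubring P → ∀ x → IsNonunitalSubring (λ z → ∃[ n ] z ∈ Poly P x n)
  poly-subring P-subring x = record
    { resp = λ y≈z (n , y∈) → n , poly-resp P-subring n y≈z y∈
    ; 0∈   = 0 , 0∈
    ; +∈   = λ (m , y∈) (n , z∈) → m ℕ.⊔ n ,
        poly-+ P-subring (m ℕ.⊔ n) (poly-pad P-subring (ℕ.m≤m⊔n m n) y∈) (poly-pad P-subring (ℕ.m≤n⊔m m n) z∈)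
    ; -∈   = λ {z} (n , z∈) → n , poly-resp P-subring n (-1*x≈-x z)
        (poly-scale P-subring (λ {c} c∈ → resp (sym (-1*x≈-x c)) (-∈ c∈)) n z∈)
    ; *∈   = λ (m , y∈) (n , z∈) → m ℕ.+ n , poly-* P-subring *∈ m n y∈ z∈
    }
    where open IsNonunitalSubring P-subring

  adjoin-element : (V : Pair) (x : Carrier) → ¬ (∃[ n ] 1# ∈ Poly (J V) x n) →
                   ∃[ W ] V ≼ W × x ∈ R W
  adjoin-element V x 1∉ = W , ((λ z∈ → 0 , z∈) , (λ z∈ → 0 , z∈)) ,
    1 , (0# , 1# , 0∈ , 1∈ , solve 1 (λ x → x := con ℤ.0ℤ :+ x :* con ℤ.1ℤ) refl x)
    where
    open IsSubring (R-subring V)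
    W : Pair
    W = record
      { R = λ z → ∃[ n ] z ∈ Poly (R V) x n
      ; J = λ z → ∃[ n ] z ∈ Poly (J V) x n
      ; R-subring = record { isNonunitalSubring = poly-subring isNonunitalSubring x ; 1∈ = 0 , 1∈ }
      ; J-subring = poly-subring (J-subring V) x
      ; J⊆R = λ (n , z∈) → n , poly-mono (J⊆R V) n z∈
      ; RJ⊆J = λ (m , a∈) (n , z∈) → m ℕ.+ n , poly-* (J-subring V) (RJ⊆J V) m n a∈ z∈
      ; proper = 1∉
      }

  module _ (em : ExcludedMiddle 0ℓ) where

    adjoin-or-inverse : (V : Pair) → ∀ {x y} → x * y ≈ 1# →
                        (∃[ W ] V ≼ W × x ∈ R W) ⊎ (∃[ W ] V ≼ W × y ∈ R W)
    adjoin-or-inverse V {x} {y} xy≈1 with em {∃[ n ] 1# ∈ Poly (J V) x n}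
    ... | no 1∉        = inj₁ (adjoin-element V x 1∉)
    ... | yes (m , 1∈) = inj₂ (adjoin-element V y λ (n , 1∈′) → proper V (chevalley (J-subring V) xy≈1 m n 1∈ 1∈′))

    Adjoinable : Carrier → Set₁
    Adjoinable x = ∀ V → ∃[ W ] V ≼ W × x ∈ R W

    -- The inverse of x is x^n, and x = (x^n)^n because n² is 1 modulo n + 1. Whichever of the two
    -- is adjoined, x is in the ring.
    root-of-unity-adjoinable : ∀ {x} n → x ^ suc n ≈ 1# → Adjoinable x
    root-of-unity-adjoinable {x} n xⁿ⁺¹≈1 V with adjoin-or-inverse V {x} {x ^ n} xⁿ⁺¹≈1
    ... | inj₁ adjoined = adjoined
    ... | inj₂ (W , V≼W , xⁿ∈) = W , V≼W , resp (begin
      (x ^ n) ^ n                  ≈⟨ *-identityˡ _ ⟨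
      1# * (x ^ n) ^ n             ≈⟨ *-congʳ xⁿ⁺¹≈1 ⟨
      x * x ^ n * (x ^ n) ^ n      ≈⟨ *-assoc x (x ^ n) _ ⟩
      x * (x ^ n) ^ suc n          ≈⟨ *-congˡ (trans (^-assocʳ x n (suc n))
        (trans (reflexive (≡.cong (x ^_) (ℕ.*-comm n (suc n)))) (sym (^-assocʳ x (suc n) n)))) ⟩
      x * (x ^ suc n) ^ n          ≈⟨ *-congˡ (^-congˡ n xⁿ⁺¹≈1) ⟩
      x * 1# ^ n                   ≈⟨ *-congˡ (1^ n) ⟩
      x * 1#                       ≈⟨ *-identityʳ x ⟩
      x                            ∎) (^∈ xⁿ∈ n)
      where
      open IsSubring (R-subring W)

    -- If 1/x was adjoined instead of x, then x = n/x is in the ring as well.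
    √ι-adjoinable : ∀ {x y} n → x * x ≈ ι n → x * y ≈ 1# → Adjoinable x
    √ι-adjoinable {x} {y} n x²≈n xy≈1 V with adjoin-or-inverse V xy≈1
    ... | inj₁ adjoined = adjoined
    ... | inj₂ (W , V≼W , y∈) = W , V≼W , resp (begin
      ι n * y      ≈⟨ *-congʳ x²≈n ⟨
      x * x * y    ≈⟨ *-assoc x x y ⟩
      x * (x * y)  ≈⟨ *-congˡ xy≈1 ⟩
      x * 1#       ≈⟨ *-identityʳ x ⟩
      x            ∎) (*∈ (ι∈ n) y∈)
      where open IsSubring (R-subring W)

    adjoin-family : ∀ {m} (f : Fin m → Carrier) → (∀ i → Adjoinable (f i)) →
                    ∀ V → ∃[ W ] V ≼ W × (∀ i → f i ∈ R W)
    adjoin-family {zero}  f adjoinable V = V , ≼-refl {V} , λ ()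
    adjoin-family {suc m} f adjoinable V =
      let W , V≼W , fs∈ = adjoin-family (f ∘ suc) (adjoinable ∘ suc) V
          X , W≼X , f0∈ = adjoinable zero W
      in X , ≼-trans {V} {W} {X} V≼W W≼X , λ { zero → f0∈ ; (suc i) → R⊆ W≼X (fs∈ i) }

    record Dominant {m} (f : Fin m → Carrier) (V : Pair) : Set₁ where
      field
        W       : Pair
        V≼W     : V ≼ W
        i₀      : Fin m
        inverse : Carrier
        inv     : f i₀ * inverse ≈ 1#
        inv∈J   : inverse ∈ J W
        f/f∈R   : ∀ i → f i * inverse ∈ R W

    module _ (invert : ∀ x → ¬ (x ≈ 0#) → ∃[ y ] x * y ≈ 1#) where

      private
        -- A running maximum over the tail f of the family g: i₀ is the index of the largest value
        -- so far and z its inverse. A new nonzero value is compared with it by adjoining their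
        -- quotient or its inverse. If the new value wins, its inverse is an element of R times z,
        -- so it stays in J.
        dominant-from : ∀ {m k} (g : Fin m → Carrier) (f : Fin k → Carrier) (emb : Fin k → Fin m) →
          (∀ i → f i ≡ g (emb i)) → ∀ V u {y} → g u * y ≈ 1# → y ∈ J V →
          ∃[ W ] V ≼ W × (∃[ i₀ ] ∃[ z ] g i₀ * z ≈ 1# × z ∈ J W × g u * z ∈ R W × (∀ i → f i * z ∈ R W))
        dominant-from {k = zero} g f emb f≡g V u {y} eq y∈ = V , ≼-refl {V} , u , y , eq , y∈ , resp (sym eq) 1∈ , λ ()
          where open IsSubring (R-subring V)
        dominant-from {k = suc k} g f emb f≡g V u eq y∈
          with dominant-from g (f ∘ suc) (emb ∘ suc) (f≡g ∘ suc) V u eq y∈ | em {f zero ≈ 0#}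
        ... | W , V≼W , i₀ , z , gz≈1 , z∈ , gu∈ , fs∈ | yes f0≈0 = W , V≼W , i₀ , z , gz≈1 , z∈ , gu∈ ,
          λ { zero → resp (sym (trans (*-congʳ f0≈0) (zeroˡ z))) 0∈ ; (suc i) → fs∈ i }
          where open IsSubring (R-subring W)
        ... | W , V≼W , i₀ , z , gz≈1 , z∈ , gu∈ , fs∈ | no f0≉0 = compare (adjoin-or-inverse W quotient*inverse)
          where
          x⁻¹ = proj₁ (invert (f zero) f0≉0)
          xx⁻¹≈1 : f zero * x⁻¹ ≈ 1#
          xx⁻¹≈1 = proj₂ (invert (f zero) f0≉0)
          quotient*inverse : f zero * z * (g i₀ * x⁻¹) ≈ 1#
          quotient*inverse = trans (solve 4 (λ x z g y → x :* z :* (g :* y) := x :* y :* (g :* z)) refl (f zero) z (g i₀) x⁻¹)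
            (trans (*-cong xx⁻¹≈1 gz≈1) (*-identityˡ 1#))
          change : ∀ a → a * z * (g i₀ * x⁻¹) ≈ a * x⁻¹
          change a = trans (solve 4 (λ a z g y → a :* z :* (g :* y) := a :* y :* (g :* z)) refl a z (g i₀) x⁻¹)
            (trans (*-congˡ gz≈1) (*-identityʳ _))
          compare : (∃[ X ] W ≼ X × f zero * z ∈ R X) ⊎ (∃[ X ] W ≼ X × g i₀ * x⁻¹ ∈ R X) →
            ∃[ X ] V ≼ X × (∃[ i₁ ] ∃[ y ] g i₁ * y ≈ 1# × y ∈ J X × g u * y ∈ R X × (∀ i → f i * y ∈ R X))
          compare (inj₁ (X , W≼X , f0∈)) = X , ≼-trans {V} {W} {X} V≼W W≼X , i₀ , z , gz≈1 , J⊆ W≼X z∈ , R⊆ W≼X gu∈ ,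
            λ { zero → f0∈ ; (suc i) → R⊆ W≼X (fs∈ i) }
          compare (inj₂ (X , W≼X , g∈)) = X , ≼-trans {V} {W} {X} V≼W W≼X , emb zero , x⁻¹ ,
            ≡.subst (λ a → a * x⁻¹ ≈ 1#) (f≡g zero) xx⁻¹≈1 ,
            IsNonunitalSubring.resp (J-subring X) (trans (solve 3 (λ g y z → g :* y :* z := g :* z :* y) refl (g i₀) x⁻¹ z)
              (trans (*-congʳ gz≈1) (*-identityˡ _))) (RJ⊆J X g∈ (J⊆ W≼X z∈)) ,
            resp (change (g u)) (*∈ (R⊆ W≼X gu∈) g∈) ,
            λ { zero → resp (sym xx⁻¹≈1) 1∈ ; (suc i) → resp (change (f (suc i))) (*∈ (R⊆ W≼X (fs∈ i)) g∈) }
            where open IsSubring (R-subring X)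

      dominant : ∀ {m} (f : Fin m → Carrier) V u {y} → f u * y ≈ 1# → y ∈ J V → Dominant f V
      dominant f V u eq y∈ =
        let W , V≼W , i₀ , z , fz≈1 , z∈ , _ , f∈ = dominant-from f f id (λ _ → ≡.refl) V u eq y∈ in
        record { W = W ; V≼W = V≼W ; i₀ = i₀ ; inverse = z ; inv = fz≈1 ; inv∈J = z∈ ; f/f∈R = f∈ }

  -- The place t = ∞ on K[1/t]. If 1 = y/t with y of degree n in 1/t, then t^(n+1) = t^n y is a
  -- polynomial in t of degree at most n, so t would be integral over K.
  infinite-place : ∀ {K} → IsSubring K → ∀ {t t⁻¹} → t * t⁻¹ ≈ 1# → (∀ n → t ^ suc n ∉ Poly K t n) →
                   ∃[ V ] K ⊆ R V × t⁻¹ ∈ J V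
  infinite-place {K} K-subring {t} {t⁻¹} tt⁻¹≈1 transcendental =
    V , (λ a∈ → 0 , a∈) , 1# , (0 , 1∈) , sym (*-identityʳ t⁻¹)
    where
    open IsSubring K-subring
    K[t⁻¹] : Pred Carrier 0ℓ
    K[t⁻¹] z = ∃[ n ] z ∈ Poly K t⁻¹ n
    module K[t⁻¹] = IsNonunitalSubring (poly-subring isNonunitalSubring t⁻¹)
    t⁻¹∈ : t⁻¹ ∈ K[t⁻¹]
    t⁻¹∈ = 1 , (0# , 1# , 0∈ , 1∈ , solve 1 (λ x → x := con ℤ.0ℤ :+ x :* con ℤ.1ℤ) refl t⁻¹)
    V : Pair
    V = record
      { R = K[t⁻¹]
      ; J = λ z → ∃[ y ] y ∈ K[t⁻¹] × z ≈ t⁻¹ * y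
      ; R-subring = record { isNonunitalSubring = poly-subring isNonunitalSubring t⁻¹ ; 1∈ = 0 , 1∈ }
      ; J-subring = record
        { resp = λ x≈y (z , z∈ , eq) → z , z∈ , trans (sym x≈y) eq
        ; 0∈   = 0# , K[t⁻¹].0∈ , sym (zeroʳ t⁻¹)
        ; +∈   = λ (y , y∈ , eq) (z , z∈ , eq′) → y + z , K[t⁻¹].+∈ y∈ z∈ , trans (+-cong eq eq′) (sym (distribˡ t⁻¹ y z))
        ; -∈   = λ (y , y∈ , eq) → - y , K[t⁻¹].-∈ y∈ , trans (-‿cong eq) (-‿distribʳ-* t⁻¹ y)
        ; *∈   = λ (y , y∈ , eq) (z , z∈ , eq′) → y * (t⁻¹ * z) , K[t⁻¹].*∈ y∈ (K[t⁻¹].*∈ t⁻¹∈ z∈) ,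
            trans (*-cong eq eq′) (*-assoc t⁻¹ y (t⁻¹ * z))
        }
      ; J⊆R = λ (y , y∈ , eq) → K[t⁻¹].resp (sym eq) (K[t⁻¹].*∈ t⁻¹∈ y∈)
      ; RJ⊆J = λ {a} a∈ (y , y∈ , eq) → a * y , K[t⁻¹].*∈ a∈ y∈ ,
          trans (*-congˡ eq) (solve 3 (λ a t y → a :* (t :* y) := t :* (a :* y)) refl a t⁻¹ y)
      ; proper = λ (y , (n , y∈) , 1≈) → transcendental n (poly-resp isNonunitalSubring n (begin
          t ^ n * y                  ≈⟨ solve 2 (λ p y → p :* y := p :* (con ℤ.1ℤ :* y)) refl (t ^ n) y ⟩
          t ^ n * (1# * y)           ≈⟨ *-congˡ (*-congʳ tt⁻¹≈1) ⟨
          t ^ n * (t * t⁻¹ * y)      ≈⟨ solve 4 (λ p t s y → p :* (t :* s :* y) := t :* p :* (s :* y)) refl (t ^ n) t t⁻¹ y ⟩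
          t ^ suc n * (t⁻¹ * y)      ≈⟨ *-congˡ 1≈ ⟨
          t ^ suc n * 1#             ≈⟨ *-identityʳ _ ⟩
          t ^ suc n                  ∎) (poly-reverse isNonunitalSubring tt⁻¹≈1 (ℕ.≤-refl {n}) y∈))
      }

-- Finite quantum dilogarithms over an abstract field

-- `multiple n` is n times a generator and `toℕ` is the discrete logarithm. This brings χ into the
-- form ζ^(xy) of the Fourier matrix in Chebotarev's theorem.
record IsEnumerated {p : ℕ} (_∙_ : Op₂ (Fin p)) (ε : Fin p) (multiple : ℕ → Fin p) : Set where
  field
    multiple-0   : multiple 0 ≡ ε
    multiple-suc : ∀ n → multiple (suc n) ≡ multiple 1 ∙ multiple n
    multiple-p   : multiple p ≡ ε
    multiple-toℕ : ∀ i → multiple (toℕ i) ≡ i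

module Dilogarithm (F : CommutativeRing 0ℓ 0ℓ) (em : ExcludedMiddle 0ℓ) {p : ℕ} (p-prime : Prime p)
  {_∙_ : Op₂ (Fin p)} {ε : Fin p} {_⁻¹ : Op₁ (Fin p)} (isAbelianGroup : IsAbelianGroup _≡_ _∙_ ε _⁻¹) where

  open CommutativeRingTools F
  open SetoidReasoning setoid
  open FourierAnalysis F isAbelianGroup
  open PlaceTheory F
  open CommutativeExp commutativeSemiring using (^-distrib-*)

  Invertible : Set
  Invertible = ∀ x → ¬ x ≈ 0# → ∃[ y ] x * y ≈ 1#

  module _ (invert : Invertible) {multiple : ℕ → Fin p} (enumerated : IsEnumerated _∙_ ε multiple)
    {w w⁻ : Fin p → Carrier} where

    open IsEnumerated enumerated

    private
      1<p : 1 ℕ.< p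
      1<p = ℕ.nonTrivial⇒n>1 p {{prime⇒nonTrivial p-prime}}

      instance
        p-nonZero : NonZero p
        p-nonZero = prime⇒nonZero p-prime

      cancel-nonzero : ∀ {a x} → ¬ a ≈ 0# → a * x ≈ 0# → x ≈ 0#
      cancel-nonzero {a} a≉0 ax≈0 = *-invertible-cancelˡ (proj₂ (invert a a≉0)) (trans ax≈0 (sym (zeroʳ a)))

    χ′ : Fin p → Fin p → Carrier
    χ′ x y = w (x ∙ y) * w⁻ x * w⁻ y

    -- For y ≠ `ε`, nondegeneracy and excluded middle provide x₀ with χ(x₀,y) ≠ 1. Translation by x₀
    -- shows that χ(x₀,y) - 1, a unit of the field, kills the character sum.
    gaussian : (∀ x → w x * w⁻ x ≈ 1#) → (∀ x → w (x ⁻¹) ≈ w x) → (∀ x y z → χ′ (x ∙ y) z ≈ χ′ x z * χ′ y z) →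
               (∀ y → (∀ x → χ′ x y ≈ 1#) → y ≡ ε) → IsGaussian w w⁻
    gaussian inverse even χ-∙ˡ nondegenerate = record
      { inverse = inverse ; even = even ; χ-∙ˡ = χ-∙ˡ ; orthogonal = orthogonal }
      where
      orthogonal : ∀ {y} → y ≢ ε → ∑ (λ x → χ′ x y) ≈ 0#
      orthogonal {y} y≢ε =
        let x₀ , χ≉1 = Fin.¬∀⟶∃¬ p (λ x → χ′ x y ≈ 1#) (λ x → em) (λ χ≈1 → y≢ε (nondegenerate y χ≈1)) in
        cancel-nonzero (λ χ-1≈0 → χ≉1 (x-y≈0⇒x≈y χ-1≈0)) (begin
          (χ′ x₀ y - 1#) * ∑ (λ x → χ′ x y)
            ≈⟨ solve 2 (λ c s → (c :- con ℤ.1ℤ) :* s := c :* s :- s) refl (χ′ x₀ y) (∑ (λ x → χ′ x y)) ⟩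
          χ′ x₀ y * ∑ (λ x → χ′ x y) - ∑ (λ x → χ′ x y)
            ≈⟨ +-congʳ (*-distribˡ-sum (χ′ x₀ y) (λ x → χ′ x y)) ⟩
          ∑ (λ x → χ′ x₀ y * χ′ x y) - ∑ (λ x → χ′ x y)
            ≈⟨ +-congʳ (sum-cong-≋ (λ x → χ-∙ˡ x₀ x y)) ⟨
          ∑ (λ x → χ′ (x₀ ∙ x) y) - ∑ (λ x → χ′ x y)
            ≈⟨ x≈y⇒x-y≈0 (∑-translate x₀ (λ x → χ′ x y)) ⟩
          0# ∎)

    module _ (w-gaussian : IsGaussian w w⁻) where
      open IsGaussian w-gaussian

      ζ : Carrier
      ζ = χ (multiple 1) (multiple 1)

      χ-multipleˡ : ∀ n y → χ (multiple n) y ≈ χ (multiple 1) y ^ n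
      χ-multipleˡ zero    y = trans (reflexive (≡.cong (λ x → χ x y) multiple-0)) (χ-εˡ y)
      χ-multipleˡ (suc n) y = trans (reflexive (≡.cong (λ x → χ x y) (multiple-suc n)))
        (trans (χ-∙ˡ (multiple 1) (multiple n) y) (*-congˡ (χ-multipleˡ n y)))

      χ-multiple : ∀ m n → χ (multiple m) (multiple n) ≈ ζ ^ (m ℕ.* n)
      χ-multiple m n = begin
        χ (multiple m) (multiple n)        ≈⟨ χ-multipleˡ m (multiple n) ⟩
        χ (multiple 1) (multiple n) ^ m    ≈⟨ ^-congˡ m (trans (χ-comm (multiple 1) (multiple n)) (χ-multipleˡ n (multiple 1))) ⟩
        (ζ ^ n) ^ m                        ≈⟨ ^-assocʳ ζ n m ⟩
        ζ ^ (n ℕ.* m)                      ≡⟨ ≡.cong (ζ ^_) (ℕ.*-comm n m) ⟩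
        ζ ^ (m ℕ.* n)                      ∎

      χ≈ζ^ : ∀ x y → χ x y ≈ ζ ^ (toℕ x ℕ.* toℕ y)
      χ≈ζ^ x y = trans (reflexive (≡.sym (≡.cong₂ χ (multiple-toℕ x) (multiple-toℕ y)))) (χ-multiple (toℕ x) (toℕ y))

      χ^p≈1 : ∀ x y → χ x y ^ p ≈ 1#
      χ^p≈1 x y = begin
        χ x y ^ p                            ≈⟨ ^-congˡ p (χ≈ζ^ x y) ⟩
        (ζ ^ (toℕ x ℕ.* toℕ y)) ^ p          ≈⟨ ^-assocʳ ζ (toℕ x ℕ.* toℕ y) p ⟩
        ζ ^ (toℕ x ℕ.* toℕ y ℕ.* p)          ≡⟨ ≡.cong (ζ ^_) (ℕ.*-comm (toℕ x ℕ.* toℕ y) p) ⟩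
        ζ ^ (p ℕ.* (toℕ x ℕ.* toℕ y))        ≈⟨ χ-multiple p (toℕ x ℕ.* toℕ y) ⟨
        χ (multiple p) (multiple (toℕ x ℕ.* toℕ y))  ≡⟨ ≡.cong (λ z → χ z (multiple (toℕ x ℕ.* toℕ y))) multiple-p ⟩
        χ ε (multiple (toℕ x ℕ.* toℕ y))     ≈⟨ χ-εˡ _ ⟩
        1#                                   ∎

      multiple-fromℕ< : ∀ {j} (j<p : j ℕ.< p) → multiple j ≡ fromℕ< j<p
      multiple-fromℕ< {j} j<p = ≡.trans (≡.cong multiple (≡.sym (Fin.toℕ-fromℕ< j<p))) (multiple-toℕ (fromℕ< j<p))

      multiple≢ε : ∀ {j} → 0 ℕ.< j → j ℕ.< p → multiple j ≢ ε
      multiple≢ε {j} 0<j j<p eq = ℕ.<⇒≢ 0<j (≡.trans (≡.sym (Fin.toℕ-fromℕ< (ℕ.<-trans 0<j j<p)))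
        (≡.trans (≡.cong toℕ (≡.trans (≡.sym (multiple-fromℕ< (ℕ.<-trans 0<j j<p)))
          (≡.trans multiple-0 (≡.trans (≡.sym eq) (multiple-fromℕ< j<p))))) (Fin.toℕ-fromℕ< j<p)))

      ζ-primitive : PrimitiveRoot.IsPrimitiveRoot F p ζ
      ζ-primitive = record
        { ζ^p≈1     = χ^p≈1 (multiple 1) (multiple 1)
        ; geometric = λ {j} 0<j j<p → trans
            (sum-cong-≋ {p} (λ i → trans (sym (χ-multiple (toℕ i) j)) (reflexive (≡.cong (λ x → χ x (multiple j)) (multiple-toℕ i)))))
            (orthogonal (multiple≢ε 0<j j<p))
        }

      -- From 1 = w(x ∙ x⁻¹) = w(x) w(x⁻¹) χ(x,x⁻¹) and evenness. Hence the values of w are 2p-th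
      -- roots of unity, which every pair can absorb.
      w²≈χ : ∀ x → w x * w x ≈ χ x x
      w²≈χ x = *-invertible-cancelˡ (trans (*-comm _ _) (χ-⁻¹ʳ x x)) (begin
        χ x (x ⁻¹) * (w x * w x)          ≈⟨ *-congˡ (*-congˡ (even x)) ⟨
        χ x (x ⁻¹) * (w x * w (x ⁻¹))     ≈⟨ *-comm _ _ ⟩
        w x * w (x ⁻¹) * χ x (x ⁻¹)       ≈⟨ w-∙ x (x ⁻¹) ⟨
        w (x ∙ (x ⁻¹))                    ≡⟨ ≡.cong w (IsAbelianGroup.inverseʳ isAbelianGroup x) ⟩
        w ε                               ≈⟨ wε≈1 ⟩
        1#                                ≈⟨ trans (*-comm _ _) (χ-⁻¹ʳ x x) ⟨
        χ x (x ⁻¹) * χ x x                ∎)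

      w^2p≈1 : ∀ x → w x ^ (2 ℕ.* p) ≈ 1#
      w^2p≈1 x = begin
        w x ^ (2 ℕ.* p)     ≈⟨ ^-assocʳ (w x) 2 p ⟨
        (w x ^ 2) ^ p       ≈⟨ ^-congˡ p (trans (*-congˡ (*-identityʳ (w x))) (w²≈χ x)) ⟩
        χ x x ^ p           ≈⟨ χ^p≈1 x x ⟩
        1#                  ∎

      w⁻^2p≈1 : ∀ x → w⁻ x ^ (2 ℕ.* p) ≈ 1#
      w⁻^2p≈1 x = begin
        w⁻ x ^ (2 ℕ.* p)                        ≈⟨ *-identityˡ _ ⟨
        1# * w⁻ x ^ (2 ℕ.* p)                   ≈⟨ *-congʳ (w^2p≈1 x) ⟨
        w x ^ (2 ℕ.* p) * w⁻ x ^ (2 ℕ.* p)      ≈⟨ ^-distrib-* (w x) (w⁻ x) (2 ℕ.* p) ⟨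
        (w x * w⁻ x) ^ (2 ℕ.* p)                ≈⟨ ^-congˡ (2 ℕ.* p) (inverse x) ⟩
        1# ^ (2 ℕ.* p)                          ≈⟨ 1^ (2 ℕ.* p) ⟩
        1#                                      ∎

      2p-root-adjoinable : ∀ {x} → x ^ (2 ℕ.* p) ≈ 1# → Adjoinable em x
      2p-root-adjoinable {x} eq = root-of-unity-adjoinable em (ℕ.pred (2 ℕ.* p))
        (trans (reflexive (≡.cong (x ^_) (ℕ.suc-pred (2 ℕ.* p) {{ℕ.m*n≢0 2 p}}))) eq)

      module _ {s s⁻¹} (s²≈p : s * s ≈ ι p) (ss⁻¹≈1 : s * s⁻¹ ≈ 1#) {E : Fin p → Carrier} {κ : Carrier}
        (functional : ∀ x y → χ x y * E x * E y ≈
          κ + ∑ (λ z → E (y ∙ (z ⁻¹)) * E z * w z * E (x ∙ (z ⁻¹))) * s⁻¹) where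

        -- A ring over which E, divided by its largest value E x₀, stays finite, while 1 / E x₀ is infinitesimal.
        no-pole : (V : Pair) → (∀ n → ∃[ q ] q ∈ Pair.R V × ι (suc n) * q ≈ 1#) →
                  (∀ x → w x ∈ Pair.R V) → (∀ x → w⁻ x ∈ Pair.R V) → s ∈ Pair.R V →
                  ∀ {x₀ λ⁻¹} → E x₀ * λ⁻¹ ≈ 1# → λ⁻¹ ∈ Pair.J V → (∀ x → E x * λ⁻¹ ∈ Pair.R V) → ⊥
        no-pole V ι-inverse w∈ w⁻∈ s∈ {x₀} {λ⁻¹} Ex₀λ⁻¹≈1 λ⁻¹∈J e∈ = proper (improper J′-ideal ν∈)
          where
          open Pair V
          open IsSubring R-subring renaming (subring to S)
          module S = CommutativeRingTools S
          module FS = FourierAnalysis S isAbelianGroup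
          J′ : Pred S.Carrier 0ℓ
          J′ x = proj₁ x ∈ J
          J′-ideal : IdealTheory.IsIdeal S J′
          J′-ideal = record
            { resp = IsNonunitalSubring.resp J-subring ; 0∈ = IsNonunitalSubring.0∈ J-subring
            ; +∈ = IsNonunitalSubring.+∈ J-subring ; *∈ = λ a → RJ⊆J (proj₂ a) }
            where open Spans F
          sum-S : ∀ {m} (f : Fin m → S.Carrier) → proj₁ (S.sum f) ≡ sum (proj₁ ∘ f)
          sum-S {zero}  f = ≡.refl
          sum-S {suc m} f = ≡.cong (proj₁ (f zero) +_) (sum-S (f ∘ suc))
          ^-S : ∀ x m → proj₁ (x S.^ m) ≡ proj₁ x ^ m
          ^-S x zero    = ≡.refl
          ^-S x (suc m) = ≡.cong (proj₁ x *_) (^-S x m)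
          ι-S : ∀ m → proj₁ (S.ι m) ≡ ι m
          ι-S zero    = ≡.refl
          ι-S (suc m) = ≡.cong (1# +_) (ι-S m)
          wˢ w⁻ˢ e : Fin p → S.Carrier
          wˢ x = w x , w∈ x
          w⁻ˢ x = w⁻ x , w⁻∈ x
          e x = E x * λ⁻¹ , e∈ x
          gaussianˢ : FS.IsGaussian wˢ w⁻ˢ
          gaussianˢ = record
            { inverse = inverse ; even = even ; χ-∙ˡ = χ-∙ˡ
            ; orthogonal = λ {y} y≢ε → trans (reflexive (sum-S (λ x → wˢ (x ∙ y) S.* w⁻ˢ x S.* w⁻ˢ y))) (orthogonal y≢ε) }
          ζˢ : S.Carrier
          ζˢ = FS.IsGaussian.χ gaussianˢ (multiple 1) (multiple 1)
          ζˢ-primitive : PrimitiveRoot.IsPrimitiveRoot S p ζˢ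
          ζˢ-primitive = record
            { ζ^p≈1     = trans (reflexive (^-S ζˢ p)) (PrimitiveRoot.IsPrimitiveRoot.ζ^p≈1 ζ-primitive)
            ; geometric = λ {j} 0<j j<p → trans (reflexive (sum-S {p} (λ i → ζˢ S.^ (toℕ i ℕ.* j))))
                (trans (sum-cong-≋ {p} (λ i → reflexive (^-S ζˢ (toℕ i ℕ.* j))))
                  (PrimitiveRoot.IsPrimitiveRoot.geometric ζ-primitive 0<j j<p)) }
          χ≈ζ^ˢ : ∀ x y → FS.IsGaussian.χ gaussianˢ x y S.≈ ζˢ S.^ (toℕ x ℕ.* toℕ y)
          χ≈ζ^ˢ x y = trans (χ≈ζ^ x y) (reflexive (≡.sym (^-S ζˢ (toℕ x ℕ.* toℕ y))))
          ι-inverseˢ : ∀ m → ∃[ y ] S.ι (suc m) S.* y S.≈ S.1#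
          ι-inverseˢ m = let q , q∈ , eq = ι-inverse m in
            (q , q∈) , trans (reflexive (≡.cong (_* q) (ι-S (suc m)))) eq
          ν : S.Carrier
          ν = s * λ⁻¹ , *∈ s∈ (J⊆R λ⁻¹∈J)
          ν∈ : ν ∈ J′
          ν∈ = RJ⊆J s∈ λ⁻¹∈J
          ν-regular : ν ∈ Frequencies.Regular S
          ν-regular x eq = *-invertible-cancelˡ ν-inverse (trans eq (sym (zeroʳ _)))
            where
            ν-inverse : s * λ⁻¹ * (s⁻¹ * E x₀) ≈ 1#
            ν-inverse = trans (solve 4 (λ s l t x → s :* l :* (t :* x) := (s :* t) :* (x :* l)) refl s λ⁻¹ s⁻¹ (E x₀))
              (trans (*-cong ss⁻¹≈1 Ex₀λ⁻¹≈1) (*-identityˡ 1#))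
          open FS.IsGaussian gaussianˢ using () renaming (χ to χˢ)
          open FS.Transforms gaussianˢ e using (convolution)
          -- Multiplied by s λ⁻³, the functional equation says that this difference is s λ⁻³ κ for
          -- all x and y. As κ is not known to lie in R, the constant is realised inside R as the
          -- defect at (`ε`, `ε`).
          defect : Fin p → Fin p → S.Carrier
          defect x y = ν S.* (χˢ x y S.* e x S.* e y) S.- convolution x y
          defect≈ : ∀ x y → proj₁ (defect x y) ≈ s * (λ⁻¹ * (λ⁻¹ * λ⁻¹)) * κ
          defect≈ x y = begin
            s * λ⁻¹ * (χ x y * (E x * λ⁻¹) * (E y * λ⁻¹)) - proj₁ (convolution x y)
              ≈⟨ +-cong (solve 5 (λ s l c a b → s :* l :* (c :* (a :* l) :* (b :* l)) := s :* (l :* (l :* l)) :* (c :* a :* b))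
                   refl s λ⁻¹ (χ x y) (E x) (E y))
                   (-‿cong (trans (reflexive (sum-S (λ z → e (y ∙ (z ⁻¹)) S.* e z S.* wˢ z S.* e (x ∙ (z ⁻¹))))) scale)) ⟩
            s * l³ * (χ x y * E x * E y) - l³ * T
              ≈⟨ +-cong (*-congˡ (functional x y)) (-‿cong (sym (trans (*-congʳ ss⁻¹≈1) (*-identityˡ _)))) ⟩
            s * l³ * (κ + T * s⁻¹) - s * s⁻¹ * (l³ * T)
              ≈⟨ solve 5 (λ s t l c T → s :* l :* (c :+ T :* t) :- s :* t :* (l :* T) := s :* l :* c) refl s s⁻¹ l³ κ T ⟩
            s * l³ * κ ∎
            where
            l³ = λ⁻¹ * (λ⁻¹ * λ⁻¹)
            T = ∑ (λ z → E (y ∙ (z ⁻¹)) * E z * w z * E (x ∙ (z ⁻¹)))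
            scale : ∑ (λ z → E (y ∙ (z ⁻¹)) * λ⁻¹ * (E z * λ⁻¹) * w z * (E (x ∙ (z ⁻¹)) * λ⁻¹)) ≈ l³ * T
            scale = trans (sum-cong-≋ (λ z → solve 5 (λ l a b c d →
                a :* l :* (b :* l) :* c :* (d :* l) := l :* (l :* l) :* (a :* b :* c :* d))
                refl λ⁻¹ (E (y ∙ (z ⁻¹))) (E z) (w z) (E (x ∙ (z ⁻¹)))))
              (sym (*-distribˡ-sum l³ (λ z → E (y ∙ (z ⁻¹)) * E z * w z * E (x ∙ (z ⁻¹)))))
          equation : ∀ x y → ν S.* (χˢ x y S.* e x S.* e y) S.≈ defect ε ε S.+ convolution x y
          equation x y = trans
            (solve 2 (λ a b → a := (a :- b) :+ b) refl (proj₁ (ν S.* (χˢ x y S.* e x S.* e y))) (proj₁ (convolution x y)))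
            (+-congʳ (trans (defect≈ x y) (sym (defect≈ ε ε))))
          improper : IdealTheory.IsIdeal S J′ → ν ∈ J′ → S.1# ∈ J′
          improper = AtInfinity.improper S p-prime isAbelianGroup gaussianˢ {ζˢ} ζˢ-primitive χ≈ζ^ˢ ι-inverseˢ e
            {ν} {defect ε ε} equation ν-regular {x₀} Ex₀λ⁻¹≈1 {multiple 1} (multiple≢ε ℕ.z<s 1<p)

        no-transcendental : ∀ {K} → IsSubring K → (∀ n → ∃[ q ] q ∈ K × ι (suc n) * q ≈ 1#) →
          ∀ u {t⁻¹} → E u * t⁻¹ ≈ 1# → ¬ (∀ n → E u ^ suc n ∉ Poly K (E u) n)
        no-transcendental K-subring ι-inverse u tt⁻¹≈1 transcendental =
          let V₀ , K⊆ , t⁻¹∈  = infinite-place K-subring tt⁻¹≈1 transcendental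
              V₁ , V₀≼ , w∈  = adjoin-family em w (2p-root-adjoinable ∘ w^2p≈1) V₀
              V₂ , V₁≼ , w⁻∈ = adjoin-family em w⁻ (2p-root-adjoinable ∘ w⁻^2p≈1) V₁
              V₃ , V₂≼ , s∈  = √ι-adjoinable em p s²≈p ss⁻¹≈1 V₂
              open Dominant (dominant em invert E V₃ u tt⁻¹≈1 (J⊆ V₂≼ (J⊆ V₁≼ (J⊆ V₀≼ t⁻¹∈))))
                renaming (inverse to λ⁻¹)
              R₂⊆ : Pair.R V₂ ⊆ Pair.R W
              R₂⊆ = R⊆ V≼W ∘ R⊆ V₂≼
          in no-pole W (λ n → let q , q∈ , eq = ι-inverse n in q , R₂⊆ (R⊆ V₁≼ (R⊆ V₀≼ (K⊆ q∈))) , eq)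
               (λ x → R₂⊆ (R⊆ V₁≼ (w∈ x))) (λ x → R₂⊆ (w⁻∈ x)) (R⊆ V≼W s∈) {i₀} inv inv∈J f/f∈R

-- Rational numbers in a ring and polynomial equations over them

private
  suc/1 : ∀ n → ℤ.+ suc n ℚ./ 1 ≡ 1ℚ ℚ.+ ℤ.+ n ℚ./ 1
  suc/1 n = ℚ.toℚᵘ-injective (begin
    ℚ.toℚᵘ (ℤ.+ suc n ℚ./ 1)                  ≈⟨ ℚ.toℚᵘ-fromℚᵘ (ℚᵘ.mkℚᵘ (ℤ.+ suc n) 0) ⟩
    ℚᵘ.mkℚᵘ (ℤ.+ suc n) 0                     ≈⟨ ℚᵘ.*≡* (≡.cong (λ k → (ℤ.1ℤ ℤ.+ k) ℤ.* ℤ.1ℤ) (≡.sym (ℤ.*-identityʳ (ℤ.+ n)))) ⟩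
    ℚᵘ.1ℚᵘ ℚᵘ.+ ℚᵘ.mkℚᵘ (ℤ.+ n) 0             ≈⟨ ℚᵘ.+-congʳ ℚᵘ.1ℚᵘ (ℚ.toℚᵘ-fromℚᵘ (ℚᵘ.mkℚᵘ (ℤ.+ n) 0)) ⟨
    ℚᵘ.1ℚᵘ ℚᵘ.+ ℚ.toℚᵘ (ℤ.+ n ℚ./ 1)          ≈⟨ ℚ.toℚᵘ-homo-+ 1ℚ (ℤ.+ n ℚ./ 1) ⟨
    ℚ.toℚᵘ (1ℚ ℚ.+ ℤ.+ n ℚ./ 1)               ∎)
    where open SetoidReasoning ℚᵘ.≃-setoid

module RationalImage (F : CommutativeRing 0ℓ 0ℓ) (embed : ℚ → CommutativeRing.Carrier F) where
  open CommutativeRingTools F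
  open PlaceTheory F
  open SetoidReasoning setoid

  record IsEmbedding : Set where
    field
      1-homo : embed 1ℚ ≈ 1#
      +-homo : ∀ p q → embed (p ℚ.+ q) ≈ embed p + embed q
      *-homo : ∀ p q → embed (p ℚ.* q) ≈ embed p * embed q

  Image : Pred Carrier 0ℓ
  Image z = ∃[ q ] z ≈ embed q

  -- The counterpart of `IsAlgebraic` over an abstract ring; `Root⇒IsAlgebraic` translates it back.
  record Root (z : Carrier) : Set where
    constructor root
    field
      {degree}    : ℕ
      coefficient : Fin (suc degree) → ℚ
      nonzero     : ∃[ i ] coefficient i ≢ 0ℚ
      vanishes    : sum (λ i → embed (coefficient i) * z ^ toℕ i) ≈ 0#

  module _ (embedding : IsEmbedding) where
    open IsEmbedding embedding

    0-homo : embed 0ℚ ≈ 0#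
    0-homo = begin
      embed 0ℚ                              ≈⟨ solve 1 (λ a → a := (a :+ a) :- a) refl (embed 0ℚ) ⟩
      (embed 0ℚ + embed 0ℚ) - embed 0ℚ      ≈⟨ +-congʳ (+-homo 0ℚ 0ℚ) ⟨
      embed 0ℚ - embed 0ℚ                   ≈⟨ -‿inverseʳ (embed 0ℚ) ⟩
      0#                                    ∎

    neg-homo : ∀ q → embed (ℚ.- 1ℚ ℚ.* q) ≈ - embed q
    neg-homo q = begin
      embed (ℚ.- 1ℚ ℚ.* q)        ≈⟨ *-homo (ℚ.- 1ℚ) q ⟩
      embed (ℚ.- 1ℚ) * embed q    ≈⟨ *-congʳ (x-y≈0⇒x≈y (trans (+-congˡ (trans (solve 0 (:- (:- con ℤ.1ℤ) := con ℤ.1ℤ) refl) (sym 1-homo)))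
                                      (trans (sym (+-homo (ℚ.- 1ℚ) 1ℚ)) 0-homo))) ⟩
      - 1# * embed q              ≈⟨ -1*x≈-x _ ⟩
      - embed q                   ∎

    Image-subring : IsSubring Image
    Image-subring = record
      { isNonunitalSubring = record
        { resp = λ y≈z (q , y≈) → q , trans (sym y≈z) y≈
        ; 0∈   = 0ℚ , sym 0-homo
        ; +∈   = λ (p , y≈) (q , z≈) → p ℚ.+ q , trans (+-cong y≈ z≈) (sym (+-homo p q))
        ; -∈   = λ (q , y≈) → ℚ.- 1ℚ ℚ.* q , trans (-‿cong y≈) (sym (neg-homo q))
        ; *∈   = λ (p , y≈) (q , z≈) → p ℚ.* q , trans (*-cong y≈ z≈) (sym (*-homo p q)) }
      ; 1∈ = 1ℚ , sym 1-homo }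

    ι≈embed : ∀ n → ι n ≈ embed (ℤ.+ n ℚ./ 1)
    ι≈embed zero    = sym 0-homo
    ι≈embed (suc n) = begin
      1# + ι n                            ≈⟨ +-cong (sym 1-homo) (ι≈embed n) ⟩
      embed 1ℚ + embed (ℤ.+ n ℚ./ 1)      ≈⟨ +-homo 1ℚ (ℤ.+ n ℚ./ 1) ⟨
      embed (1ℚ ℚ.+ ℤ.+ n ℚ./ 1)          ≡⟨ ≡.cong embed (suc/1 n) ⟨
      embed (ℤ.+ suc n ℚ./ 1)             ∎

    ι-inverse : ∀ n → ∃[ q ] q ∈ Image × ι (suc n) * q ≈ 1#
    ι-inverse n = embed (ℚ.1/ q) , (ℚ.1/ q , refl) , (begin
      ι (suc n) * embed (ℚ.1/ q)   ≈⟨ *-congʳ (ι≈embed (suc n)) ⟩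
      embed q * embed (ℚ.1/ q)     ≈⟨ *-homo q (ℚ.1/ q) ⟨
      embed (q ℚ.* ℚ.1/ q)         ≡⟨ ≡.cong embed (ℚ.*-inverseʳ q) ⟩
      embed 1ℚ                     ≈⟨ 1-homo ⟩
      1#                           ∎)
      where
      q = ℤ.+ suc n ℚ./ 1
      instance
        q-nonZero : ℚ.NonZero q
        q-nonZero = ℚ.pos⇒nonZero q {{ℚ.normalize-pos (suc n) 1}}

    -- Horner form of exact degree n with leading coefficient 1, which certifies that the
    -- coefficients of the resulting equation are not all zero.
    Monic : Carrier → ℕ → Pred Carrier 0ℓ
    Monic t zero    z = z ≈ 1#
    Monic t (suc n) z = ∃[ q ] ∃[ z′ ] z′ ∈ Monic t n × z ≈ embed q + t * z′

    monic-sum : ∀ {t} n {z} → z ∈ Monic t n →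
      Σ (Fin (suc n) → ℚ) λ a → a (fromℕ n) ≡ 1ℚ × z ≈ sum (λ i → embed (a i) * t ^ toℕ i)
    monic-sum {t} zero z≈1 = (λ _ → 1ℚ) , ≡.refl ,
      trans z≈1 (trans (sym 1-homo) (sym (trans (+-identityʳ _) (*-identityʳ _))))
    monic-sum {t} (suc n) {z} (q , z′ , z′∈ , z≈) =
      let a , top , z′≈ = monic-sum n z′∈
          c : Fin (suc (suc n)) → ℚ
          c = λ { zero → q ; (suc i) → a i }
      in c , top , (begin
        z                                                      ≈⟨ z≈ ⟩
        embed q + t * z′                                       ≈⟨ +-cong (sym (*-identityʳ _)) (*-congˡ z′≈) ⟩
        embed q * 1# + t * sum (λ i → embed (a i) * t ^ toℕ i)
          ≈⟨ +-congˡ (*-distribˡ-sum t (λ i → embed (a i) * t ^ toℕ i)) ⟩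
        embed q * 1# + sum (λ i → t * (embed (a i) * t ^ toℕ i))
          ≈⟨ +-congˡ (sum-cong-≋ (λ i → solve 3 (λ t a p → t :* (a :* p) := a :* (t :* p)) refl t (embed (a i)) (t ^ toℕ i))) ⟩
        sum (λ i → embed (c i) * t ^ toℕ i)                    ∎)

    monic-root : ∀ {t} n {z} → z ∈ Monic t n → z ≈ 0# → Root t
    monic-root n z∈ z≈0 =
      let a , top , z≈ = monic-sum n z∈ in
      root a (fromℕ n , λ eq → case-absurd (≡.trans (≡.sym top) eq)) (trans (sym z≈) z≈0)
      where
      case-absurd : 1ℚ ≢ 0ℚ
      case-absurd ()

    poly-monic : ∀ {t} n {z} → z ∈ Poly Image t n → t ^ suc n - z ∈ Monic t (suc n)
    poly-monic {t} zero {z} (q , z≈) = ℚ.- 1ℚ ℚ.* q , 1# , refl , (begin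
      t * 1# - z                          ≈⟨ +-congˡ (trans (-‿cong z≈) (sym (neg-homo q))) ⟩
      t * 1# + embed (ℚ.- 1ℚ ℚ.* q)       ≈⟨ +-comm _ _ ⟩
      embed (ℚ.- 1ℚ ℚ.* q) + t * 1#       ∎)
    poly-monic {t} (suc n) {z} (a , z′ , (q , a≈) , z′∈ , z≈) =
      ℚ.- 1ℚ ℚ.* q , t ^ suc n - z′ , poly-monic n z′∈ , (begin
        t * t ^ suc n - z                                    ≈⟨ +-congˡ (-‿cong (trans z≈ (+-congʳ a≈))) ⟩
        t * t ^ suc n - (embed q + t * z′)                   ≈⟨ solve 4 (λ t p e z → t :* p :- (e :+ t :* z) := (:- e) :+ t :* (p :- z)) refl t (t ^ suc n) (embed q) z′ ⟩
        - embed q + t * (t ^ suc n - z′)                     ≈⟨ +-congʳ (neg-homo q) ⟨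
        embed (ℚ.- 1ℚ ℚ.* q) + t * (t ^ suc n - z′)          ∎)

    integral⇒Root : ∀ {t} n → t ^ suc n ∈ Poly Image t n → Root t
    integral⇒Root n t∈ = monic-root (suc n) (poly-monic n t∈) (-‿inverseʳ _)

    0-Root : ∀ {t} → t ≈ 0# → Root t
    0-Root {t} = monic-root 1 (0ℚ , 1# , refl , sym (trans (+-congʳ 0-homo) (trans (+-identityˡ _) (*-identityʳ t))))

-- Algebraicity of the values over an abstract field

mkRawSemiring : {A : Set} → Rel A 0ℓ → Op₂ A → Op₂ A → A → A → RawSemiring 0ℓ 0ℓ
mkRawSemiring _≈_ _+_ _*_ 0# 1# = record { _≈_ = _≈_ ; _+_ = _+_ ; _*_ = _*_ ; 0# = 0# ; 1# = 1# }

mkCommutativeRing : {A : Set} {_≈_ : Rel A 0ℓ} {_+_ _*_ : Op₂ A} { -_ : Op₁ A} {0# 1# : A} →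
  IsCommutativeRing _≈_ _+_ _*_ -_ 0# 1# → CommutativeRing 0ℓ 0ℓ
mkCommutativeRing isCommutativeRing = record { isCommutativeRing = isCommutativeRing }

-- The field is passed as separate operations, and `sum` together with a proof that it is the usual
-- one, so that applying the module to ℂ leaves these operations as names instead of unfolding them.
module AlgebraicValues {A : Set} (_≈_ : Rel A 0ℓ) (_+_ _*_ : Op₂ A) (-_ : Op₁ A) (0# 1# : A)
  (isCommutativeRing : IsCommutativeRing _≈_ _+_ _*_ -_ 0# 1#)
  (invert : ∀ x → ¬ (x ≈ 0#) → ∃[ y ] (x * y) ≈ 1#)
  (sum : ∀ {n} → (Fin n → A) → A)
  (sum-def : ∀ n → RawSemiringDefinitions.sum (mkRawSemiring _≈_ _+_ _*_ 0# 1#) {n} ≡ sum {n})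
  (em : ExcludedMiddle 0ℓ) {p : ℕ} (p-prime : Prime p)
  {_∙_ : Op₂ (Fin p)} {ε : Fin p} {_⁻¹ : Op₁ (Fin p)} (isAbelianGroup : IsAbelianGroup _≡_ _∙_ ε _⁻¹) where

  private
    F : CommutativeRing 0ℓ 0ℓ
    F = mkCommutativeRing isCommutativeRing

  open CommutativeRingTools F using (trans; sym; reflexive; +-congˡ; *-congʳ)
  open Dilogarithm F em p-prime isAbelianGroup

  root-values : {embed : ℚ → A} → RationalImage.IsEmbedding (mkCommutativeRing isCommutativeRing) embed →
    {multiple : ℕ → Fin p} → IsEnumerated _∙_ ε multiple → (w w⁻ : Fin p → A) →
    (∀ x → (w x * w⁻ x) ≈ 1#) → (∀ x → w x ≈ w (x ⁻¹)) →
    (∀ x y z → ((w ((x ∙ y) ∙ z) * w⁻ (x ∙ y)) * w⁻ z) ≈ (((w (x ∙ z) * w⁻ x) * w⁻ z) * ((w (y ∙ z) * w⁻ y) * w⁻ z))) →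
    (∀ y → (∀ x → ((w (x ∙ y) * w⁻ x) * w⁻ y) ≈ 1#) → y ≡ ε) →
    (s s⁻¹ : A) → (s * s) ≈ embed (ℤ.+ p ℚ./ 1) → (s * s⁻¹) ≈ 1# → (E : Fin p → A) (κ : A) →
    (∀ x y → ((((w (x ∙ y) * w⁻ x) * w⁻ y) * E x) * E y) ≈
      (κ + (sum (λ z → ((E (y ∙ (z ⁻¹)) * E z) * w z) * E (x ∙ (z ⁻¹))) * s⁻¹))) →
    ∀ u → RationalImage.Root (mkCommutativeRing isCommutativeRing) embed (E u)
  root-values {embed} embedding enumerated w w⁻ w-inverse even χ-∙ˡ nondegenerate s s⁻¹ s²≈p ss⁻¹≈1 E κ functional u
    with em {RationalImage.Root F embed (E u)} | em {E u ≈ 0#}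
  ... | yes algebraic     | _        = algebraic
  -- The value 0 is treated apart: the place at infinity needs E(u) to be invertible.
  ... | no _              | yes Eu≈0 = RationalImage.0-Root F embed embedding Eu≈0
  ... | no transcendental | no Eu≉0  = contradiction
    (λ n t∈ → transcendental (integral⇒Root embedding n t∈))
    (no-transcendental invert enumerated (gaussian invert enumerated w-inverse (sym ∘ even) χ-∙ˡ nondegenerate)
      (trans s²≈p (sym (ι≈embed embedding p))) ss⁻¹≈1 {E} {κ}
      (λ x y → trans (functional x y) (+-congˡ (*-congʳ (reflexive (≡.sym (≡.cong (λ sum → sum _) (sum-def p)))))))
      (Image-subring embedding) (ι-inverse embedding) u (proj₂ (invert (E u) Eu≉0)))
    where open RationalImage F embed

open import Defs

-- The field ℂ

private
  open CommutativeRingTools ℚ.+-*-commutativeRing using (solve; _:+_; _:*_; _:-_; :-_; _:=_; con)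

  half-+ : ∀ ε → ε ℚ.* ½ ℚ.+ ε ℚ.* ½ ≡ ε
  half-+ ε = ≡.trans (≡.sym (ℚ.*-distribˡ-+ ε ½ ½)) (ℚ.*-identityʳ ε)

  half-pos : ∀ {ε} → 0ℚ ℚ.< ε → 0ℚ ℚ.< ε ℚ.* ½
  half-pos {ε} 0<ε = ≡.subst (ℚ._< ε ℚ.* ½) (ℚ.*-zeroˡ ½) (ℚ.*-monoˡ-<-pos ½ 0<ε)

  *-pos : ∀ {p q} → 0ℚ ℚ.< p → 0ℚ ℚ.< q → 0ℚ ℚ.< p ℚ.* q
  *-pos {p} {q} 0<p 0<q = ≡.subst (ℚ._< p ℚ.* q) (ℚ.*-zeroˡ q) (ℚ.*-monoˡ-<-pos q {{ℚ.positive 0<q}} 0<p)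

  divide : ∀ {ε B} → 0ℚ ℚ.< ε → 0ℚ ℚ.< B → ∃[ δ ] 0ℚ ℚ.< δ × B ℚ.* δ ≡ ε
  divide {ε} {B} 0<ε 0<B = ε ℚ.* (1/ B) , *-pos 0<ε (ℚ.positive⁻¹ (1/ B) {{ℚ.1/pos⇒pos B}}) ,
    ≡.trans (solve 3 (λ a b c → a :* (b :* c) := b :* (a :* c)) ≡.refl B ε (1/ B))
      (≡.trans (≡.cong (ε ℚ.*_) (ℚ.*-inverseʳ B)) (ℚ.*-identityʳ ε))
    where
    instance
      _ = ℚ.positive 0<B
      _ = ℚ.pos⇒nonZero B

  *-mono-≤ : ∀ {a b c d} → 0ℚ ℚ.≤ b → 0ℚ ℚ.≤ c → a ℚ.≤ b → c ℚ.≤ d → a ℚ.* c ℚ.≤ b ℚ.* d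
  *-mono-≤ {a} {b} {c} {d} 0≤b 0≤c a≤b c≤d = ℚ.≤-trans
    (ℚ.*-monoʳ-≤-nonNeg c {{ℚ.nonNegative 0≤c}} a≤b) (ℚ.*-monoˡ-≤-nonNeg b {{ℚ.nonNegative 0≤b}} c≤d)

Eventually : (ℕ → Set) → Set
Eventually P = ∃[ n₀ ] ∀ n → n₀ ℕ.≤ n → P n

private
  both : ∀ {P Q : ℕ → Set} → Eventually P → Eventually Q → Eventually (λ n → P n × Q n)
  both (a , p) (b , q) = a ℕ.⊔ b , λ n le → p n (ℕ.m⊔n≤o⇒m≤o a b le) , q n (ℕ.m⊔n≤o⇒n≤o a b le)

  eventually : ∀ {P Q : ℕ → Set} → (∀ n → P n → Q n) → Eventually P → Eventually Q
  eventually f (a , p) = a , λ n le → f n (p n le)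

Null : (ℕ → ℚ) → Set
Null f = ∀ {ε} → 0ℚ ℚ.< ε → Eventually (λ n → ∣ f n ∣ ℚ.< ε)

private
  Bounded : (ℕ → ℚ) → Set
  Bounded f = ∃[ B ] 0ℚ ℚ.< B × Eventually (λ n → ∣ f n ∣ ℚ.≤ B)

  null-≗ : ∀ {f g} → (∀ n → f n ≡ g n) → Null f → Null g
  null-≗ f≗g f-null 0<ε = eventually (λ n → ≡.subst (λ q → ∣ q ∣ ℚ.< _) (f≗g n)) (f-null 0<ε)

  null-0 : ∀ {f} → (∀ n → f n ≡ 0ℚ) → Null f
  null-0 f≗0 = null-≗ (λ n → ≡.sym (f≗0 n)) (λ 0<ε → 0 , λ _ _ → 0<ε)

  null-+ : ∀ {f g} → Null f → Null g → Null (λ n → f n ℚ.+ g n)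
  null-+ {f} {g} f-null g-null {ε} 0<ε = eventually
    (λ n (f< , g<) → ℚ.≤-<-trans (ℚ.∣p+q∣≤∣p∣+∣q∣ (f n) (g n))
      (≡.subst (∣ f n ∣ ℚ.+ ∣ g n ∣ ℚ.<_) (half-+ ε) (ℚ.+-mono-< f< g<)))
    (both (f-null (half-pos 0<ε)) (g-null (half-pos 0<ε)))

  null-neg : ∀ {f} → Null f → Null (λ n → ℚ.- f n)
  null-neg {f} f-null 0<ε = eventually (λ n → ≡.subst (ℚ._< _) (≡.sym (ℚ.∣-p∣≡∣p∣ (f n)))) (f-null 0<ε)

  null-* : ∀ {f g} → Bounded f → Null g → Null (λ n → f n ℚ.* g n)
  null-* {f} {g} (B , 0<B , f≤B) g-null {ε} 0<ε =
    let δ , 0<δ , Bδ≡ε = divide 0<ε 0<B in eventually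
      (λ n (f≤ , g<) → ≡.subst₂ ℚ._<_ (≡.sym (ℚ.∣p*q∣≡∣p∣*∣q∣ (f n) (g n))) Bδ≡ε
        (ℚ.≤-<-trans (ℚ.*-monoʳ-≤-nonNeg ∣ g n ∣ {{ℚ.∣-∣-nonNeg (g n)}} f≤)
          (ℚ.*-monoʳ-<-pos B {{ℚ.positive 0<B}} g<)))
      (both f≤B (g-null 0<δ))

  bounded : ∀ x → Bounded (seq x)
  bounded x =
    let a , close = cauchy x (ℚ.positive⁻¹ 1ℚ) in
    ∣ seq x a ∣ ℚ.+ 1ℚ , ℚ.+-mono-≤-< (ℚ.0≤∣p∣ (seq x a)) (ℚ.positive⁻¹ 1ℚ) , a , λ n a≤n →
      ℚ.≤-trans (ℚ.≤-reflexive (≡.cong ∣_∣ (solve 2 (λ a b → a := b :+ (a :- b)) ≡.refl (seq x n) (seq x a))))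
        (ℚ.≤-trans (ℚ.∣p+q∣≤∣p∣+∣q∣ (seq x a) (seq x n ℚ.- seq x a))
          (ℚ.+-monoʳ-≤ ∣ seq x a ∣ (ℚ.<⇒≤ (close n a a≤n ℕ.≤-refl))))

pointwise : ∀ {x y} → (∀ n → seq x n ≡ seq y n) → x ≈ℝ y
pointwise {x} {y} eq = mk≈ℝ (null-0 {λ n → seq x n ℚ.- seq y n}
  (λ n → ≡.trans (≡.cong (ℚ._- seq y n) (eq n)) (ℚ.+-inverseʳ (seq y n))))

private
  ≈ℝ-sym : ∀ {x y} → x ≈ℝ y → y ≈ℝ x
  ≈ℝ-sym {x} {y} x≈y = mk≈ℝ (null-≗ {λ n → ℚ.- (seq x n ℚ.- seq y n)} {λ n → seq y n ℚ.- seq x n}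
    (λ n → solve 2 (λ a b → :- (a :- b) := b :- a) ≡.refl (seq x n) (seq y n))
    (null-neg {λ n → seq x n ℚ.- seq y n} (converge x≈y)))

  ≈ℝ-trans : ∀ {x y z} → x ≈ℝ y → y ≈ℝ z → x ≈ℝ z
  ≈ℝ-trans {x} {y} {z} x≈y y≈z = mk≈ℝ (null-≗ {_} {λ n → seq x n ℚ.- seq z n}
    (λ n → solve 3 (λ a b c → (a :- b) :+ (b :- c) := a :- c) ≡.refl (seq x n) (seq y n) (seq z n))
    (null-+ {λ n → seq x n ℚ.- seq y n} {λ n → seq y n ℚ.- seq z n} (converge x≈y) (converge y≈z)))

  +ℝ-cong : ∀ {x y u v} → x ≈ℝ y → u ≈ℝ v → x +ℝ u ≈ℝ y +ℝ v
  +ℝ-cong {x} {y} {u} {v} x≈y u≈v = mk≈ℝ (null-≗ {_} {λ n → (seq x n ℚ.+ seq u n) ℚ.- (seq y n ℚ.+ seq v n)}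
    (λ n → solve 4 (λ a b c d → (a :- b) :+ (c :- d) := (a :+ c) :- (b :+ d)) ≡.refl (seq x n) (seq y n) (seq u n) (seq v n))
    (null-+ {λ n → seq x n ℚ.- seq y n} {λ n → seq u n ℚ.- seq v n} (converge x≈y) (converge u≈v)))

  -ℝ-cong : ∀ {x y} → x ≈ℝ y → -ℝ x ≈ℝ -ℝ y
  -ℝ-cong {x} {y} x≈y = mk≈ℝ (null-≗ {_} {λ n → ℚ.- seq x n ℚ.- (ℚ.- seq y n)}
    (λ n → solve 2 (λ a b → :- (a :- b) := :- a :- (:- b)) ≡.refl (seq x n) (seq y n))
    (null-neg {λ n → seq x n ℚ.- seq y n} (converge x≈y)))

  *ℝ-cong : ∀ {x y u v} → x ≈ℝ y → u ≈ℝ v → x *ℝ u ≈ℝ y *ℝ v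
  *ℝ-cong {x} {y} {u} {v} x≈y u≈v = mk≈ℝ (null-≗ {_} {λ n → seq x n ℚ.* seq u n ℚ.- seq y n ℚ.* seq v n}
    (λ n → solve 4 (λ a b c d → a :* (c :- d) :+ d :* (a :- b) := a :* c :- b :* d) ≡.refl (seq x n) (seq y n) (seq u n) (seq v n))
    (null-+ {λ n → seq x n ℚ.* (seq u n ℚ.- seq v n)} {λ n → seq v n ℚ.* (seq x n ℚ.- seq y n)}
      (null-* {seq x} (bounded x) (converge u≈v)) (null-* {seq v} (bounded v) (converge x≈y))))

private
  ≈-refl : ∀ {x} → x ≈ x
  ≈-refl = pointwise (λ _ → ≡.refl) , pointwise (λ _ → ≡.refl)

  ≈-sym : ∀ {x y} → x ≈ y → y ≈ x
  ≈-sym (r , i) = ≈ℝ-sym r , ≈ℝ-sym i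

  ≈-trans : ∀ {x y z} → x ≈ y → y ≈ z → x ≈ z
  ≈-trans (r , i) (r′ , i′) = ≈ℝ-trans r r′ , ≈ℝ-trans i i′

  +-cong : ∀ {x y u v} → x ≈ y → u ≈ v → x + u ≈ y + v
  +-cong {x} {y} {u} {v} (r , i) (r′ , i′) =
    +ℝ-cong {re x} {re y} {re u} {re v} r r′ , +ℝ-cong {im x} {im y} {im u} {im v} i i′

  neg-cong : ∀ {x y} → x ≈ y → - x ≈ - y
  neg-cong {x} {y} (r , i) = -ℝ-cong {re x} {re y} r , -ℝ-cong {im x} {im y} i

  *-cong : ∀ {x y u v} → x ≈ y → u ≈ v → x * u ≈ y * v
  *-cong {x} {y} {u} {v} (r , i) (r′ , i′) =
    +ℝ-cong {re x *ℝ re u} {re y *ℝ re v} { -ℝ (im x *ℝ im u)} { -ℝ (im y *ℝ im v)}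
      (*ℝ-cong {re x} {re y} {re u} {re v} r r′)
      (-ℝ-cong {im x *ℝ im u} {im y *ℝ im v} (*ℝ-cong {im x} {im y} {im u} {im v} i i′)) ,
    +ℝ-cong {re x *ℝ im u} {re y *ℝ im v} {im x *ℝ re u} {im y *ℝ re v}
      (*ℝ-cong {re x} {re y} {im u} {im v} r i′) (*ℝ-cong {im x} {im y} {re u} {re v} i r′)

-- Comparing two complex numbers up to conversion unfolds the operations of ℂ-rawRing down to the
-- Cauchy moduli. These copies are compared by name, and equations are carried over to them from
-- ℂ-rawRing by comparing only the sequences of rationals.
infixl 6 _⊕_
infixl 7 _⊗_
infix  8 ⊖_

_⊕_ _⊗_ : ℂ → ℂ → ℂ
x ⊕ y = x + y
x ⊗ y = x * y

⊖_ : ℂ → ℂ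
⊖ x = - x

ℂ-isCommutativeRing : IsCommutativeRing _≈ℂ_ _⊕_ _⊗_ ⊖_ 0# 1#
ℂ-isCommutativeRing = record
  { isRing = record
    { +-isAbelianGroup = record
      { isGroup = record
        { isMonoid = record
          { isSemigroup = record
            { isMagma = record
              { isEquivalence = record
                { refl  = λ {x} → ≈-refl {x}
                ; sym   = λ {x} {y} → ≈-sym {x} {y}
                ; trans = λ {x} {y} {z} → ≈-trans {x} {y} {z}
                }
              ; ∙-cong = λ {x} {y} {u} {v} → +-cong {x} {y} {u} {v}
              }
            ; assoc = λ x y z →
                pointwise (λ n → ℚ.+-assoc (seq (re x) n) (seq (re y) n) (seq (re z) n)) ,
                pointwise (λ n → ℚ.+-assoc (seq (im x) n) (seq (im y) n) (seq (im z) n))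
            }
          ; identity =
              (λ x → pointwise (λ n → ℚ.+-identityˡ (seq (re x) n)) , pointwise (λ n → ℚ.+-identityˡ (seq (im x) n))) ,
              (λ x → pointwise (λ n → ℚ.+-identityʳ (seq (re x) n)) , pointwise (λ n → ℚ.+-identityʳ (seq (im x) n)))
          }
        ; inverse =
            (λ x → pointwise (λ n → ℚ.+-inverseˡ (seq (re x) n)) , pointwise (λ n → ℚ.+-inverseˡ (seq (im x) n))) ,
            (λ x → pointwise (λ n → ℚ.+-inverseʳ (seq (re x) n)) , pointwise (λ n → ℚ.+-inverseʳ (seq (im x) n)))
        ; ⁻¹-cong = λ {x} {y} → neg-cong {x} {y}
        }
      ; comm = λ x y →
          pointwise (λ n → ℚ.+-comm (seq (re x) n) (seq (re y) n)) ,
          pointwise (λ n → ℚ.+-comm (seq (im x) n) (seq (im y) n))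
      }
    ; *-cong = λ {x} {y} {u} {v} → *-cong {x} {y} {u} {v}
    ; *-assoc = λ x y z →
        pointwise (λ n → solve 6 (λ a b c d e f →
          (a :* c :+ :- (b :* d)) :* e :+ :- ((a :* d :+ b :* c) :* f) :=
          a :* (c :* e :+ :- (d :* f)) :+ :- (b :* (c :* f :+ d :* e))) ≡.refl
          (seq (re x) n) (seq (im x) n) (seq (re y) n) (seq (im y) n) (seq (re z) n) (seq (im z) n)) ,
        pointwise (λ n → solve 6 (λ a b c d e f →
          (a :* c :+ :- (b :* d)) :* f :+ (a :* d :+ b :* c) :* e :=
          a :* (c :* f :+ d :* e) :+ b :* (c :* e :+ :- (d :* f))) ≡.refl
          (seq (re x) n) (seq (im x) n) (seq (re y) n) (seq (im y) n) (seq (re z) n) (seq (im z) n))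
    ; *-identity =
        (λ x →
          pointwise (λ n → solve 2 (λ a b → con ℤ.1ℤ :* a :+ :- (con ℤ.0ℤ :* b) := a) ≡.refl (seq (re x) n) (seq (im x) n)) ,
          pointwise (λ n → solve 2 (λ a b → con ℤ.1ℤ :* b :+ con ℤ.0ℤ :* a := b) ≡.refl (seq (re x) n) (seq (im x) n))) ,
        (λ x →
          pointwise (λ n → solve 2 (λ a b → a :* con ℤ.1ℤ :+ :- (b :* con ℤ.0ℤ) := a) ≡.refl (seq (re x) n) (seq (im x) n)) ,
          pointwise (λ n → solve 2 (λ a b → a :* con ℤ.0ℤ :+ b :* con ℤ.1ℤ := b) ≡.refl (seq (re x) n) (seq (im x) n)))
    ; distrib =
        (λ x y z →
          pointwise (λ n → solve 6 (λ a b c d e f →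
            a :* (c :+ e) :+ :- (b :* (d :+ f)) := (a :* c :+ :- (b :* d)) :+ (a :* e :+ :- (b :* f))) ≡.refl
            (seq (re x) n) (seq (im x) n) (seq (re y) n) (seq (im y) n) (seq (re z) n) (seq (im z) n)) ,
          pointwise (λ n → solve 6 (λ a b c d e f →
            a :* (d :+ f) :+ b :* (c :+ e) := (a :* d :+ b :* c) :+ (a :* f :+ b :* e)) ≡.refl
            (seq (re x) n) (seq (im x) n) (seq (re y) n) (seq (im y) n) (seq (re z) n) (seq (im z) n))) ,
        (λ x y z →
          pointwise (λ n → solve 6 (λ a b c d e f →
            (c :+ e) :* a :+ :- ((d :+ f) :* b) := (c :* a :+ :- (d :* b)) :+ (e :* a :+ :- (f :* b))) ≡.refl
            (seq (re x) n) (seq (im x) n) (seq (re y) n) (seq (im y) n) (seq (re z) n) (seq (im z) n)) ,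
          pointwise (λ n → solve 6 (λ a b c d e f →
            (c :+ e) :* b :+ (d :+ f) :* a := (c :* b :+ d :* a) :+ (e :* b :+ f :* a)) ≡.refl
            (seq (re x) n) (seq (im x) n) (seq (re y) n) (seq (im y) n) (seq (re z) n) (seq (im z) n)))
    }
  ; *-comm = λ x y →
      pointwise (λ n → solve 4 (λ a b c d → a :* c :+ :- (b :* d) := c :* a :+ :- (d :* b)) ≡.refl
        (seq (re x) n) (seq (im x) n) (seq (re y) n) (seq (im y) n)) ,
      pointwise (λ n → solve 4 (λ a b c d → a :* d :+ b :* c := c :* b :+ d :* a) ≡.refl
        (seq (re x) n) (seq (im x) n) (seq (re y) n) (seq (im y) n))
  }

-- Inverses in ℝ and ℂ

private
  AwayFrom0 : (ℕ → ℚ) → Set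
  AwayFrom0 f = ∃[ δ ] 0ℚ ℚ.< δ × Eventually (λ n → δ ℚ.≤ ∣ f n ∣)

  -- A single late term of size at least ε forces, by the Cauchy property, all late terms to have
  -- size at least ε/2. So a sequence that is not bounded away from 0 is null.
  away : ExcludedMiddle 0ℓ → ∀ x → ¬ Null (seq x) → AwayFrom0 (seq x)
  away em x ¬null with em {AwayFrom0 (seq x)}
  ... | yes p = p
  ... | no ¬p = ⊥-elim (¬null null)
    where
    null : Null (seq x)
    null {ε} 0<ε =
      let a , close = cauchy x (half-pos 0<ε) in
      a , λ n a≤n → ℚ.≰⇒> λ ε≤∣xn∣ → ¬p (ε ℚ.* ½ , half-pos 0<ε , a , λ m a≤m →
        let open ℚ.≤-Reasoning in begin
        ε ℚ.* ½
          ≡⟨ ≡.trans (solve 1 (λ a → a := (a :+ a) :- a) ≡.refl (ε ℚ.* ½)) (≡.cong (ℚ._- ε ℚ.* ½) (half-+ ε)) ⟩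
        ε ℚ.- ε ℚ.* ½
          ≤⟨ ℚ.+-mono-≤ ε≤∣xn∣ (ℚ.neg-antimono-≤ (ℚ.<⇒≤ (close n m a≤n a≤m))) ⟩
        ∣ seq x n ∣ ℚ.- ∣ seq x n ℚ.- seq x m ∣
          ≤⟨ ℚ.+-monoˡ-≤ (ℚ.- ∣ seq x n ℚ.- seq x m ∣)
               (ℚ.≤-trans (ℚ.≤-reflexive (≡.cong ∣_∣ (solve 2 (λ a b → a := b :+ (a :- b)) ≡.refl (seq x n) (seq x m))))
                 (ℚ.∣p+q∣≤∣p∣+∣q∣ (seq x m) (seq x n ℚ.- seq x m))) ⟩
        (∣ seq x m ∣ ℚ.+ ∣ seq x n ℚ.- seq x m ∣) ℚ.- ∣ seq x n ℚ.- seq x m ∣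
          ≡⟨ solve 2 (λ a b → (a :+ b) :- b := a) ≡.refl ∣ seq x m ∣ ∣ seq x n ℚ.- seq x m ∣ ⟩
        ∣ seq x m ∣ ∎)

  -- Extended by 0⁻¹ = 0.
  inv : ℚ → ℚ
  inv q with q ℚ.≟ 0ℚ
  ... | yes _  = 0ℚ
  ... | no q≢0 = (1/ q) {{ℚ.≢-nonZero q≢0}}

  *-inv : ∀ {q} → q ≢ 0ℚ → q ℚ.* inv q ≡ 1ℚ
  *-inv {q} q≢0 with q ℚ.≟ 0ℚ
  ... | yes q≡0 = contradiction q≡0 q≢0
  ... | no q≢0′ = ℚ.*-inverseʳ q {{ℚ.≢-nonZero q≢0′}}

  ≤∣∣⇒≢0 : ∀ {δ q} → 0ℚ ℚ.< δ → δ ℚ.≤ ∣ q ∣ → q ≢ 0ℚ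
  ≤∣∣⇒≢0 0<δ δ≤ ≡.refl = ℚ.<-irrefl ≡.refl (ℚ.<-≤-trans 0<δ δ≤)

  ∣inv∣≤ : ∀ {δ B q} → 0ℚ ℚ.< δ → 0ℚ ℚ.< B → δ ℚ.* B ≡ 1ℚ → δ ℚ.≤ ∣ q ∣ → ∣ inv q ∣ ℚ.≤ B
  ∣inv∣≤ {δ} {B} {q} 0<δ 0<B δB≡1 δ≤∣q∣ = begin
    ∣ inv q ∣                    ≡⟨ ℚ.*-identityʳ ∣ inv q ∣ ⟨
    ∣ inv q ∣ ℚ.* 1ℚ             ≡⟨ ≡.cong (∣ inv q ∣ ℚ.*_) δB≡1 ⟨
    ∣ inv q ∣ ℚ.* (δ ℚ.* B)      ≤⟨ ℚ.*-monoˡ-≤-nonNeg ∣ inv q ∣ {{ℚ.∣-∣-nonNeg (inv q)}}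
                                     (ℚ.*-monoʳ-≤-nonNeg B {{ℚ.nonNegative (ℚ.<⇒≤ 0<B)}} δ≤∣q∣) ⟩
    ∣ inv q ∣ ℚ.* (∣ q ∣ ℚ.* B)  ≡⟨ solve 3 (λ a b c → a :* (b :* c) := (b :* a) :* c) ≡.refl ∣ inv q ∣ ∣ q ∣ B ⟩
    (∣ q ∣ ℚ.* ∣ inv q ∣) ℚ.* B  ≡⟨ ≡.cong (ℚ._* B) (ℚ.∣p*q∣≡∣p∣*∣q∣ q (inv q)) ⟨
    ∣ q ℚ.* inv q ∣ ℚ.* B        ≡⟨ ≡.cong (λ p → ∣ p ∣ ℚ.* B) (*-inv (≤∣∣⇒≢0 0<δ δ≤∣q∣)) ⟩
    1ℚ ℚ.* B                     ≡⟨ ℚ.*-identityˡ B ⟩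
    B                            ∎
    where open ℚ.≤-Reasoning

  inv-difference : ∀ {p q} → p ≢ 0ℚ → q ≢ 0ℚ → inv p ℚ.- inv q ≡ (inv p ℚ.* inv q) ℚ.* (q ℚ.- p)
  inv-difference {p} {q} p≢0 q≢0 = begin
    inv p ℚ.- inv q
      ≡⟨ solve 2 (λ a b → a :- b := a :* con ℤ.1ℤ :- b :* con ℤ.1ℤ) ≡.refl (inv p) (inv q) ⟩
    inv p ℚ.* 1ℚ ℚ.- inv q ℚ.* 1ℚ
      ≡⟨ ≡.cong₂ (λ a b → inv p ℚ.* a ℚ.- inv q ℚ.* b) (*-inv q≢0) (*-inv p≢0) ⟨
    inv p ℚ.* (q ℚ.* inv q) ℚ.- inv q ℚ.* (p ℚ.* inv p)
      ≡⟨ solve 4 (λ a b p q → a :* (q :* b) :- b :* (p :* a) := (a :* b) :* (q :- p)) ≡.refl (inv p) (inv q) p q ⟩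
    (inv p ℚ.* inv q) ℚ.* (q ℚ.- p) ∎
    where open ≡.≡-Reasoning

  inverseℝ : ∀ x → AwayFrom0 (seq x) → ∃[ y ] x *ℝ y ≈ℝ fromℚ 1ℚ
  inverseℝ x (δ , 0<δ , a , δ≤) = y , mk≈ℝ xy-1-null
    where
    δ⁻¹ = divide (ℚ.positive⁻¹ 1ℚ) 0<δ
    B = proj₁ δ⁻¹
    0<B : 0ℚ ℚ.< B
    0<B = proj₁ (proj₂ δ⁻¹)
    inv≤B : ∀ n → a ℕ.≤ n → ∣ inv (seq x n) ∣ ℚ.≤ B
    inv≤B n a≤n = ∣inv∣≤ 0<δ 0<B (proj₂ (proj₂ δ⁻¹)) (δ≤ n a≤n)
    y : ℝ
    y .seq n = inv (seq x n)
    y .cauchy {ε} 0<ε =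
      let η , 0<η , BBη≡ε = divide 0<ε (*-pos 0<B 0<B)
          c , close       = cauchy x 0<η
      in a ℕ.⊔ c , λ m n le₁ le₂ →
        let p = seq x m
            q = seq x n
            a≤m = ℕ.m⊔n≤o⇒m≤o a c le₁
            a≤n = ℕ.m⊔n≤o⇒m≤o a c le₂
            open ℚ.≤-Reasoning
        in begin-strict
        ∣ inv p ℚ.- inv q ∣
          ≡⟨ ≡.cong ∣_∣ (inv-difference (≤∣∣⇒≢0 0<δ (δ≤ m a≤m)) (≤∣∣⇒≢0 0<δ (δ≤ n a≤n))) ⟩
        ∣ (inv p ℚ.* inv q) ℚ.* (q ℚ.- p) ∣
          ≡⟨ ≡.trans (ℚ.∣p*q∣≡∣p∣*∣q∣ (inv p ℚ.* inv q) (q ℚ.- p)) (≡.cong (ℚ._* ∣ q ℚ.- p ∣) (ℚ.∣p*q∣≡∣p∣*∣q∣ (inv p) (inv q))) ⟩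
        (∣ inv p ∣ ℚ.* ∣ inv q ∣) ℚ.* ∣ q ℚ.- p ∣
          ≤⟨ ℚ.*-monoʳ-≤-nonNeg ∣ q ℚ.- p ∣ {{ℚ.∣-∣-nonNeg (q ℚ.- p)}}
               (*-mono-≤ (ℚ.<⇒≤ 0<B) (ℚ.0≤∣p∣ (inv q)) (inv≤B m a≤m) (inv≤B n a≤n)) ⟩
        (B ℚ.* B) ℚ.* ∣ q ℚ.- p ∣
          <⟨ ℚ.*-monoʳ-<-pos (B ℚ.* B) {{ℚ.positive (*-pos 0<B 0<B)}}
               (close n m (ℕ.m⊔n≤o⇒n≤o a c le₂) (ℕ.m⊔n≤o⇒n≤o a c le₁)) ⟩
        (B ℚ.* B) ℚ.* η
          ≡⟨ BBη≡ε ⟩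
        ε ∎
    xy-1-null : Null (λ n → seq x n ℚ.* inv (seq x n) ℚ.- 1ℚ)
    xy-1-null {ε} 0<ε = a , λ n a≤n → ≡.subst (λ q → ∣ q ℚ.- 1ℚ ∣ ℚ.< ε)
      (≡.sym (*-inv (≤∣∣⇒≢0 0<δ (δ≤ n a≤n)))) 0<ε

  ∣q∣²≡q² : ∀ q → ∣ q ∣ ℚ.* ∣ q ∣ ≡ q ℚ.* q
  ∣q∣²≡q² q with ∣ q ∣ | ℚ.∣p∣≡p∨∣p∣≡-p q
  ... | _ | inj₁ ≡.refl = ≡.refl
  ... | _ | inj₂ ≡.refl = solve 1 (λ a → :- a :* :- a := a :* a) ≡.refl q

  0≤q² : ∀ q → 0ℚ ℚ.≤ q ℚ.* q
  0≤q² q = ≡.subst (0ℚ ℚ.≤_) (≡.trans (ℚ.∣p*q∣≡∣p∣*∣q∣ q q) (∣q∣²≡q² q)) (ℚ.0≤∣p∣ (q ℚ.* q))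

  -- Squares of rationals are nonnegative, so |f| ≥ ε would give f² + g² ≥ ε².
  null-√ : ∀ {f g : ℕ → ℚ} → Null (λ n → f n ℚ.* f n ℚ.+ g n ℚ.* g n) → Null f
  null-√ {f} {g} f²+g²-null {ε} 0<ε = eventually {λ n → ∣ f n ℚ.* f n ℚ.+ g n ℚ.* g n ∣ ℚ.< ε ℚ.* ε}
    (λ n f²+g²< → ℚ.≰⇒> λ ε≤∣f∣ → ℚ.<-irrefl ≡.refl (ℚ.<-≤-trans f²+g²< (begin
      ε ℚ.* ε                             ≤⟨ *-mono-≤ (ℚ.0≤∣p∣ (f n)) (ℚ.<⇒≤ 0<ε) ε≤∣f∣ ε≤∣f∣ ⟩
      ∣ f n ∣ ℚ.* ∣ f n ∣                 ≡⟨ ∣q∣²≡q² (f n) ⟩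
      f n ℚ.* f n                         ≡⟨ ℚ.+-identityʳ (f n ℚ.* f n) ⟨
      f n ℚ.* f n ℚ.+ 0ℚ                  ≤⟨ ℚ.+-monoʳ-≤ (f n ℚ.* f n) (0≤q² (g n)) ⟩
      f n ℚ.* f n ℚ.+ g n ℚ.* g n         ≡⟨ ℚ.0≤p⇒∣p∣≡p {f n ℚ.* f n ℚ.+ g n ℚ.* g n} (ℚ.+-mono-≤ (0≤q² (f n)) (0≤q² (g n))) ⟨
      ∣ f n ℚ.* f n ℚ.+ g n ℚ.* g n ∣     ∎)))
    (f²+g²-null (*-pos 0<ε 0<ε))
    where open ℚ.≤-Reasoning

-- The conjugate of z divided by the squared modulus.
ℂ-inverse : ExcludedMiddle 0ℓ → ∀ z → ¬ z ≈ℂ 0# → ∃[ w ] z ⊗ w ≈ℂ 1#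
ℂ-inverse em z z≉0 =
  let y , xy≈1 = inverseℝ x (away em x ¬null) in
  ((re z *ℝ y) +i (-ℝ (im z *ℝ y))) ,
  (≈ℝ-trans (pointwise (λ n → solve 3 (λ a b c →
      a :* (a :* c) :+ :- (b :* :- (b :* c)) := (a :* a :+ b :* b) :* c) ≡.refl (seq (re z) n) (seq (im z) n) (seq y n))) xy≈1 ,
   pointwise (λ n → solve 3 (λ a b c → a :* :- (b :* c) :+ b :* (a :* c) := con ℤ.0ℤ) ≡.refl
      (seq (re z) n) (seq (im z) n) (seq y n)))
  where
  x : ℝ
  x = re z *ℝ re z +ℝ im z *ℝ im z
  ≈ℝ0 : ∀ {x} → Null (seq x) → x ≈ℝ fromℚ 0ℚ
  ≈ℝ0 {x} x-null = mk≈ℝ (null-≗ {seq x} {λ n → seq x n ℚ.- 0ℚ} (λ n → solve 1 (λ a → a := a :- con ℤ.0ℤ) ≡.refl (seq x n)) x-null)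
  ¬null : ¬ Null (seq x)
  ¬null x-null = z≉0
    (≈ℝ0 {re z} (null-√ {seq (re z)} {seq (im z)} x-null) ,
     ≈ℝ0 {im z} (null-√ {seq (im z)} {seq (re z)} (null-≗ {seq x} {λ n → seq (im z) n ℚ.* seq (im z) n ℚ.+ seq (re z) n ℚ.* seq (re z) n}
       (λ n → ℚ.+-comm (seq (re z) n ℚ.* seq (re z) n) (seq (im z) n ℚ.* seq (im z) n)) x-null)))

-- Rational numbers, the square root of the order, and the cyclic group ℤ/p

rationalℂ-+ : ∀ p q → rationalℂ (p ℚ.+ q) ≈ℂ rationalℂ p ⊕ rationalℂ q
rationalℂ-+ p q = pointwise (λ _ → ≡.refl) , pointwise (λ _ → ≡.refl)

rationalℂ-* : ∀ p q → rationalℂ (p ℚ.* q) ≈ℂ rationalℂ p ⊗ rationalℂ q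
rationalℂ-* p q =
  pointwise (λ _ → solve 2 (λ p q → p :* q := p :* q :+ :- (con ℤ.0ℤ :* con ℤ.0ℤ)) ≡.refl p q) ,
  pointwise (λ _ → solve 2 (λ p q → con ℤ.0ℤ := p :* con ℤ.0ℤ :+ con ℤ.0ℤ :* q) ≡.refl p q)

√order² : (G : FiniteAbelianGroup) →
  value (FiniteAbelianGroup.√order G) ⊗ value (FiniteAbelianGroup.√order G) ≈ℂ rationalℂ (ℤ.+ FiniteAbelianGroup.order G ℚ./ 1)
√order² G =
  mk≈ℝ (null-≗ {λ k → r k ℚ.* r k ℚ.- q} {λ k → (r k ℚ.* r k ℚ.+ ℚ.- (0ℚ ℚ.* 0ℚ)) ℚ.- q}
    (λ k → solve 2 (λ s q → s :* s :- q := (s :* s :+ :- (con ℤ.0ℤ :* con ℤ.0ℤ)) :- q) ≡.refl (r k) q)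
    (√-seq² q)) ,
  pointwise (λ k → solve 1 (λ s → s :* con ℤ.0ℤ :+ con ℤ.0ℤ :* s := con ℤ.0ℤ) ≡.refl (r k))
  where
  open FiniteAbelianGroup G
  q = ℤ.+ order ℚ./ 1
  instance
    _ = ℚ.pos⇒nonNeg q {{ℚ.normalize-pos order 1}}
  r : ℕ → ℚ
  r = root q

module _ (p : ℕ) .{{_ : NonZero p}} where

  private
    module G = FiniteAbelianGroup (ℤ/ p ℤ)

    toℕ-mod : ∀ m → toℕ (m mod p) ≡ m % p
    toℕ-mod m = Fin.toℕ-fromℕ< (m%n<n m p)

    mod-cong : ∀ {k m} → k % p ≡ m % p → k mod p ≡ m mod p
    mod-cong {k} {m} eq = Fin.toℕ-injective (≡.trans (toℕ-mod k) (≡.trans eq (≡.sym (toℕ-mod m))))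

  mod-enumerated : IsEnumerated G._∙_ G.ε (_mod p)
  mod-enumerated = record
    { multiple-0   = ≡.refl
    ; multiple-suc = λ m → mod-cong (≡.trans (%-distribˡ-+ 1 m p)
        (≡.cong₂ (λ a b → (a ℕ.+ b) % p) (≡.sym (toℕ-mod 1)) (≡.sym (toℕ-mod m))))
    ; multiple-p   = mod-cong (≡.trans (n%n≡0 p) (≡.sym (m<n⇒m%n≡m (ℕ.>-nonZero⁻¹ p))))
    ; multiple-toℕ = λ i → Fin.toℕ-injective (≡.trans (toℕ-mod (toℕ i)) (m<n⇒m%n≡m (Fin.toℕ<n i)))
    }

-- Transfer between the abstract field and the given operations of ℂ

private
  module R = CommutativeRingTools (mkCommutativeRing ℂ-isCommutativeRing)

infix 4 _≗ℂ_

_≗ℂ_ : ℂ → ℂ → Set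
x ≗ℂ y = (∀ n → seq (re x) n ≡ seq (re y) n) × (∀ n → seq (im x) n ≡ seq (im y) n)

≗⇒≈ : ∀ {x y} → x ≗ℂ y → x ≈ℂ y
≗⇒≈ {x} {y} (re≗ , im≗) = pointwise {re x} {re y} re≗ , pointwise {im x} {im y} im≗

reshape : ∀ {x y} x′ y′ → x ≈ℂ y → x′ ≗ℂ x → y ≗ℂ y′ → x′ ≈ℂ y′
reshape {x} {y} x′ y′ x≈y x′≗x y≗y′ =
  R.trans {x′} {x} {y′} (≗⇒≈ {x′} {x} x′≗x) (R.trans {x} {y} {y′} x≈y (≗⇒≈ {y} {y′} y≗y′))

∑ℂ : ∀ {n} → (Fin n → ℂ) → ℂ
∑ℂ {n} f = R.sum {n} f

∑ℂ-def : ∀ n → RawSemiringDefinitions.sum (mkRawSemiring _≈ℂ_ _⊕_ _⊗_ 0# 1#) {n} ≡ ∑ℂ {n}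
∑ℂ-def n = ≡.refl

∑ℂ-cong : ∀ {n} {f g : Fin n → ℂ} → (∀ i → f i ≈ℂ g i) → ∑ℂ f ≈ℂ ∑ℂ g
∑ℂ-cong {n} {f} {g} f≈g = R.sum-cong-≋ {n} {f} {g} f≈g

private
  ⊕⊗-cong : ∀ k {a b} u → a ≈ℂ b → k ⊕ (a ⊗ u) ≈ℂ k ⊕ (b ⊗ u)
  ⊕⊗-cong k {a} {b} u a≈b = R.+-cong {k} {k} {a ⊗ u} {b ⊗ u} (R.refl {k}) (R.*-cong {a} {b} {u} {u} a≈b (R.refl {u}))

  reshape-∑ : ∀ {n x y} {f : Fin n → ℂ} x′ k (g : Fin n → ℂ) u → x ≈ℂ y →
    x′ ≗ℂ x → y ≗ℂ k ⊕ (∑ℂ f ⊗ u) → ∑ℂ f ≈ℂ ∑ℂ g → x′ ≈ℂ k ⊕ (∑ℂ g ⊗ u)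
  reshape-∑ {n} {x} {y} {f} x′ k g u x≈y x′≗x y≗ f≈g =
    let x′≈   = reshape {x} {y} x′ (k ⊕ (∑ℂ f ⊗ u)) x≈y x′≗x y≗
        sums  = ⊕⊗-cong k {∑ℂ f} {∑ℂ g} u f≈g
        x′≈′  = R.trans {x′} {k ⊕ (∑ℂ f ⊗ u)} {k ⊕ (∑ℂ g ⊗ u)} x′≈ sums
    in x′≈′

  head-tail-≈0 : ∀ {n x} {t t′ : Fin n → ℂ} h → x ≈ℂ 0# → h ⊕ ∑ℂ t ≗ℂ x → (∀ i → t′ i ≈ℂ t i) → h ⊕ ∑ℂ t′ ≈ℂ 0#
  head-tail-≈0 {n} {x} {t} {t′} h x≈0 ≗x t′≈t =
    let sums  = R.+-cong {h} {h} {∑ℂ t′} {∑ℂ t} (R.refl {h}) (∑ℂ-cong {n} {t′} {t} t′≈t)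
        h+t≈0 = reshape (h ⊕ ∑ℂ t) 0# x≈0 ≗x ((λ _ → ≡.refl) , λ _ → ≡.refl)
        h+t′≈0 = R.trans {h ⊕ ∑ℂ t′} {h ⊕ ∑ℂ t} {0#} sums h+t≈0
    in h+t′≈0

  re-≈0 : ∀ {n x} {t t′ : Fin n → ℂ} h → x ≈ℂ 0# → h ⊕ ∑ℂ t ≗ℂ x → (∀ i → t′ i ≈ℂ t i) →
    Null (λ n → seq (re (h ⊕ ∑ℂ t′)) n ℚ.- 0ℚ)
  re-≈0 {n} {x} {t} {t′} h x≈0 ≗x t′≈t = let eq = head-tail-≈0 {n} {x} {t} {t′} h x≈0 ≗x t′≈t in converge (re≈ eq)

  im-≈0 : ∀ {n x} {t t′ : Fin n → ℂ} h → x ≈ℂ 0# → h ⊕ ∑ℂ t ≗ℂ x → (∀ i → t′ i ≈ℂ t i) →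
    Null (λ n → seq (im (h ⊕ ∑ℂ t′)) n ℚ.- 0ℚ)
  im-≈0 {n} {x} {t} {t′} h x≈0 ≗x t′≈t = let eq = head-tail-≈0 {n} {x} {t} {t′} h x≈0 ≗x t′≈t in converge (im≈ eq)

-- The two sums have the same approximating sequences. Passing to real and imaginary parts as null
-- sequences leaves only rationals to compare.
Root⇒IsAlgebraic : ∀ {z} → RationalImage.Root (mkCommutativeRing ℂ-isCommutativeRing) rationalℂ z → IsAlgebraic z
Root⇒IsAlgebraic (RationalImage.root {d} a nonzero eq) = d , a , nonzero ,
  (mk≈ℝ (re-≈0 {d} (rationalℂ (a zero) ⊗ 1#) eq ((λ _ → ≡.refl) , λ _ → ≡.refl) λ _ → ≗⇒≈ ((λ _ → ≡.refl) , λ _ → ≡.refl)) ,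
   mk≈ℝ (im-≈0 {d} (rationalℂ (a zero) ⊗ 1#) eq ((λ _ → ≡.refl) , λ _ → ≡.refl) λ _ → ≗⇒≈ ((λ _ → ≡.refl) , λ _ → ≡.refl)))

ℂ-embedding : RationalImage.IsEmbedding (mkCommutativeRing ℂ-isCommutativeRing) rationalℂ
ℂ-embedding = record { 1-homo = R.refl {1#} ; +-homo = rationalℂ-+ ; *-homo = rationalℂ-* }

*-unit : (u : ℂˣ) → value u ⊗ inverse u ≈ℂ 1#
*-unit u = value*inverse u

module _ (G : FiniteAbelianGroup) (M : MetricStructure G) where
  open FiniteAbelianGroup using (Carrier; _∙_; ε; _⁻¹)

  w w⁻ : Carrier G → ℂ
  w x = value (MetricStructure.⟨_⟩ M x)
  w⁻ x = inverse (MetricStructure.⟨_⟩ M x)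

  w-inverse : ∀ x → w x ⊗ w⁻ x ≈ℂ 1#
  w-inverse x =
    let eq = value*inverse (MetricStructure.⟨_⟩ M x)
    in reshape (w x ⊗ w⁻ x) 1# eq ((λ _ → ≡.refl) , λ _ → ≡.refl) ((λ _ → ≡.refl) , λ _ → ≡.refl)

  w-even : ∀ x → w x ≈ℂ w (_⁻¹ G x)
  w-even = MetricStructure.even M

  χ-∙ˡ : ∀ x y z → (w (_∙_ G (_∙_ G x y) z) ⊗ w⁻ (_∙_ G x y)) ⊗ w⁻ z ≈ℂ
    ((w (_∙_ G x z) ⊗ w⁻ x) ⊗ w⁻ z) ⊗ ((w (_∙_ G y z) ⊗ w⁻ y) ⊗ w⁻ z)
  χ-∙ˡ x y z =
    let eq = IsBicharacter.multiplicativeˡ (MetricStructure.bicharacter M) x y z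
    in reshape ((w (_∙_ G (_∙_ G x y) z) ⊗ w⁻ (_∙_ G x y)) ⊗ w⁻ z)
         (((w (_∙_ G x z) ⊗ w⁻ x) ⊗ w⁻ z) ⊗ ((w (_∙_ G y z) ⊗ w⁻ y) ⊗ w⁻ z))
         eq ((λ _ → ≡.refl) , λ _ → ≡.refl) ((λ _ → ≡.refl) , λ _ → ≡.refl)

  χ-nondegenerate : ∀ y → (∀ x → (w (_∙_ G x y) ⊗ w⁻ x) ⊗ w⁻ y ≈ℂ 1#) → y ≡ ε G
  χ-nondegenerate y χ≈1 = IsNondegenerate.nondegenerateʳ (MetricStructure.nondegenerate M) y λ x →
    let eq = χ≈1 x in reshape _ 1# eq ((λ _ → ≡.refl) , λ _ → ≡.refl) ((λ _ → ≡.refl) , λ _ → ≡.refl)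

module _ (p : ℕ) (p≢0 : NonZero p) (M : MetricStructure (ℤ/_ℤ p {{p≢0}})) where
  open FiniteAbelianGroup using (_∙_; ε; _⁻¹; √order; isAbelianGroup)
  open IsFiniteQuantumDilogarithm using (functional)

  functional-⊗ : ∀ {E : Fin p → ℂ} (D : IsFiniteQuantumDilogarithm (ℤ/_ℤ p {{p≢0}}) M E) → ∀ x y →
    let G = ℤ/_ℤ p {{p≢0}} in
    (((w G M (_∙_ G x y) ⊗ w⁻ G M x) ⊗ w⁻ G M y) ⊗ E x) ⊗ E y ≈ℂ
      value (IsFiniteQuantumDilogarithm.C D) ⊕
      (∑ℂ (λ z → ((E (_∙_ G y (_⁻¹ G z)) ⊗ E z) ⊗ w G M z) ⊗ E (_∙_ G x (_⁻¹ G z))) ⊗ inverse (√order G))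
  functional-⊗ {E} D x y =
    let G   = ℤ/_ℤ p {{p≢0}}
        eq  = functional D x y
        eq′ = reshape-∑ {p} ((((w G M (_∙_ G x y) ⊗ w⁻ G M x) ⊗ w⁻ G M y) ⊗ E x) ⊗ E y)
          (value (IsFiniteQuantumDilogarithm.C D))
          (λ z → ((E (_∙_ G y (_⁻¹ G z)) ⊗ E z) ⊗ w G M z) ⊗ E (_∙_ G x (_⁻¹ G z))) (inverse (√order G))
          eq ((λ _ → ≡.refl) , λ _ → ≡.refl) ((λ _ → ≡.refl) , λ _ → ≡.refl)
          (∑ℂ-cong {p} λ _ → ≗⇒≈ ((λ _ → ≡.refl) , λ _ → ≡.refl))
    in eq′

  values-algebraic : ExcludedMiddle 0ℓ → Prime p → (E : Fin p → ℂ) →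
    IsFiniteQuantumDilogarithm (ℤ/_ℤ p {{p≢0}}) M E → ∀ u → IsAlgebraic (E u)
  values-algebraic em p-prime E D u =
    let G      = ℤ/_ℤ p {{p≢0}}
        square = √order² G
        root   = AlgebraicValues.root-values _≈ℂ_ _⊕_ _⊗_ ⊖_ 0# 1# ℂ-isCommutativeRing (ℂ-inverse em) ∑ℂ ∑ℂ-def em p-prime
          {_∙_ G} {ε G} {_⁻¹ G} (isAbelianGroup G) {rationalℂ} ℂ-embedding {λ m → _mod_ m p {{p≢0}}} (mod-enumerated p {{p≢0}})
          (w G M) (w⁻ G M) (w-inverse G M) (w-even G M) (χ-∙ˡ G M) (χ-nondegenerate G M)
          (value (√order G)) (inverse (√order G)) square (*-unit (√order G))
          E (value (IsFiniteQuantumDilogarithm.C D)) (functional-⊗ {E} D) u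
    in Root⇒IsAlgebraic {E u} root

theorem9 : ExcludedMiddle 0ℓ →
    (p : ℕ) (p-prime : Prime p) →
    (M : MetricStructure (ℤ/_ℤ p {{prime⇒nonZero p-prime}})) →
    (E : Fin p → ℂ) →
    IsFiniteQuantumDilogarithm (ℤ/_ℤ p {{prime⇒nonZero p-prime}}) M E →
    (u : Fin p) → IsAlgebraic (E u)
theorem9 em p p-prime M E D =
  let values = values-algebraic p (prime⇒nonZero p-prime) M em p-prime E D in values
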